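{- For each integer $\alpha \geq 5$, let \[ \Gamma_1 = \Gamma^{2^{\alpha-1}, 2^{\alpha}}(-1 + 2^{\alpha-2},\ -3 + 2^{\alpha-2},\ 1 + 2^{\alpha-2},\ 3 + 2^{\alpha-2}), \qquad \Gamma_2 = \Gamma^{2^{\alpha}, 8}(-1 + 2^{\alpha-2},\ -3,\ 1 + 2^{\alpha-2},\ 3). \] Then the mix $\Gamma_1 \diamond \Gamma_2$ is the automorphism group of a tight chiral polyhedron of type $\{2^{\alpha}, 2^{\alpha}\}$.
   Context: For integers $p,q,i_1,j_1,i_2,j_2$, $\Gamma^{p,q}(i_1,j_1,i_2,j_2)$ denotes the group with presentation $\langle \sigma_1,\sigma_2 \mid \sigma_1^p=\sigma_2^q=(\sigma_1\sigma_2)^2=1,\ \sigma_2^{ -1}\sigma_1=\sigma_1^{i_1}\sigma_2^{j_1},\ \sigma_2\sigma_1^{ -1}=\sigma_1^{i_2}\sigma_2^{j_2}\rangle$. For groups $\Gamma=\langle\sigma_1,\sigma_2\rangle$ and $\Gamma'=\langle\sigma_1',\sigma_2'\rangle$, the mix $\Gamma\diamond\Gamma'$ is the subgroup of $\Gamma\times\Gamma'$ generated by $\alpha_1=(\sigma_1,\sigma_1')$ and $\alpha_2=(\sigma_2,\sigma_2')$, with distinguished generators $\alpha_1,\alpha_2$. An (abstract) polyhedron is a partially ordered set whose elements have rank $0$, $1$, $2$ (vertices, edges, faces), incidence meaning comparability, such that every edge is incident to exactly two vertices and two faces, whenever a vertex is incident to a face exactly two edges are incident to both, the incidence graph is connected,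 and for each vertex or face the subgraph of the incidence graph induced on its neighbours is connected. A flag is a mutually incident (vertex, edge, face) triple; $\Phi^i$ is the flag differing from $\Phi$ exactly in its rank-$i$ element. Type $\{p,q\}$: faces are incident to $p$ edges and vertices to $q$ edges. The polyhedron is chiral if its flags split into two classes with $\Phi,\Phi^i$ always in different classes and the automorphism group transitive on each class but not on all flags; then, fixing a base flag $\Phi$, the automorphism group is generated by $\sigma_1:\Phi\mapsto(\Phi^1)^0$ and $\sigma_2:\Phi\mapsto(\Phi^2)^1$. A group with two distinguished generators "is the automorphism group of" such a polyhedron if there is an isomorphism onto it sending the distinguished generators to $\sigma_1,\sigma_2$ respectively. A polyhedron of type $\{p,q\}$ is tight if it has exactly $2pq$ flags. -}

module Defs where

open import Data.Nat using (ℕ; suc; _*_; _^_; _∸_)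
open import Data.Integer as ℤ using (ℤ; +_; -[1+_])
open import Data.Bool using (Bool; true; false; not)
open import Data.List using (List; []; _∷_; _++_; replicate)
open import Data.Product using (Σ; _×_; _,_; ∃)
open import Data.Sum using (_⊎_; inj₁; inj₂)
open import Data.Fin using (Fin)
open import Data.Empty using (⊥)
open import Data.Unit using (⊤)
open import Relation.Binary.PropositionalEquality using (_≡_; _≢_; trans)
open import Relation.Nullary using (¬_)
open import Function.Bundles using (_↔_; _⇔_)

data Gen : Set where
  s₁ s₂ : Gen

-- a letter is a generator together with a flag: true = inverse
Letter : Set
Letter = Gen × Bool

-- a word x₁ x₂ … xₙ denotes the product x₁ x₂ ⋯ xₙ (leftmost = leftmost factor)
Word : Set
Word = List Letter

inv : Letter → Letter
inv (g , b) = (g , not b)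

pow : Gen → ℤ → Word
pow g (+ n)      = replicate n (g , false)
pow g -[1+ n ]   = replicate (suc n) (g , true)

data GammaRel (p q : ℕ) (i₁ j₁ i₂ j₂ : ℤ) : Word → Word → Set where
  rel-p   : GammaRel p q i₁ j₁ i₂ j₂ (pow s₁ (+ p)) []
  rel-q   : GammaRel p q i₁ j₁ i₂ j₂ (pow s₂ (+ q)) []
  rel-12  : GammaRel p q i₁ j₁ i₂ j₂
              ((s₁ , false) ∷ (s₂ , false) ∷ (s₁ , false) ∷ (s₂ , false) ∷ []) []
  rel-1   : GammaRel p q i₁ j₁ i₂ j₂
              ((s₂ , true) ∷ (s₁ , false) ∷ []) (pow s₁ i₁ ++ pow s₂ j₁)
  rel-2   : GammaRel p q i₁ j₁ i₂ j₂
              ((s₂ , false) ∷ (s₁ , true) ∷ []) (pow s₁ i₂ ++ pow s₂ j₂)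

-- the congruence on words generated by free cancellation and the relations R:
-- PresEq R u v  iff  u and v represent the same element of ⟨ s₁ , s₂ ∣ R ⟩
data PresEq (R : Word → Word → Set) : Word → Word → Set where
  ≈-refl   : ∀ {u} → PresEq R u u
  ≈-sym    : ∀ {u v} → PresEq R u v → PresEq R v u
  ≈-trans  : ∀ {u v w} → PresEq R u v → PresEq R v w → PresEq R u w
  ≈-cong   : ∀ {u u′ v v′} → PresEq R u u′ → PresEq R v v′ →
             PresEq R (u ++ v) (u′ ++ v′)
  ≈-cancel : ∀ x → PresEq R (x ∷ inv x ∷ []) []
  ≈-rel    : ∀ {u v} → R u v → PresEq R u v

Γ : (p q : ℕ) (i₁ j₁ i₂ j₂ : ℤ) → Word → Word → Set
Γ p q i₁ j₁ i₂ j₂ = PresEq (GammaRel p q i₁ j₁ i₂ j₂)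

-- The mix Γ ◇ Γ′ ⊆ Γ × Γ′ is the image of the free group on α₁, α₂ under
-- αᵢ ↦ (σᵢ , σᵢ′); two words represent the same element of the mix iff
-- they are equal in both Γ and Γ′.
Mix : (Word → Word → Set) → (Word → Word → Set) → Word → Word → Set
Mix E E′ u v = E u v × E′ u v

record Poset3 : Set₁ where
  field
    V E F : Set
    VE : V → E → Bool
    EF : E → F → Bool
    VF : V → F → Bool
    VEF-trans : ∀ v e f → VE v e ≡ true → EF e f ≡ true → VF v f ≡ true

module _ (P : Poset3) where
  open Poset3 P

  Elt : Set
  Elt = V ⊎ (E ⊎ F)

  Inc : Elt → Elt → Set
  Inc (inj₁ v)        (inj₁ _)        = ⊥
  Inc (inj₁ v)        (inj₂ (inj₁ e)) = VE v e ≡ true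
  Inc (inj₁ v)        (inj₂ (inj₂ f)) = VF v f ≡ true
  Inc (inj₂ (inj₁ e)) (inj₁ v)        = VE v e ≡ true
  Inc (inj₂ (inj₁ e)) (inj₂ (inj₁ _)) = ⊥
  Inc (inj₂ (inj₁ e)) (inj₂ (inj₂ f)) = EF e f ≡ true
  Inc (inj₂ (inj₂ f)) (inj₁ v)        = VF v f ≡ true
  Inc (inj₂ (inj₂ f)) (inj₂ (inj₁ e)) = EF e f ≡ true
  Inc (inj₂ (inj₂ f)) (inj₂ (inj₂ _)) = ⊥

  data Reach (S : Elt → Set) : Elt → Elt → Set where
    here : ∀ {x} → Reach S x x
    step : ∀ {x y z} → Inc x y → S y → Reach S y z → Reach S x z

  ConnectedOn : (Elt → Set) → Set
  ConnectedOn S = ∀ x y → S x → S y → Reach S x y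

  record IsPolyhedron : Set where
    field
      edge-two-vertices : ∀ e → Σ V (λ v → VE v e ≡ true) ↔ Fin 2
      edge-two-faces    : ∀ e → Σ F (λ f → EF e f ≡ true) ↔ Fin 2
      diamond           : ∀ v f → VF v f ≡ true →
                          Σ E (λ e → VE v e ≡ true × EF e f ≡ true) ↔ Fin 2
      connected         : ConnectedOn (λ _ → ⊤)
      vertex-connected  : ∀ v → ConnectedOn (Inc (inj₁ v))
      face-connected    : ∀ f → ConnectedOn (Inc (inj₂ (inj₂ f)))

  HasType : ℕ → ℕ → Set
  HasType p q = (∀ f → Σ E (λ e → EF e f ≡ true) ↔ Fin p)
              × (∀ v → Σ E (λ e → VE v e ≡ true) ↔ Fin q)

  record Flag : Set where
    constructor flag
    field
      fv : V
      fe : E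
      ff : F
      ve : VE fv fe ≡ true
      ef : EF fe ff ≡ true
  open Flag

  FlagEq : Flag → Flag → Set
  FlagEq Φ Ψ = fv Φ ≡ fv Ψ × fe Φ ≡ fe Ψ × ff Φ ≡ ff Ψ

  Adj₀ Adj₁ Adj₂ : Flag → Flag → Set
  Adj₀ Φ Ψ = fv Φ ≢ fv Ψ × fe Φ ≡ fe Ψ × ff Φ ≡ ff Ψ
  Adj₁ Φ Ψ = fv Φ ≡ fv Ψ × fe Φ ≢ fe Ψ × ff Φ ≡ ff Ψ
  Adj₂ Φ Ψ = fv Φ ≡ fv Ψ × fe Φ ≡ fe Ψ × ff Φ ≢ ff Ψ

  Tight : ℕ → ℕ → Set
  Tight p q = Flag ↔ Fin (2 * p * q)

  record Aut : Set where
    field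
      mV : V → V
      mE : E → E
      mF : F → F
      iV : V → V
      iE : E → E
      iF : F → F
      iV-l : ∀ x → iV (mV x) ≡ x
      iV-r : ∀ x → mV (iV x) ≡ x
      iE-l : ∀ x → iE (mE x) ≡ x
      iE-r : ∀ x → mE (iE x) ≡ x
      iF-l : ∀ x → iF (mF x) ≡ x
      iF-r : ∀ x → mF (iF x) ≡ x
      pres-VE : ∀ v e → VE (mV v) (mE e) ≡ VE v e
      pres-EF : ∀ e f → EF (mE e) (mF f) ≡ EF e f
      pres-VF : ∀ v f → VF (mV v) (mF f) ≡ VF v f
  open Aut

  actFlag : Aut → Flag → Flag
  actFlag γ (flag v e f p q) =
    flag (mV γ v) (mE γ e) (mF γ f) (trans (pres-VE γ v e) p) (trans (pres-EF γ e f) q)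

  Chiral : Set
  Chiral = Σ (Flag → Bool) λ c →
             (∀ Φ Ψ → Adj₀ Φ Ψ → c Φ ≢ c Ψ)
           × (∀ Φ Ψ → Adj₁ Φ Ψ → c Φ ≢ c Ψ)
           × (∀ Φ Ψ → Adj₂ Φ Ψ → c Φ ≢ c Ψ)
           × (∀ Φ Ψ → c Φ ≡ c Ψ → ∃ λ γ → FlagEq (actFlag γ Φ) Ψ)
           × ¬ (∀ Φ Ψ → ∃ λ γ → FlagEq (actFlag γ Φ) Ψ)

  module _ (g₁ g₂ : Aut) where
    letterAut : Letter → Aut
    letterAut (s₁ , _) = g₁
    letterAut (s₂ , _) = g₂

    wordV : Word → V → V
    wordV [] x = x
    wordV ((g , false) ∷ w) x = mV (letterAut (g , false)) (wordV w x)
    wordV ((g , true)  ∷ w) x = iV (letterAut (g , true)) (wordV w x)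

    wordE : Word → E → E
    wordE [] x = x
    wordE ((g , false) ∷ w) x = mE (letterAut (g , false)) (wordE w x)
    wordE ((g , true)  ∷ w) x = iE (letterAut (g , true)) (wordE w x)

    wordF : Word → F → F
    wordF [] x = x
    wordF ((g , false) ∷ w) x = mF (letterAut (g , false)) (wordF w x)
    wordF ((g , true)  ∷ w) x = iF (letterAut (g , true)) (wordF w x)

    SameAction : Word → Word → Set
    SameAction u w = (∀ x → wordV u x ≡ wordV w x)
                   × (∀ x → wordE u x ≡ wordE w x)
                   × (∀ x → wordF u x ≡ wordF w x)

  -- The group given by the word-equality EqG, with distinguished generators
  -- s₁, s₂, is the automorphism group of P: there is a base flag Φ and an
  -- isomorphism (w ↦ action of w via g₁,g₂) onto Aut(P), sending s₁ to the
  -- automorphism σ₁ : Φ ↦ (Φ^1)^0 and s₂ to σ₂ : Φ ↦ (Φ^2)^1.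
  IsAutGroupOf : (Word → Word → Set) → Set
  IsAutGroupOf EqG =
    Σ Flag λ Φ → Σ Aut λ g₁ → Σ Aut λ g₂ →
        (∃ λ Ψ → Adj₁ Φ Ψ × Adj₀ Ψ (actFlag g₁ Φ))
      × (∃ λ Ψ → Adj₂ Φ Ψ × Adj₁ Ψ (actFlag g₂ Φ))
      × (∀ u w → EqG u w ⇔ SameAction g₁ g₂ u w)
      × (∀ (γ : Aut) → ∃ λ w →
           (∀ x → mV γ x ≡ wordV g₁ g₂ w x)
         × (∀ x → mE γ x ≡ wordE g₁ g₂ w x)
         × (∀ x → mF γ x ≡ wordF g₁ g₂ w x))

Γ₁ : ℕ → Word → Word → Set
Γ₁ α = Γ (2 ^ (α ∸ 1)) (2 ^ α)
         (ℤ.-[1+ 0 ] ℤ.+ + (2 ^ (α ∸ 2)))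
         (ℤ.-[1+ 2 ] ℤ.+ + (2 ^ (α ∸ 2)))
         (+ 1 ℤ.+ + (2 ^ (α ∸ 2)))
         (+ 3 ℤ.+ + (2 ^ (α ∸ 2)))

Γ₂ : ℕ → Word → Word → Set
Γ₂ α = Γ (2 ^ α) 8
         (ℤ.-[1+ 0 ] ℤ.+ + (2 ^ (α ∸ 2)))
         ℤ.-[1+ 2 ]
         (+ 1 ℤ.+ + (2 ^ (α ∸ 2)))
         (+ 3)

{-# OPTIONS --safe #-}
module Submission where

-- Put N = 2^α and M = N/4. In the mix, ⟨σ₁⟩ and ⟨σ₂⟩ meet trivially and their product is the
-- whole group, so every vertex lies on every face and the group acts simply transitively on
-- the pairs (v , f) ∈ ℤ/N × ℤ/N. The vertex action factors through Γ₂ and the face action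
-- through Γ₁; with c g = g/2 for g even and (1 - g)/2 for g odd they are
--   σ₁ v = v + 1,                   σ₂ v = - v + M c(v),
--   σ₁ f = f - 2 [f odd] - M c(f),  σ₂ f = f + 1.
-- Right multiplication by the half-turn σ₂σ₁ is an involution τ of the pairs which commutes with
-- the action; its orbits are the edges. Writing a residue as 8w + r, all these maps are integral
-- affine in the quotients w once the residues r are fixed, so that each identity between them
-- is a finite check.
--
-- A reflection fixing the base vertex and the base face would act on both by negation, which
-- fails at the face τ₂(-2, 0). Conversely, a word acting trivially is trivial in Γ₁ and Γ₂, because
-- in both groups every word equals σ₂^b σ₁^a with the same exponents.

open import Defs
open import Axiom.UniquenessOfIdentityProofs.WithK using (uip)
open import Data.Bool using (Bool; true; false; not; _∨_; if_then_else_)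
open import Data.Bool.Properties as Bool using (∨-zeroʳ; not-involutive; not-¬; ⇔→≡)
open import Data.Empty using (⊥; ⊥-elim)
open import Data.Fin as Fin using (Fin; toℕ; fromℕ<; #_)
import Data.Fin.Properties as Fin
open import Data.Integer as ℤ using (ℤ; +_; -[1+_]; _+_; _*_; -_; _-_; ∣_∣)
import Data.Integer.Properties as ℤ
open import Data.Integer.DivMod using (_%ℕ_; _/ℕ_; n%ℕd<d; a≡a%ℕn+[a/ℕn]*n)
open import Data.Integer.Tactic.RingSolver using (solve-∀)
open import Data.List using (List; []; _∷_; _++_; replicate)
open import Data.List.Properties using (++-assoc; ++-identityʳ)
open import Data.Nat as ℕ using (ℕ; NonZero; _≤_; _^_; s≤s; z≤n)
import Data.Nat.DivMod as ℕ
import Data.Nat.Properties as ℕ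
import Data.Nat.Tactic.RingSolver as ℕSolver
open import Data.Product using (Σ; ∃; _×_; _,_; proj₁; proj₂)
open import Data.Product.Function.NonDependent.Propositional using (_×-↔_)
open import Data.Product.Properties using (≡-dec)
open import Data.Sum using (_⊎_; inj₁; inj₂)
open import Data.Unit using (⊤; tt)
open import Function.Bundles using (_↔_; _⇔_; mk↔ₛ′; mk⇔; module Equivalence)
open import Function.Properties.Inverse using (↔-refl; ↔-sym; ↔-trans)
open import Relation.Binary using (DecidableEquality; Setoid)
open import Relation.Binary.PropositionalEquality using (_≡_; _≢_; refl; sym; trans; cong; cong₂; subst; subst₂; module ≡-Reasoning)
import Relation.Binary.Reasoning.Setoid as SetoidReasoning
open import Relation.Nullary using (¬_; Dec; yes; no; does; contradiction)
open import Relation.Nullary.Decidable using (_×-dec_; True; toWitness; dec-true)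

-- Tight polyhedra from an involution of vertex-face pairs

-- The quantity c(v) only enters multiplied by M = N/4, so it matters modulo 4, and modulo 4 it
-- depends on v modulo 8. This is why residues are taken modulo 8. Since α ≥ 5, M = 8m with m =
-- 2^(α-5), so adding a multiple of M changes the quotient alone, by a multiple of m. The number m
-- stays a symbol, and one finite computation serves every α. Neither action is faithful by itself:
-- σ₂^8 is trivial on vertices and σ₁^(2M) is trivial on faces. The order of the mix is never
-- computed; normal forms bound it from above, and the action separates them. The obstacle is that a
-- relation of the mix needs the same exponents in both groups. The slack comes from σ₁^(2M) = 1 in
-- Γ₁ and σ₂^8 = 1 in Γ₂: an exponent that is forced in one group can be adjusted freely in the
-- other. The orbits of τ are the cosets of the half-turn, which is how edges arise in a rotation
-- group.

-- The edges will be the orbits {(v , f) , (τ₁ v f , τ₂ v f)}; such an edge is incident to both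
-- vertices and both faces occurring in it.
record TightData : Set₁ where
  field
    V F     : Set
    _≟V_    : DecidableEquality V
    _≟F_    : DecidableEquality F
    parV    : V → Bool
    parF    : F → Bool
    τ₁      : V → F → V
    τ₂      : V → F → F
    ρ₂      : V → F → F
    τ₁-inv  : ∀ v f → τ₁ (τ₁ v f) (τ₂ v f) ≡ v
    τ₂-inv  : ∀ v f → τ₂ (τ₁ v f) (τ₂ v f) ≡ f
    τ₂-ρ₂   : ∀ v f → τ₂ v (ρ₂ v f) ≡ f
    ρ₂-τ₂   : ∀ v f → ρ₂ v (τ₂ v f) ≡ f
    parV-τ₁ : ∀ v f → parV (τ₁ v f) ≡ not (parV v)
    parF-τ₂ : ∀ v f → parF (τ₂ v f) ≡ not (parF f)

module Polyhedron (D : TightData) where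
  open TightData D

  -- The orbit of (v , ρ₂ v f) has f as its second face, so it is the other edge joining v to f;
  -- `ρ₁ v f` is the far vertex of that edge.
  ρ₁ : V → F → V
  ρ₁ v f = τ₁ v (ρ₂ v f)

  τ₁-ρ₁ : ∀ v f → τ₁ (ρ₁ v f) f ≡ v
  τ₁-ρ₁ v f = trans (cong (τ₁ (ρ₁ v f)) (sym (τ₂-ρ₂ v f))) (τ₁-inv v (ρ₂ v f))

  ρ₂-τ₁ : ∀ v f → ρ₂ (τ₁ v f) f ≡ τ₂ v f
  ρ₂-τ₁ v f = trans (cong (ρ₂ (τ₁ v f)) (sym (τ₂-inv v f))) (ρ₂-τ₂ (τ₁ v f) (τ₂ v f))

  ρ₁-τ₁ : ∀ v f → ρ₁ (τ₁ v f) f ≡ v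
  ρ₁-τ₁ v f = trans (cong (τ₁ (τ₁ v f)) (ρ₂-τ₁ v f)) (τ₁-inv v f)

  -- An orbit is represented by its element with an even vertex.
  E : Set
  E = Σ (V × F) λ g → parV (proj₁ g) ≡ false

  E-≡ : {e e′ : E} → proj₁ e ≡ proj₁ e′ → e ≡ e′
  E-≡ {g , p} {.g , q} refl = cong (g ,_) (uip p q)

  -- The parity is an argument with its own equation, so that `rep-of` can split on it although it
  -- also occurs in the proof component of the edge.
  edge-of : ∀ v f b → parV v ≡ b → E
  edge-of v f false p = (v , f) , p
  edge-of v f true  p = (τ₁ v f , τ₂ v f) , trans (parV-τ₁ v f) (cong not p)

  edge₊ : V → F → E
  edge₊ v f = edge-of v f (parV v) refl

  -- A view that hides parity: later proofs split on which member of the orbit was chosen, and never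
  -- on `parV v`.
  data Rep (v : V) (f : F) : E → Set where
    same : ∀ p → Rep v f ((v , f) , p)
    twin : ∀ p → Rep v f ((τ₁ v f , τ₂ v f) , p)

  rep-of : ∀ v f b (p : parV v ≡ b) → Rep v f (edge-of v f b p)
  rep-of v f false p = same p
  rep-of v f true  p = twin _

  rep : ∀ v f → Rep v f (edge₊ v f)
  rep v f = rep-of v f (parV v) refl

  edge₊-base : ∀ v f (p : parV v ≡ false) → edge₊ v f ≡ ((v , f) , p)
  edge₊-base v f p with edge₊ v f | rep v f
  ... | _ | same q = E-≡ refl
  ... | _ | twin q =
    contradiction (trans p (trans (sym q) (parV-τ₁ v f))) (not-¬ refl)

  edge₊-twin : ∀ v f → edge₊ (τ₁ v f) (τ₂ v f) ≡ edge₊ v f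
  edge₊-twin v f with edge₊ v f | rep v f
  ... | _ | twin q = edge₊-base _ _ q
  ... | _ | same q with edge₊ (τ₁ v f) (τ₂ v f) | rep (τ₁ v f) (τ₂ v f)
  ...   | _ | same p = contradiction (trans q (trans (sym p) (parV-τ₁ v f))) (not-¬ refl)
  ...   | _ | twin p = E-≡ (cong₂ _,_ (τ₁-inv v f) (τ₂-inv v f))

  -- These are the two edges through the corner (v , f). The Boolean becomes the colour of the flag
  -- in the two-colouring that chirality asks for.
  edge : Bool → V → F → E
  edge true  v f = edge₊ v f
  edge false v f = edge₊ v (ρ₂ v f)

  oppV : Bool → V → F → V
  oppV true  = τ₁
  oppV false = ρ₁

  oppF : Bool → V → F → F
  oppF true  = τ₂
  oppF false = ρ₂

  edge-oppF : ∀ b v f → edge (not b) v (oppF b v f) ≡ edge b v f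
  edge-oppF true  v f = cong (edge₊ v) (ρ₂-τ₂ v f)
  edge-oppF false v f = refl

  edge-oppV : ∀ b v f → edge (not b) (oppV b v f) f ≡ edge b v f
  edge-oppV true  v f = trans (cong (edge₊ (τ₁ v f)) (ρ₂-τ₁ v f)) (edge₊-twin v f)
  edge-oppV false v f = trans (cong (edge₊ (ρ₁ v f)) (sym (τ₂-ρ₂ v f))) (edge₊-twin v (ρ₂ v f))

  parV-oppV : ∀ b v f → parV (oppV b v f) ≡ not (parV v)
  parV-oppV true  v f = parV-τ₁ v f
  parV-oppV false v f = parV-τ₁ v (ρ₂ v f)

  parF-oppF : ∀ b v f → parF (oppF b v f) ≡ not (parF f)
  parF-oppF true  v f = parF-τ₂ v f
  parF-oppF false v f =
    trans (sym (not-involutive _)) (cong not (trans (sym (parF-τ₂ v (ρ₂ v f))) (cong parF (τ₂-ρ₂ v f))))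

  -- Besides choosing representatives, this is the purpose of the parities: they keep the two ends
  -- of an edge apart, and likewise its two faces.
  oppV-≢ : ∀ b v f → v ≢ oppV b v f
  oppV-≢ b v f eq = not-¬ refl (trans (cong parV eq) (parV-oppV b v f))

  oppF-≢ : ∀ b v f → f ≢ oppF b v f
  oppF-≢ b v f eq = not-¬ refl (trans (cong parF eq) (parF-oppF b v f))

  -- An orbit of an involution has no third member. All incidence arguments below come down to this
  -- dichotomy, with parity ruling out one of the cases.
  edge₊-injective : ∀ {v f v′ f′} → edge₊ v f ≡ edge₊ v′ f′ →
                    (v′ ≡ v × f′ ≡ f) ⊎ (v′ ≡ τ₁ v f × f′ ≡ τ₂ v f)
  edge₊-injective {v} {f} {v′} {f′} eq with edge₊ v f | rep v f | edge₊ v′ f′ | rep v′ f′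
  edge₊-injective refl | _ | same p | _ | same .p = inj₁ (refl , refl)
  edge₊-injective {v} {f} {v′} {f′} refl | _ | same p | ._ | twin .p =
    inj₂ (sym (τ₁-inv v′ f′) , sym (τ₂-inv v′ f′))
  edge₊-injective refl | _ | twin p | _ | same .p = inj₂ (refl , refl)
  edge₊-injective {v} {f} {v′} {f′} eq | _ | twin p | _ | twin q =
    inj₁ ( trans (sym (τ₁-inv v′ f′)) (trans (cong₂ τ₁ (sym a) (sym b)) (τ₁-inv v f))
         , trans (sym (τ₂-inv v′ f′)) (trans (cong₂ τ₂ (sym a) (sym b)) (τ₂-inv v f)))
    where a = cong (λ e → proj₁ (proj₁ e)) eq
          b = cong (λ e → proj₂ (proj₁ e)) eq

  edge-≢ : ∀ v f → edge true v f ≢ edge false v f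
  edge-≢ v f eq with edge₊-injective eq
  ... | inj₁ (_ , q) = oppF-≢ false v f (sym q)
  ... | inj₂ (q , _) = oppV-≢ true v f q

  VE : V → E → Bool
  VE x ((v , f) , _) = does (x ≟V v) ∨ does (x ≟V τ₁ v f)

  EF : E → F → Bool
  EF ((v , f) , _) x = does (x ≟F f) ∨ does (x ≟F τ₂ v f)

  VE-edge₊ : ∀ v f → VE v (edge₊ v f) ≡ true
  VE-edge₊ v f with edge₊ v f | rep v f
  ... | _ | same p rewrite dec-true (v ≟V v) refl = refl
  ... | _ | twin p rewrite dec-true (v ≟V τ₁ (τ₁ v f) (τ₂ v f)) (sym (τ₁-inv v f)) = ∨-zeroʳ (does (v ≟V τ₁ v f))

  VE-edge : ∀ b v f → VE v (edge b v f) ≡ true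
  VE-edge true  v f = VE-edge₊ v f
  VE-edge false v f = VE-edge₊ v (ρ₂ v f)

  EF-edge₊ : ∀ v f → EF (edge₊ v f) f ≡ true
  EF-edge₊ v f with edge₊ v f | rep v f
  ... | _ | same p rewrite dec-true (f ≟F f) refl = refl
  ... | _ | twin p rewrite dec-true (f ≟F τ₂ (τ₁ v f) (τ₂ v f)) (sym (τ₂-inv v f)) = ∨-zeroʳ (does (f ≟F τ₂ v f))

  EF-edge : ∀ b v f → EF (edge b v f) f ≡ true
  EF-edge true  v f = EF-edge₊ v f
  EF-edge false v f = subst (λ e → EF e f ≡ true) (edge-oppV false v f) (EF-edge₊ (ρ₁ v f) f)

  VE-elim : ∀ v e → VE v e ≡ true → Σ F λ f → e ≡ edge₊ v f
  VE-elim x ((v , f) , p) q with x ≟V v | x ≟V τ₁ v f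
  ... | yes refl | _        = f , sym (edge₊-base v f p)
  ... | no _     | yes refl = τ₂ v f , trans (sym (edge₊-base v f p)) (sym (edge₊-twin v f))
  VE-elim x ((v , f) , p) () | no _ | no _

  EF-elim : ∀ e f → EF e f ≡ true → Σ V λ v → e ≡ edge₊ v f
  EF-elim ((v , f) , p) x q with x ≟F f | x ≟F τ₂ v f
  ... | yes refl | _        = v , sym (edge₊-base v f p)
  ... | no _     | yes refl = τ₁ v f , trans (sym (edge₊-base v f p)) (sym (edge₊-twin v f))
  EF-elim ((v , f) , p) x () | no _ | no _

  -- Incidence with v gives e = `edge₊ v g`, incidence with f gives e = `edge₊ u f`. Either the two
  -- pairs coincide, or τ exchanges them and then g = `ρ₂ v f`.
  incident-edge : ∀ v e f → VE v e ≡ true → EF e f ≡ true → Σ Bool λ b → e ≡ edge b v f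
  incident-edge v e f p q with VE-elim v e p | EF-elim e f q
  ... | g , eq | u , eq′ with edge₊-injective (trans (sym eq) eq′)
  ...   | inj₁ (_ , r) = true , trans eq (cong (edge₊ v) (sym r))
  ...   | inj₂ (_ , r) =
    false , trans eq (cong (edge₊ v) (trans (sym (ρ₂-τ₂ v g)) (cong (ρ₂ v) (sym r))))

  incident-vertex : ∀ b v f x → VE x (edge b v f) ≡ true → x ≡ v ⊎ x ≡ oppV b v f
  incident-vertex b v f x p with incident-edge x (edge b v f) f p (EF-edge b v f)
  incident-vertex true v f x p | true , eq with edge₊-injective eq
  ... | inj₁ (q , _) = inj₁ q
  ... | inj₂ (q , _) = inj₂ q
  incident-vertex true v f x p | false , eq with edge₊-injective eq
  ... | inj₁ (q , _) = inj₁ q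
  ... | inj₂ (q , _) = inj₂ q
  incident-vertex false v f x p | true , eq with edge₊-injective eq
  ... | inj₁ (q , _) = inj₁ q
  ... | inj₂ (q , _) = inj₂ q
  incident-vertex false v f x p | false , eq with edge₊-injective eq
  ... | inj₁ (q , _) = inj₁ q
  ... | inj₂ (q , _) = inj₂ q

  incident-face : ∀ b v f x → EF (edge b v f) x ≡ true → x ≡ f ⊎ x ≡ oppF b v f
  incident-face b v f x p with incident-edge v (edge b v f) x (VE-edge b v f) p
  incident-face true v f x p | true , eq with edge₊-injective eq
  ... | inj₁ (_ , q) = inj₁ q
  ... | inj₂ (q , _) = ⊥-elim (oppV-≢ true v f q)
  incident-face true v f x p | false , eq with edge₊-injective eq
  ... | inj₁ (_ , q) = inj₂ (trans (sym (τ₂-ρ₂ v x)) (cong (τ₂ v) q))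
  ... | inj₂ (q , _) = ⊥-elim (oppV-≢ true v f q)
  incident-face false v f x p | true , eq with edge₊-injective eq
  ... | inj₁ (_ , q) = inj₂ q
  ... | inj₂ (q , _) = ⊥-elim (oppV-≢ false v f q)
  incident-face false v f x p | false , eq with edge₊-injective eq
  ... | inj₁ (_ , q) = inj₁ (trans (sym (τ₂-ρ₂ v x)) (trans (cong (τ₂ v) q) (τ₂-ρ₂ v f)))
  ... | inj₂ (q , _) = ⊥-elim (oppV-≢ false v f q)

  VE-oppV : ∀ b v f → VE (oppV b v f) (edge b v f) ≡ true
  VE-oppV b v f = subst (λ e → VE (oppV b v f) e ≡ true) (edge-oppV b v f) (VE-edge (not b) (oppV b v f) f)

  EF-oppF : ∀ b v f → EF (edge b v f) (oppF b v f) ≡ true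
  EF-oppF b v f = subst (λ e → EF e (oppF b v f) ≡ true) (edge-oppF b v f) (EF-edge (not b) v (oppF b v f))

  𝒫 : Poset3
  𝒫 = record { V = V ; E = E ; F = F ; VE = VE ; EF = EF ; VF = λ _ _ → true
                 ; VEF-trans = λ _ _ _ _ _ → refl }

  Σ-≡ : {A : Set} {B : A → Bool} {x y : Σ A λ a → B a ≡ true} → proj₁ x ≡ proj₁ y → x ≡ y
  Σ-≡ {x = a , p} {.a , q} refl = cong (a ,_) (uip p q)

  two-vertices : ∀ e → Σ V (λ v → VE v e ≡ true) ↔ Fin 2
  two-vertices e@((v , f) , p) = mk↔ₛ′ to from to-from from-to
    where
    e≡ = edge₊-base v f p
    code : V → Fin 2
    code x with x ≟V v
    ... | yes _ = Fin.zero
    ... | no _  = Fin.suc Fin.zero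
    to : Σ V (λ v → VE v e ≡ true) → Fin 2
    to (x , _) = code x
    from : Fin 2 → Σ V (λ v → VE v e ≡ true)
    from Fin.zero           = v , subst (λ e → VE v e ≡ true) e≡ (VE-edge true v f)
    from (Fin.suc Fin.zero) = τ₁ v f , subst (λ e → VE (τ₁ v f) e ≡ true) e≡ (VE-oppV true v f)
    to-from : ∀ i → to (from i) ≡ i
    to-from Fin.zero with v ≟V v
    ... | yes _ = refl
    ... | no v≢ = contradiction refl v≢
    to-from (Fin.suc Fin.zero) with τ₁ v f ≟V v
    ... | yes eq = contradiction (sym eq) (oppV-≢ true v f)
    ... | no _   = refl
    from-code : ∀ x → x ≡ v ⊎ x ≡ τ₁ v f → proj₁ (from (code x)) ≡ x
    from-code x x∈ with x ≟V v
    from-code x x∈ | yes eq = sym eq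
    from-code x (inj₁ eq) | no x≢ = contradiction eq x≢
    from-code x (inj₂ eq) | no _  = sym eq
    from-to : ∀ x → from (to x) ≡ x
    from-to (x , q) = Σ-≡ (from-code x (incident-vertex true v f x (subst (λ e → VE x e ≡ true) (sym e≡) q)))

  two-faces : ∀ e → Σ F (λ f → EF e f ≡ true) ↔ Fin 2
  two-faces e@((v , f) , p) = mk↔ₛ′ to from to-from from-to
    where
    e≡ = edge₊-base v f p
    code : F → Fin 2
    code x with x ≟F f
    ... | yes _ = Fin.zero
    ... | no _  = Fin.suc Fin.zero
    to : Σ F (λ f → EF e f ≡ true) → Fin 2
    to (x , _) = code x
    from : Fin 2 → Σ F (λ f → EF e f ≡ true)
    from Fin.zero           = f , subst (λ e → EF e f ≡ true) e≡ (EF-edge true v f)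
    from (Fin.suc Fin.zero) = τ₂ v f , subst (λ e → EF e (τ₂ v f) ≡ true) e≡ (EF-oppF true v f)
    to-from : ∀ i → to (from i) ≡ i
    to-from Fin.zero with f ≟F f
    ... | yes _ = refl
    ... | no f≢ = contradiction refl f≢
    to-from (Fin.suc Fin.zero) with τ₂ v f ≟F f
    ... | yes eq = contradiction (sym eq) (oppF-≢ true v f)
    ... | no _   = refl
    from-code : ∀ x → x ≡ f ⊎ x ≡ τ₂ v f → proj₁ (from (code x)) ≡ x
    from-code x x∈ with x ≟F f
    from-code x x∈ | yes eq = sym eq
    from-code x (inj₁ eq) | no x≢ = contradiction eq x≢
    from-code x (inj₂ eq) | no _  = sym eq
    from-to : ∀ x → from (to x) ≡ x
    from-to (x , q) = Σ-≡ (from-code x (incident-face true v f x (subst (λ e → EF e x ≡ true) (sym e≡) q)))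

  edge-injective : ∀ a b v f → edge a v f ≡ edge b v f → a ≡ b
  edge-injective true  true  v f eq = refl
  edge-injective true  false v f eq = contradiction eq (edge-≢ v f)
  edge-injective false true  v f eq = contradiction (sym eq) (edge-≢ v f)
  edge-injective false false v f eq = refl

  sign : ∀ v e f → VE v e ≡ true → EF e f ≡ true → Bool
  sign v e f p q = proj₁ (incident-edge v e f p q)

  edge-sign : ∀ v e f (p : VE v e ≡ true) (q : EF e f ≡ true) → e ≡ edge (sign v e f p q) v f
  edge-sign v e f p q = proj₂ (incident-edge v e f p q)

  sign-edge : ∀ b v f → sign v (edge b v f) f (VE-edge b v f) (EF-edge b v f) ≡ b
  sign-edge b v f = edge-injective _ b v f (sym (edge-sign v (edge b v f) f (VE-edge b v f) (EF-edge b v f)))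

  diamond : ∀ v f → Σ E (λ e → VE v e ≡ true × EF e f ≡ true) ↔ Fin 2
  diamond v f = ↔-trans (mk↔ₛ′ to from to-from from-to) (↔-sym Fin.2↔Bool)
    where
    to : Σ E (λ e → VE v e ≡ true × EF e f ≡ true) → Bool
    to (e , p , q) = sign v e f p q
    from : Bool → Σ E (λ e → VE v e ≡ true × EF e f ≡ true)
    from b = edge b v f , VE-edge b v f , EF-edge b v f
    to-from : ∀ b → to (from b) ≡ b
    to-from b = sign-edge b v f
    pair-≡ : ∀ {e e′ p q p′ q′} → e ≡ e′ → _≡_ {A = Σ E (λ e → VE v e ≡ true × EF e f ≡ true)} (e , p , q) (e′ , p′ , q′)
    pair-≡ {e} refl = cong (e ,_) (cong₂ _,_ (uip _ _) (uip _ _))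
    from-to : ∀ x → from (to x) ≡ x
    from-to (e , p , q) = pair-≡ (sym (edge-sign v e f p q))

  -- Of the two pairs in an orbit at most one contains v, because the other one has a vertex of
  -- opposite parity. Hence an edge at v determines its face g with e = `edge₊ v g`.
  edges-at-vertex : ∀ v → Σ E (λ e → VE v e ≡ true) ↔ F
  edges-at-vertex v = mk↔ₛ′ (λ (e , p) → proj₁ (VE-elim v e p)) (λ f → edge₊ v f , VE-edge₊ v f) to-from from-to
    where
    to-from : ∀ f → proj₁ (VE-elim v (edge₊ v f) (VE-edge₊ v f)) ≡ f
    to-from f with VE-elim v (edge₊ v f) (VE-edge₊ v f)
    ... | g , eq with edge₊-injective eq
    ...   | inj₁ (_ , q) = q
    ...   | inj₂ (q , _) = contradiction q (oppV-≢ true v f)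
    from-to : ∀ ((e , p) : Σ E (λ e → VE v e ≡ true)) →
              (edge₊ v (proj₁ (VE-elim v e p)) , VE-edge₊ v _) ≡ (e , p)
    from-to (e , p) = Σ-≡ (sym (proj₂ (VE-elim v e p)))

  edges-at-face : ∀ f → Σ E (λ e → EF e f ≡ true) ↔ V
  edges-at-face f = mk↔ₛ′ (λ (e , p) → proj₁ (EF-elim e f p)) (λ v → edge₊ v f , EF-edge₊ v f) to-from from-to
    where
    to-from : ∀ v → proj₁ (EF-elim (edge₊ v f) f (EF-edge₊ v f)) ≡ v
    to-from v with EF-elim (edge₊ v f) f (EF-edge₊ v f)
    ... | u , eq with edge₊-injective eq
    ...   | inj₁ (q , _) = q
    ...   | inj₂ (_ , q) = contradiction q (oppF-≢ true v f)
    from-to : ∀ ((e , p) : Σ E (λ e → EF e f ≡ true)) →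
              (edge₊ (proj₁ (EF-elim e f p)) f , EF-edge₊ _ f) ≡ (e , p)
    from-to (e , p) = Σ-≡ (sym (proj₂ (EF-elim e f p)))

  flag-≡ : ∀ {v e f v′ e′ f′ p q p′ q′} → v ≡ v′ → e ≡ e′ → f ≡ f′ →
           _≡_ {A = Flag 𝒫} (flag v e f p q) (flag v′ e′ f′ p′ q′)
  flag-≡ {v} {e} {f} refl refl refl = cong₂ (flag v e f) (uip _ _) (uip _ _)

  signFlag : Flag 𝒫 → Bool
  signFlag (flag v e f p q) = sign v e f p q

  mkFlag : Bool → V → F → Flag 𝒫
  mkFlag b v f = flag v (edge b v f) f (VE-edge b v f) (EF-edge b v f)

  -- A flag is a corner with a colour, and all vertex-face pairs are corners; this is the source of
  -- tightness. The nesting matches the bracketing of `2 * p * q`.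
  flags : Flag 𝒫 ↔ ((Bool × V) × F)
  flags = mk↔ₛ′ (λ Φ → (signFlag Φ , Flag.fv Φ) , Flag.ff Φ) (λ ((b , v) , f) → mkFlag b v f)
    (λ ((b , v) , f) → cong (λ c → (c , v) , f) (sign-edge b v f))
    (λ (flag v e f p q) → flag-≡ refl (sym (edge-sign v e f p q)) refl)

  hasType : ∀ {p q} → V ↔ Fin p → F ↔ Fin q → HasType 𝒫 p q
  hasType V↔ F↔ = (λ f → ↔-trans (edges-at-face f) V↔) , (λ v → ↔-trans (edges-at-vertex v) F↔)

  tight : ∀ {p q} → V ↔ Fin p → F ↔ Fin q → Tight 𝒫 p q
  tight V↔ F↔ = ↔-trans flags (↔-trans (↔-trans (↔-sym Fin.2↔Bool ×-↔ V↔) (↔-sym Fin.*↔×) ×-↔ F↔) (↔-sym Fin.*↔×))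

-- Automorphisms from pairs of permutations commuting with τ

module Symmetries (D : TightData) where
  open TightData D
  open Polyhedron D

  record Symmetry : Set where
    field
      mV iV : V → V
      mF iF : F → F
      iV-mV : ∀ v → iV (mV v) ≡ v
      mV-iV : ∀ v → mV (iV v) ≡ v
      iF-mF : ∀ f → iF (mF f) ≡ f
      mF-iF : ∀ f → mF (iF f) ≡ f
      mV-τ₁ : ∀ v f → mV (τ₁ v f) ≡ τ₁ (mV v) (mF f)
      mF-τ₂ : ∀ v f → mF (τ₂ v f) ≡ τ₂ (mV v) (mF f)

    mF-ρ₂ : ∀ v f → mF (ρ₂ v f) ≡ ρ₂ (mV v) (mF f)
    mF-ρ₂ v f = begin
      mF (ρ₂ v f)                               ≡⟨ ρ₂-τ₂ _ _ ⟨
      ρ₂ (mV v) (τ₂ (mV v) (mF (ρ₂ v f)))       ≡⟨ cong (ρ₂ (mV v)) (mF-τ₂ v (ρ₂ v f)) ⟨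
      ρ₂ (mV v) (mF (τ₂ v (ρ₂ v f)))            ≡⟨ cong (λ g → ρ₂ (mV v) (mF g)) (τ₂-ρ₂ v f) ⟩
      ρ₂ (mV v) (mF f)                          ∎
      where open ≡-Reasoning

    mV-ρ₁ : ∀ v f → mV (ρ₁ v f) ≡ ρ₁ (mV v) (mF f)
    mV-ρ₁ v f = trans (mV-τ₁ v (ρ₂ v f)) (cong (τ₁ (mV v)) (mF-ρ₂ v f))

    -- A symmetry may change the parity of vertices, so the image of a representative can be the
    -- other member of its orbit; `edge₊` normalises it again.
    mE : E → E
    mE ((v , f) , _) = edge₊ (mV v) (mF f)

    mE-edge₊ : ∀ v f → mE (edge₊ v f) ≡ edge₊ (mV v) (mF f)
    mE-edge₊ v f with edge₊ v f | rep v f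
    ... | _ | same _ = refl
    ... | _ | twin _ = trans (cong₂ edge₊ (mV-τ₁ v f) (mF-τ₂ v f)) (edge₊-twin (mV v) (mF f))

    mE-edge : ∀ b v f → mE (edge b v f) ≡ edge b (mV v) (mF f)
    mE-edge true  v f = mE-edge₊ v f
    mE-edge false v f = trans (mE-edge₊ v (ρ₂ v f)) (cong (edge₊ (mV v)) (mF-ρ₂ v f))

  open Symmetry

  idˢ : Symmetry
  idˢ = record { mV = λ v → v ; iV = λ v → v ; mF = λ f → f ; iF = λ f → f
               ; iV-mV = λ _ → refl ; mV-iV = λ _ → refl ; iF-mF = λ _ → refl ; mF-iF = λ _ → refl
               ; mV-τ₁ = λ _ _ → refl ; mF-τ₂ = λ _ _ → refl }

  _∘ˢ_ : Symmetry → Symmetry → Symmetry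
  g ∘ˢ h = record
    { mV = λ v → mV g (mV h v) ; iV = λ v → iV h (iV g v)
    ; mF = λ f → mF g (mF h f) ; iF = λ f → iF h (iF g f)
    ; iV-mV = λ v → trans (cong (iV h) (iV-mV g _)) (iV-mV h v)
    ; mV-iV = λ v → trans (cong (mV g) (mV-iV h _)) (mV-iV g v)
    ; iF-mF = λ f → trans (cong (iF h) (iF-mF g _)) (iF-mF h f)
    ; mF-iF = λ f → trans (cong (mF g) (mF-iF h _)) (mF-iF g f)
    ; mV-τ₁ = λ v f → trans (cong (mV g) (mV-τ₁ h v f)) (mV-τ₁ g _ _)
    ; mF-τ₂ = λ v f → trans (cong (mF g) (mF-τ₂ h v f)) (mF-τ₂ g _ _) }

  _⁻ˢ : Symmetry → Symmetry
  g ⁻ˢ = record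
    { mV = iV g ; iV = mV g ; mF = iF g ; iF = mF g
    ; iV-mV = mV-iV g ; mV-iV = iV-mV g ; iF-mF = mF-iF g ; mF-iF = iF-mF g
    ; mV-τ₁ = λ v f → trans (cong (iV g) (trans (cong₂ τ₁ (sym (mV-iV g v)) (sym (mF-iF g f))) (sym (mV-τ₁ g _ _)))) (iV-mV g _)
    ; mF-τ₂ = λ v f → trans (cong (iF g) (trans (cong₂ τ₂ (sym (mV-iV g v)) (sym (mF-iF g f))) (sym (mF-τ₂ g _ _)))) (iF-mF g _) }

  mE-inverse : ∀ g e → mE (g ⁻ˢ) (mE g e) ≡ e
  mE-inverse g ((v , f) , p) =
    trans (mE-edge₊ (g ⁻ˢ) (mV g v) (mF g f))
      (trans (cong₂ edge₊ (iV-mV g v) (iF-mF g f)) (edge₊-base v f p))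

  VE-mono : ∀ g v e → VE v e ≡ true → VE (mV g v) (mE g e) ≡ true
  VE-mono g v e p with VE-elim v e p
  ... | f , refl = subst (λ e → VE (mV g v) e ≡ true) (sym (mE-edge₊ g v f)) (VE-edge₊ (mV g v) (mF g f))

  EF-mono : ∀ g e f → EF e f ≡ true → EF (mE g e) (mF g f) ≡ true
  EF-mono g e f p with EF-elim e f p
  ... | v , refl = subst (λ e → EF e (mF g f) ≡ true) (sym (mE-edge₊ g v f)) (EF-edge₊ (mV g v) (mF g f))

  toAut : Symmetry → Aut 𝒫
  toAut g = record
    { mV = mV g ; mE = mE g ; mF = mF g ; iV = iV g ; iE = mE (g ⁻ˢ) ; iF = iF g
    ; iV-l = iV-mV g ; iV-r = mV-iV g
    ; iE-l = mE-inverse g ; iE-r = mE-inverse (g ⁻ˢ)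
    ; iF-l = iF-mF g ; iF-r = mF-iF g
    -- Preservation of a Boolean needs both implications; the backward one is monotonicity of the
    -- inverse symmetry.
    ; pres-VE = λ v e → ⇔→≡ (mk⇔
        (λ p → subst (λ v → VE v e ≡ true) (iV-mV g v)
                 (subst (λ e′ → VE (iV g (mV g v)) e′ ≡ true) (mE-inverse g e) (VE-mono (g ⁻ˢ) (mV g v) (mE g e) p)))
        (VE-mono g v e))
    ; pres-EF = λ e f → ⇔→≡ (mk⇔
        (λ p → subst (λ f → EF e f ≡ true) (iF-mF g f)
                 (subst (λ e′ → EF e′ (iF g (mF g f)) ≡ true) (mE-inverse g e) (EF-mono (g ⁻ˢ) (mE g e) (mF g f) p)))
        (EF-mono g e f))
    ; pres-VF = λ _ _ → refl }

  module Words (g₁ g₂ : Symmetry) where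

    letterSym : Letter → Symmetry
    letterSym (s₁ , false) = g₁
    letterSym (s₁ , true)  = g₁ ⁻ˢ
    letterSym (s₂ , false) = g₂
    letterSym (s₂ , true)  = g₂ ⁻ˢ

    wordSym : Word → Symmetry
    wordSym []      = idˢ
    wordSym (x ∷ w) = letterSym x ∘ˢ wordSym w

    wordV-sym : ∀ w v → wordV 𝒫 (toAut g₁) (toAut g₂) w v ≡ mV (wordSym w) v
    wordV-sym []                 v = refl
    wordV-sym ((s₁ , false) ∷ w) v = cong (mV g₁) (wordV-sym w v)
    wordV-sym ((s₁ , true)  ∷ w) v = cong (iV g₁) (wordV-sym w v)
    wordV-sym ((s₂ , false) ∷ w) v = cong (mV g₂) (wordV-sym w v)
    wordV-sym ((s₂ , true)  ∷ w) v = cong (iV g₂) (wordV-sym w v)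

    wordF-sym : ∀ w f → wordF 𝒫 (toAut g₁) (toAut g₂) w f ≡ mF (wordSym w) f
    wordF-sym []                 f = refl
    wordF-sym ((s₁ , false) ∷ w) f = cong (mF g₁) (wordF-sym w f)
    wordF-sym ((s₁ , true)  ∷ w) f = cong (iF g₁) (wordF-sym w f)
    wordF-sym ((s₂ , false) ∷ w) f = cong (mF g₂) (wordF-sym w f)
    wordF-sym ((s₂ , true)  ∷ w) f = cong (iF g₂) (wordF-sym w f)

    wordE-edge₊ : ∀ w v f → wordE 𝒫 (toAut g₁) (toAut g₂) w (edge₊ v f) ≡ edge₊ (mV (wordSym w) v) (mF (wordSym w) f)
    wordE-edge₊ []                 v f = refl
    wordE-edge₊ ((s₁ , false) ∷ w) v f = trans (cong (mE g₁) (wordE-edge₊ w v f)) (mE-edge₊ g₁ _ _)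
    wordE-edge₊ ((s₁ , true)  ∷ w) v f = trans (cong (mE (g₁ ⁻ˢ)) (wordE-edge₊ w v f)) (mE-edge₊ (g₁ ⁻ˢ) _ _)
    wordE-edge₊ ((s₂ , false) ∷ w) v f = trans (cong (mE g₂) (wordE-edge₊ w v f)) (mE-edge₊ g₂ _ _)
    wordE-edge₊ ((s₂ , true)  ∷ w) v f = trans (cong (mE (g₂ ⁻ˢ)) (wordE-edge₊ w v f)) (mE-edge₊ (g₂ ⁻ˢ) _ _)

-- `cycleV` and `cycleF` express transitivity of ⟨σ₁⟩ on vertices and of ⟨σ₂⟩ on faces as induction
-- principles with an arbitrary starting point. The inverse of σ₁ occurs because it is the step
-- taken by τ around the base face. In `no-reflection`, α and β stand for the vertex and face maps
-- of a colour-reversing automorphism that fixes the base pair; such an automorphism carries τ to ρ.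
record ChiralData : Set₁ where
  field
    tightData : TightData
  open TightData tightData public
  open Polyhedron tightData public
  open Symmetries tightData public
  open Symmetry
  field
    g₁ g₂ : Symmetry
  open Words g₁ g₂ public
  field
    oV         : V
    oF         : F
    g₂-oV      : mV g₂ oV ≡ oV
    g₁-oF      : mF g₁ oF ≡ oF
    τ₁-oF      : ∀ v → τ₁ v oF ≡ iV g₁ v
    τ₂-oV      : ∀ f → τ₂ oV f ≡ mF g₂ f
    transitive : ∀ v f → Σ Word λ w → mV (wordSym w) oV ≡ v × mF (wordSym w) oF ≡ f
    cycleV     : (Q : V → Set) → ∀ {v₀} → Q v₀ → (∀ v → Q v → Q (iV g₁ v)) → ∀ v → Q v
    cycleF     : (Q : F → Set) → ∀ {f₀} → Q f₀ → (∀ f → Q f → Q (mF g₂ f)) → ∀ f → Q f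
    no-reflection : (α : V → V) (β : F → F) → α oV ≡ oV → β oF ≡ oF →
      (∀ v f → α (τ₁ v f) ≡ ρ₁ (α v) (β f)) → (∀ v f → β (τ₂ v f) ≡ ρ₂ (α v) (β f)) → ⊥

-- Connectedness, chirality and the automorphism group

module ChiralPolyhedron (C : ChiralData) where
  open ChiralData C
  open Symmetry

  -- Around the base vertex, τ₂ is σ₂. An element moving the base vertex to v commutes with τ and
  -- transports `cycleF` to v.
  cycle-around-vertex : ∀ v (Q : F → Set) {f₀} → Q f₀ → (∀ f → Q f → Q (τ₂ v f)) → ∀ f → Q f
  cycle-around-vertex v Q {f₀} q₀ next f with transitive v f₀
  ... | w , wv , _ = subst Q (mF-iF g f) (cycleF (λ f → Q (mF g f)) (subst Q (sym (mF-iF g f₀)) q₀) next′ (iF g f))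
    where
    g = wordSym w
    next′ : ∀ f → Q (mF g f) → Q (mF g (mF g₂ f))
    next′ f q = subst Q (begin
      τ₂ v (mF g f)           ≡⟨ cong (λ v → τ₂ v (mF g f)) wv ⟨
      τ₂ (mV g oV) (mF g f)   ≡⟨ mF-τ₂ g oV f ⟨
      mF g (τ₂ oV f)          ≡⟨ cong (mF g) (τ₂-oV f) ⟩
      mF g (mF g₂ f)          ∎) (next (mF g f) q)
      where open ≡-Reasoning

  cycle-around-face : ∀ f (Q : V → Set) {v₀} → Q v₀ → (∀ v → Q v → Q (τ₁ v f)) → ∀ v → Q v
  cycle-around-face f Q {v₀} q₀ next v with transitive v₀ f
  ... | w , _ , wf = subst Q (mV-iV g v) (cycleV (λ v → Q (mV g v)) (subst Q (sym (mV-iV g v₀)) q₀) next′ (iV g v))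
    where
    g = wordSym w
    next′ : ∀ v → Q (mV g v) → Q (mV g (iV g₁ v))
    next′ v q = subst Q (begin
      τ₁ (mV g v) f           ≡⟨ cong (τ₁ (mV g v)) wf ⟨
      τ₁ (mV g v) (mF g oF)   ≡⟨ mV-τ₁ g v oF ⟨
      mV g (τ₁ v oF)          ≡⟨ cong (mV g) (τ₁-oF v) ⟩
      mV g (iV g₁ v)          ∎) (next (mV g v) q)
      where open ≡-Reasoning

  ⟪_⟫V : V → Elt 𝒫
  ⟪ v ⟫V = inj₁ v

  ⟪_⟫E : E → Elt 𝒫
  ⟪ e ⟫E = inj₂ (inj₁ e)

  ⟪_⟫F : F → Elt 𝒫
  ⟪ f ⟫F = inj₂ (inj₂ f)

  infixr 5 _++ʳ_
  _++ʳ_ : ∀ {S x y z} → Reach 𝒫 S x y → Reach 𝒫 S y z → Reach 𝒫 S x z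
  here       ++ʳ r = r
  step i s p ++ʳ r = step i s (p ++ʳ r)

  vertex-connected : ∀ v → ConnectedOn 𝒫 (Inc 𝒫 ⟪ v ⟫V)
  vertex-connected v = conn
    where
    R = Reach 𝒫 (Inc 𝒫 ⟪ v ⟫V)
    faces : ∀ f g → R ⟪ f ⟫F ⟪ g ⟫F
    -- Consecutive faces around v share the edge `edge₊ v g`, so each step of the induction extends
    -- the path by that edge and the next face.
    faces f = cycle-around-vertex v (λ g → R ⟪ f ⟫F ⟪ g ⟫F) here λ g r →
      r ++ʳ step {y = ⟪ edge₊ v g ⟫E} (EF-edge₊ v g) (VE-edge₊ v g) (step (EF-oppF true v g) refl here)
    conn : ConnectedOn 𝒫 (Inc 𝒫 ⟪ v ⟫V)
    conn (inj₂ (inj₂ f)) (inj₂ (inj₂ g)) _ _ = faces f g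
    conn (inj₂ (inj₂ f)) (inj₂ (inj₁ e)) _ p with VE-elim v e p
    ... | g , refl = faces f g ++ʳ step (EF-edge₊ v g) p here
    conn (inj₂ (inj₁ e)) (inj₂ (inj₂ g)) p _ with VE-elim v e p
    ... | f , refl = step (EF-edge₊ v f) refl (faces f g)
    conn (inj₂ (inj₁ e)) (inj₂ (inj₁ e′)) p p′ with VE-elim v e p | VE-elim v e′ p′
    ... | f , refl | g , refl = step (EF-edge₊ v f) refl (faces f g ++ʳ step (EF-edge₊ v g) p′ here)

  face-connected : ∀ f → ConnectedOn 𝒫 (Inc 𝒫 ⟪ f ⟫F)
  face-connected f = conn
    where
    R = Reach 𝒫 (Inc 𝒫 ⟪ f ⟫F)
    vertices : ∀ v u → R ⟪ v ⟫V ⟪ u ⟫V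
    vertices v = cycle-around-face f (λ u → R ⟪ v ⟫V ⟪ u ⟫V) here λ u r →
      r ++ʳ step {y = ⟪ edge₊ u f ⟫E} (VE-edge₊ u f) (EF-edge₊ u f) (step (VE-oppV true u f) refl here)
    conn : ConnectedOn 𝒫 (Inc 𝒫 ⟪ f ⟫F)
    conn (inj₁ v) (inj₁ u) _ _ = vertices v u
    conn (inj₁ v) (inj₂ (inj₁ e)) _ p with EF-elim e f p
    ... | u , refl = vertices v u ++ʳ step (VE-edge₊ u f) p here
    conn (inj₂ (inj₁ e)) (inj₁ u) p _ with EF-elim e f p
    ... | v , refl = step (VE-edge₊ v f) refl (vertices v u)
    conn (inj₂ (inj₁ e)) (inj₂ (inj₁ e′)) p p′ with EF-elim e f p | EF-elim e′ f p′
    ... | v , refl | u , refl = step (VE-edge₊ v f) refl (vertices v u ++ʳ step (VE-edge₊ u f) p′ here)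

  connected : ConnectedOn 𝒫 (λ _ → ⊤)
  connected x y _ _ = toFace x ++ʳ fromFace y
    where
    R = Reach 𝒫 (λ _ → ⊤)
    fromVertex : ∀ v y → R ⟪ v ⟫V y
    fromVertex v (inj₁ u)                      = step {y = ⟪ oF ⟫F} refl tt (step refl tt here)
    fromVertex v (inj₂ (inj₂ f))               = step refl tt here
    fromVertex v (inj₂ (inj₁ e@((u , f) , p))) = step {y = ⟪ f ⟫F} refl tt
      (step (subst (λ e → EF e f ≡ true) (edge₊-base u f p) (EF-edge₊ u f)) tt here)
    toFace : ∀ x → R x ⟪ oF ⟫F
    toFace (inj₁ v)                      = fromVertex v ⟪ oF ⟫F
    toFace (inj₂ (inj₂ f))               = step {y = ⟪ oV ⟫V} refl tt (step refl tt here)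
    toFace (inj₂ (inj₁ e@((u , f) , p))) = step {y = ⟪ u ⟫V}
      (subst (λ e → VE u e ≡ true) (edge₊-base u f p) (VE-edge₊ u f)) tt (step refl tt here)
    fromFace : ∀ y → R ⟪ oF ⟫F y
    fromFace y = step {y = ⟪ oV ⟫V} refl tt (fromVertex oV y)

  isPolyhedron : IsPolyhedron 𝒫
  isPolyhedron = record
    { edge-two-vertices = two-vertices
    ; edge-two-faces    = two-faces
    ; diamond           = λ v f _ → diamond v f
    ; connected         = connected
    ; vertex-connected  = vertex-connected
    ; face-connected    = face-connected }

  module Automorphism (γ : Aut 𝒫) (b : Bool) where
    open Aut γ renaming (mV to γV; mE to γE; mF to γF)

    γV-injective : ∀ {v u} → γV v ≡ γV u → v ≡ u
    γV-injective eq = trans (sym (iV-l _)) (trans (cong (Aut.iV γ) eq) (iV-l _))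

    γE-injective : ∀ {e e′} → γE e ≡ γE e′ → e ≡ e′
    γE-injective eq = trans (sym (iE-l _)) (trans (cong iE eq) (iE-l _))

    γF-injective : ∀ {f g} → γF f ≡ γF g → f ≡ g
    γF-injective eq = trans (sym (iF-l _)) (trans (cong (Aut.iF γ) eq) (iF-l _))

    Signed : V → F → Set
    Signed v f = γE (edge₊ v f) ≡ edge b (γV v) (γF f)

    edge₊-image : ∀ v f → Σ Bool λ c → γE (edge₊ v f) ≡ edge c (γV v) (γF f)
    edge₊-image v f = incident-edge _ _ _ (trans (pres-VE v _) (VE-edge₊ v f)) (trans (pres-EF _ f) (EF-edge₊ v f))

    γV-τ₁ : ∀ v f → Signed v f → γV (τ₁ v f) ≡ oppV b (γV v) (γF f)
    γV-τ₁ v f s with incident-vertex b (γV v) (γF f) (γV (τ₁ v f))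
                       (subst (λ e → VE (γV (τ₁ v f)) e ≡ true) s (trans (pres-VE _ _) (VE-oppV true v f)))
    ... | inj₁ eq = contradiction (sym (γV-injective eq)) (oppV-≢ true v f)
    ... | inj₂ eq = eq

    γF-τ₂ : ∀ v f → Signed v f → γF (τ₂ v f) ≡ oppF b (γV v) (γF f)
    γF-τ₂ v f s with incident-face b (γV v) (γF f) (γF (τ₂ v f))
                       (subst (λ e → EF e (γF (τ₂ v f)) ≡ true) s (trans (pres-EF _ _) (EF-oppF true v f)))
    ... | inj₁ eq = contradiction (sym (γF-injective eq)) (oppF-≢ true v f)
    ... | inj₂ eq = eq

    bool-cases : ∀ a c → c ≡ a ⊎ c ≡ not a
    bool-cases true  true  = inj₁ refl
    bool-cases true  false = inj₂ refl
    bool-cases false true  = inj₂ refl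
    bool-cases false false = inj₁ refl

    -- Seen from the neighbouring corner, `edge₊ v f` is the edge of colour `false`, and its image
    -- is the edge of colour `not b` at the image corner. If the positive edge there also went to
    -- colour `not b`, then γ would identify two distinct edges.
    signed-τ₁ : ∀ v f → Signed v f → Signed (τ₁ v f) f
    signed-τ₁ v f s with edge₊-image (τ₁ v f) f
    ... | c , eq with bool-cases b c
    ...   | inj₁ refl = eq
    ...   | inj₂ refl = contradiction (γE-injective (begin
      γE (edge₊ (τ₁ v f) f)                              ≡⟨ eq ⟩
      edge (not b) (γV (τ₁ v f)) (γF f)                  ≡⟨ cong (λ u → edge (not b) u (γF f)) (γV-τ₁ v f s) ⟩
      edge (not b) (oppV b (γV v) (γF f)) (γF f)         ≡⟨ edge-oppV b (γV v) (γF f) ⟩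
      edge b (γV v) (γF f)                               ≡⟨ s ⟨
      γE (edge₊ v f)                                     ≡⟨ cong γE (edge-oppV true v f) ⟨
      γE (edge false (τ₁ v f) f)                         ∎)) (edge-≢ (τ₁ v f) f)
      where open ≡-Reasoning

    signed-τ₂ : ∀ v f → Signed v f → Signed v (τ₂ v f)
    signed-τ₂ v f s with edge₊-image v (τ₂ v f)
    ... | c , eq with bool-cases b c
    ...   | inj₁ refl = eq
    ...   | inj₂ refl = contradiction (γE-injective (begin
      γE (edge₊ v (τ₂ v f))                              ≡⟨ eq ⟩
      edge (not b) (γV v) (γF (τ₂ v f))                  ≡⟨ cong (edge (not b) (γV v)) (γF-τ₂ v f s) ⟩
      edge (not b) (γV v) (oppF b (γV v) (γF f))         ≡⟨ edge-oppF b (γV v) (γF f) ⟩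
      edge b (γV v) (γF f)                               ≡⟨ s ⟨
      γE (edge₊ v f)                                     ≡⟨ cong γE (edge-oppF true v f) ⟨
      γE (edge false v (τ₂ v f))                         ∎)) (edge-≢ v (τ₂ v f))
      where open ≡-Reasoning

    -- The sign spreads along the vertices of the base face and then around each vertex, so an
    -- automorphism preserves all colours or reverses all of them.
    signed-everywhere : Signed oV oF → ∀ v f → Signed v f
    signed-everywhere s v = cycle-around-vertex v (Signed v)
      (cycle-around-face oF (λ v → Signed v oF) s (λ v → signed-τ₁ v oF) v) (signed-τ₂ v)

  -- Composing γ with the inverse of a group element that agrees with it on the base pair gives a
  -- reflection fixing that pair, which is the situation excluded by `no-reflection`.
  no-negative : (γ : Aut 𝒫) → ¬ Automorphism.Signed γ false oV oF
  no-negative γ s with transitive (Aut.mV γ oV) (Aut.mF γ oF)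
  ... | w , wv , wf = no-reflection (λ v → iV g (Aut.mV γ v)) (λ f → iF g (Aut.mF γ f))
      (trans (cong (iV g) (sym wv)) (iV-mV g oV)) (trans (cong (iF g) (sym wf)) (iF-mF g oF))
      (λ v f → trans (cong (iV g) (γV-τ₁ v f (all v f))) (mV-ρ₁ (g ⁻ˢ) _ _))
      (λ v f → trans (cong (iF g) (γF-τ₂ v f (all v f))) (mF-ρ₂ (g ⁻ˢ) _ _))
    where
    open Automorphism γ false
    g = wordSym w
    all = signed-everywhere s

  base : Flag 𝒫
  base = mkFlag true oV oF

  -- A colour-preserving automorphism commutes with τ, so it is determined by the image of the base
  -- pair, and by transitivity some word has the same image.
  automorphism-word : (γ : Aut 𝒫) → Σ Word λ w →
      (∀ v → Aut.mV γ v ≡ mV (wordSym w) v)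
    × (∀ f → Aut.mF γ f ≡ mF (wordSym w) f)
    × (∀ v f → Aut.mE γ (edge₊ v f) ≡ edge₊ (mV (wordSym w) v) (mF (wordSym w) f))
  automorphism-word γ with Automorphism.edge₊-image γ true oV oF
  ... | false , s = contradiction s (no-negative γ)
  ... | true , s with transitive (Aut.mV γ oV) (Aut.mF γ oF)
  ...   | w , wv , wf = w , eqV , eqF , λ v f → trans (signed-everywhere s v f) (cong₂ edge₊ (eqV v) (eqF f))
    where
    open Automorphism γ true
    g = wordSym w
    eqV : ∀ v → Aut.mV γ v ≡ mV g v
    eqV = cycle-around-face oF (λ v → Aut.mV γ v ≡ mV g v) (sym wv) λ v eq →
      trans (γV-τ₁ v oF (signed-everywhere s v oF)) (trans (cong₂ τ₁ eq (sym wf)) (sym (mV-τ₁ g v oF)))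
    eqF : ∀ f → Aut.mF γ f ≡ mF g f
    eqF = cycle-around-vertex oV (λ f → Aut.mF γ f ≡ mF g f) (sym wf) λ f eq →
      trans (γF-τ₂ oV f (signed-everywhere s oV f)) (trans (cong₂ τ₂ (sym wv) eq) (sym (mF-τ₂ g oV f)))

  chiral : Chiral 𝒫
  chiral = signFlag , adj₀ , adj₁ , adj₂ , trans-on-classes , not-transitive
    where
    adj₀ : ∀ Φ Ψ → Adj₀ 𝒫 Φ Ψ → signFlag Φ ≢ signFlag Ψ
    adj₀ (flag v e f p q) (flag u _ _ p′ q′) (v≢u , refl , refl) eq
      with incident-vertex (sign v e f p q) v f u (subst (λ e → VE u e ≡ true) (edge-sign v e f p q) p′)
    ... | inj₁ u≡v = v≢u (sym u≡v)
    ... | inj₂ refl = not-¬ refl (edge-injective b (not b) u f (trans (cong (λ c → edge c u f) eq)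
            (trans (sym (edge-sign u e f p′ q′)) (trans (edge-sign v e f p q) (sym (edge-oppV b v f))))))
      where b = sign v e f p q
    adj₁ : ∀ Φ Ψ → Adj₁ 𝒫 Φ Ψ → signFlag Φ ≢ signFlag Ψ
    adj₁ (flag v e f p q) (flag _ e′ _ p′ q′) (refl , e≢e′ , refl) eq =
      e≢e′ (trans (edge-sign v e f p q) (trans (cong (λ c → edge c v f) eq) (sym (edge-sign v e′ f p′ q′))))
    adj₂ : ∀ Φ Ψ → Adj₂ 𝒫 Φ Ψ → signFlag Φ ≢ signFlag Ψ
    adj₂ (flag v e f p q) (flag _ _ g p′ q′) (refl , refl , f≢g) eq
      with incident-face (sign v e f p q) v f g (subst (λ e → EF e g ≡ true) (edge-sign v e f p q) q′)
    ... | inj₁ g≡f = f≢g (sym g≡f)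
    ... | inj₂ refl = not-¬ refl (edge-injective b (not b) v g (trans (cong (λ c → edge c v g) eq)
            (trans (sym (edge-sign v e g p′ q′)) (trans (edge-sign v e f p q) (sym (edge-oppF b v f))))))
      where b = sign v e f p q
    trans-on-classes : ∀ Φ Ψ → signFlag Φ ≡ signFlag Ψ → ∃ λ γ → FlagEq 𝒫 (actFlag 𝒫 γ Φ) Ψ
    trans-on-classes (flag v e f p q) (flag u e′ g p′ q′) eq with transitive v f | transitive u g
    ... | w , wv , wf | w′ , wv′ , wf′ = toAut h , hv , he , hf
      where
      h = wordSym w′ ∘ˢ (wordSym w ⁻ˢ)
      hv : mV h v ≡ u
      hv = trans (cong (mV (wordSym w′)) (trans (cong (iV (wordSym w)) (sym wv)) (iV-mV (wordSym w) oV))) wv′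
      hf : mF h f ≡ g
      hf = trans (cong (mF (wordSym w′)) (trans (cong (iF (wordSym w)) (sym wf)) (iF-mF (wordSym w) oF))) wf′
      he : mE h e ≡ e′
      he = begin
        mE h e                             ≡⟨ cong (mE h) (edge-sign v e f p q) ⟩
        mE h (edge (sign v e f p q) v f)   ≡⟨ mE-edge h (sign v e f p q) v f ⟩
        edge (sign v e f p q) (mV h v) (mF h f) ≡⟨ cong₂ (edge (sign v e f p q)) hv hf ⟩
        edge (sign v e f p q) u g          ≡⟨ cong (λ c → edge c u g) eq ⟩
        edge (sign u e′ g p′ q′) u g       ≡⟨ edge-sign u e′ g p′ q′ ⟨
        e′                                 ∎
        where open ≡-Reasoning
    not-transitive : ¬ (∀ Φ Ψ → ∃ λ γ → FlagEq 𝒫 (actFlag 𝒫 γ Φ) Ψ)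
    not-transitive H with H base (mkFlag false oV oF)
    -- The two flags share vertex and face but differ in colour, so an automorphism between them is
    -- negative at the base.
    ... | γ , v≡ , e≡ , f≡ = no-negative γ (trans e≡ (cong₂ (edge false) (sym v≡) (sym f≡)))

  isAutGroup : (EqG : Word → Word → Set) →
    (∀ u w → EqG u w ⇔ ((∀ v → mV (wordSym u) v ≡ mV (wordSym w) v) × (∀ f → mF (wordSym u) f ≡ mF (wordSym w) f))) →
    IsAutGroupOf 𝒫 EqG
  isAutGroup EqG faithful =
    base , toAut g₁ , toAut g₂ ,
    (mkFlag false oV oF , (refl , edge-≢ oV oF , refl) , v≢ , sym e₁ , sym g₁-oF) ,
    -- Passing to the adjacent face keeps the edge, but the same edge has the opposite colour as
    -- seen from the new corner.
    (mkFlag false oV (τ₂ oV oF) , (refl , sym (edge-oppF true oV oF) , oppF-≢ true oV oF) , sym g₂-oV , e≢ , τ₂-oV oF) ,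
    same-action ,
    λ γ → let (w , eqV , eqF , eqE) = automorphism-word γ in
      w , (λ v → trans (eqV v) (sym (wordV-sym w v)))
        , (λ { ((v , f) , p) → subst (λ e → Aut.mE γ e ≡ wordE 𝒫 (toAut g₁) (toAut g₂) w e) (edge₊-base v f p)
                                 (trans (eqE v f) (sym (wordE-edge₊ w v f))) })
        , (λ f → trans (eqF f) (sym (wordF-sym w f)))
    where
    g₁oV : mV g₁ oV ≡ ρ₁ oV oF
    g₁oV = trans (sym (ρ₁-τ₁ (mV g₁ oV) oF)) (cong (λ v → ρ₁ v oF) (trans (τ₁-oF _) (iV-mV g₁ oV)))
    v≢ : oV ≢ mV g₁ oV
    v≢ eq = oppV-≢ false oV oF (trans eq g₁oV)
    e₁ : mE g₁ (edge₊ oV oF) ≡ edge false oV oF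
    e₁ = trans (mE-edge₊ g₁ oV oF) (trans (cong₂ edge₊ g₁oV g₁-oF) (edge-oppV false oV oF))
    e≢ : edge false oV (τ₂ oV oF) ≢ mE g₂ (edge₊ oV oF)
    e≢ eq = edge-≢ oV (τ₂ oV oF) (trans (cong₂ edge₊ (sym g₂-oV) (τ₂-oV oF)) (trans (sym (mE-edge₊ g₂ oV oF)) (sym eq)))
    same-action : ∀ u w → EqG u w ⇔ SameAction 𝒫 (toAut g₁) (toAut g₂) u w
    same-action u w = mk⇔ to from
      where
      open Equivalence (faithful u w) renaming (to to ⇒; from to ⇐)
      to : EqG u w → SameAction 𝒫 (toAut g₁) (toAut g₂) u w
      to eq with ⇒ eq
      ... | eqV , eqF =
          (λ v → trans (wordV-sym u v) (trans (eqV v) (sym (wordV-sym w v))))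
        , (λ { ((v , f) , p) → subst (λ e → wordE 𝒫 (toAut g₁) (toAut g₂) u e ≡ wordE 𝒫 (toAut g₁) (toAut g₂) w e)
                 (edge₊-base v f p)
                 (trans (wordE-edge₊ u v f) (trans (cong₂ edge₊ (eqV v) (eqF f)) (sym (wordE-edge₊ w v f)))) })
        , (λ f → trans (wordF-sym u f) (trans (eqF f) (sym (wordF-sym w f))))
      from : SameAction 𝒫 (toAut g₁) (toAut g₂) u w → EqG u w
      from (eqV , _ , eqF) = ⇐
        ( (λ v → trans (sym (wordV-sym u v)) (trans (eqV v) (wordV-sym w v)))
        , (λ f → trans (sym (wordF-sym u f)) (trans (eqF f) (wordF-sym w f))))

-- Maps that are affine on residue classes modulo 8

infix 4 _≡_mod_
record _≡_mod_ (x y : ℤ) (n : ℕ) : Set where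
  constructor _,_
  field
    quotient : ℤ
    equation : x ≡ y + quotient * + n

module _ {n : ℕ} where

  ≡⇒mod : ∀ {x y} → x ≡ y → x ≡ y mod n
  ≡⇒mod {x} refl = + 0 , lemma x (+ n)
    where
    lemma : ∀ x n → x ≡ x + + 0 * n
    lemma = solve-∀

  mod-sym : ∀ {x y} → x ≡ y mod n → y ≡ x mod n
  mod-sym {_} {y} (k , refl) = - k , lemma y k (+ n)
    where
    lemma : ∀ y k n → y ≡ (y + k * n) + (- k) * n
    lemma = solve-∀

  mod-trans : ∀ {x y z} → x ≡ y mod n → y ≡ z mod n → x ≡ z mod n
  mod-trans {_} {_} {z} (k , refl) (l , refl) = l + k , lemma z k l (+ n)
    where
    lemma : ∀ z k l n → (z + l * n) + k * n ≡ z + (l + k) * n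
    lemma = solve-∀

  mod-+ : ∀ {x y u v} → x ≡ y mod n → u ≡ v mod n → x + u ≡ y + v mod n
  mod-+ {_} {y} {_} {v} (k , refl) (l , refl) = k + l , lemma y v k l (+ n)
    where
    lemma : ∀ y v k l n → (y + k * n) + (v + l * n) ≡ y + v + (k + l) * n
    lemma = solve-∀

  mod-* : ∀ a {x y} → x ≡ y mod n → a * x ≡ a * y mod n
  mod-* a {_} {y} (k , refl) = a * k , lemma a y k (+ n)
    where
    lemma : ∀ a y k n → a * (y + k * n) ≡ a * y + a * k * n
    lemma = solve-∀

-- The distance of a and b is the absolute value of k times n, yet it is below n, which forces k =
-- 0.
remainder-unique : ∀ {n a b} → a ℕ.< n → b ℕ.< n → + a ≡ + b mod n → a ≡ b
remainder-unique {n} {a} {b} a<n b<n (k , eq) = ℤ.+-injective (ℤ.i-j≡0⇒i≡j (+ a) (+ b) (ℤ.∣i∣≡0⇒i≡0 (difference ∣ k ∣ refl)))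
  where
  lemma : ∀ b k n → b + k * n - b ≡ k * n
  lemma = solve-∀
  ∣a-b∣ : ∣ + a - + b ∣ ≡ ∣ k ∣ ℕ.* n
  ∣a-b∣ = trans (cong (λ x → ∣ x - + b ∣) eq) (trans (cong ∣_∣ (lemma (+ b) k (+ n))) (ℤ.abs-* k (+ n)))
  bound : ∣ + a - + b ∣ ℕ.< n
  bound = subst (ℕ._< n) (cong ∣_∣ (sym (ℤ.m-n≡m⊖n a b))) (ℕ.≤-<-trans (ℤ.∣m⊝n∣≤m⊔n a b) (ℕ.⊔-lub a<n b<n))
  difference : ∀ l → ∣ k ∣ ≡ l → ∣ + a - + b ∣ ≡ 0
  difference ℕ.zero    eq′ = trans ∣a-b∣ (cong (ℕ._* n) eq′)
  difference (ℕ.suc l) eq′ = contradiction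
    (ℕ.≤-<-trans (ℕ.≤-trans (ℕ.m≤m+n n (l ℕ.* n)) (ℕ.≤-reflexive (sym (trans ∣a-b∣ (cong (ℕ._* n) eq′))))) bound)
    (ℕ.<-irrefl refl)

-- An interface to ℤ/n. Modules take it as a parameter, so `cls` and `val` stay opaque while the
-- finite checks are evaluated.
record Cyclic (n : ℕ) : Set₁ where
  field
    A        : Set
    _≟_      : DecidableEquality A
    A↔Fin    : A ↔ Fin n
    cls      : ℤ → A
    val      : A → ℕ
    cls-val  : ∀ a → cls (+ val a) ≡ a
    val-cls  : ∀ x → + val (cls x) ≡ x mod n
    cls-cong : ∀ {x y} → x ≡ y mod n → cls x ≡ cls y

  cls-injective : ∀ {x y} → cls x ≡ cls y → x ≡ y mod n
  cls-injective {x} {y} eq =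
    mod-trans (mod-sym (val-cls x)) (mod-trans (≡⇒mod (cong (λ a → + val a) eq)) (val-cls y))

cyclic : ∀ n .{{_ : NonZero n}} → Cyclic n
cyclic n = record
  { A = Fin n ; _≟_ = Fin._≟_ ; A↔Fin = ↔-refl ; cls = cls ; val = toℕ
  ; cls-val = λ a → Fin.toℕ-injective (remainder-unique (Fin.toℕ<n _) (Fin.toℕ<n a) (val-cls (+ toℕ a)))
  ; val-cls = val-cls
  ; cls-cong = λ {x} {y} eq → Fin.toℕ-injective (remainder-unique (Fin.toℕ<n (cls x)) (Fin.toℕ<n (cls y))
      (mod-trans (val-cls x) (mod-trans eq (mod-sym (val-cls y))))) }
  where
  cls : ℤ → Fin n
  cls x = fromℕ< (n%ℕd<d x n)
  val-cls : ∀ x → + toℕ (cls x) ≡ x mod n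
  val-cls x = mod-trans (≡⇒mod (cong +_ (Fin.toℕ-fromℕ< (n%ℕd<d x n)))) (mod-sym (x /ℕ n , a≡a%ℕn+[a/ℕn]*n x n))

module Affine (m : ℕ) .{{_ : NonZero m}} (C : Cyclic (4 ℕ.* m)) where
  open Cyclic C public

  μ : ℤ
  μ = + m

  Point : Set
  Point = Fin 8 × A

  record Form : Set where
    constructor form
    field
      cw cz c₁ cμ : ℤ
  open Form

  ⟦_⟧ : Form → ℤ → ℤ → ℤ
  ⟦ form a b p q ⟧ w z = a * w + b * z + (p + q * μ)

  -- The coefficient of m only matters modulo 4, since the modulus is 4 m.
  infix 4 _≅_
  _≅_ : Form → Form → Set
  form a b p q ≅ form a′ b′ p′ q′ = a ≡ a′ × b ≡ b′ × p ≡ p′ × (q - q′) %ℕ 4 ≡ 0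

  _≅?_ : ∀ φ ψ → Dec (φ ≅ ψ)
  form a b p q ≅? form a′ b′ p′ q′ = a ℤ.≟ a′ ×-dec b ℤ.≟ b′ ×-dec p ℤ.≟ p′ ×-dec (q - q′) %ℕ 4 ℕ.≟ 0

  4μ-mod : ∀ q q′ → (q - q′) %ℕ 4 ≡ 0 → q * μ ≡ q′ * μ mod (4 ℕ.* m)
  4μ-mod q q′ eq = k , (begin
    q * μ                         ≡⟨ lemma q q′ μ ⟩
    q′ * μ + (q - q′) * μ         ≡⟨ cong (λ d → q′ * μ + d * μ) (a≡a%ℕn+[a/ℕn]*n (q - q′) 4) ⟩
    q′ * μ + (+ ((q - q′) %ℕ 4) + k * + 4) * μ
                                  ≡⟨ cong (λ r → q′ * μ + (+ r + k * + 4) * μ) eq ⟩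
    q′ * μ + (+ 0 + k * + 4) * μ  ≡⟨ lemma′ q′ k μ ⟩
    q′ * μ + k * (+ 4 * μ)        ≡⟨ cong (λ x → q′ * μ + k * x) (ℤ.pos-* 4 m) ⟨
    q′ * μ + k * + (4 ℕ.* m)      ∎)
    where
    open ≡-Reasoning
    k = (q - q′) /ℕ 4
    lemma : ∀ q q′ μ → q * μ ≡ q′ * μ + (q - q′) * μ
    lemma = solve-∀
    lemma′ : ∀ q′ k μ → q′ * μ + (+ 0 + k * + 4) * μ ≡ q′ * μ + k * (+ 4 * μ)
    lemma′ = solve-∀

  ≅-sound : ∀ φ ψ → φ ≅ ψ → ∀ w z → ⟦ φ ⟧ w z ≡ ⟦ ψ ⟧ w z mod (4 ℕ.* m)
  ≅-sound (form a b p q) (form _ _ _ q′) (refl , refl , refl , eq) w z =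
    mod-+ (≡⇒mod {x = a * w + b * z} refl) (mod-+ (≡⇒mod {x = p} refl) (4μ-mod q q′ eq))

  ⟦⟧-cong : ∀ φ {w w′ z z′} → w ≡ w′ mod (4 ℕ.* m) → z ≡ z′ mod (4 ℕ.* m) → ⟦ φ ⟧ w z ≡ ⟦ φ ⟧ w′ z′ mod (4 ℕ.* m)
  ⟦⟧-cong (form a b p q) eq eq′ = mod-+ (mod-+ (mod-* a eq) (mod-* b eq′)) (≡⇒mod refl)

  _[_,_] : Form → Form → Form → Form
  form a b p q [ form a₁ b₁ p₁ q₁ , form a₂ b₂ p₂ q₂ ] =
    form (a * a₁ + b * a₂) (a * b₁ + b * b₂) (a * p₁ + b * p₂ + p) (a * q₁ + b * q₂ + q)

  substitution : ∀ φ ψ χ w z → ⟦ φ [ ψ , χ ] ⟧ w z ≡ ⟦ φ ⟧ (⟦ ψ ⟧ w z) (⟦ χ ⟧ w z)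
  substitution (form a b p q) (form a₁ b₁ p₁ q₁) (form a₂ b₂ p₂ q₂) w z =
    lemma a b p q a₁ b₁ p₁ q₁ a₂ b₂ p₂ q₂ w z μ
    where
    lemma : ∀ a b p q a₁ b₁ p₁ q₁ a₂ b₂ p₂ q₂ w z μ →
      (a * a₁ + b * a₂) * w + (a * b₁ + b * b₂) * z + ((a * p₁ + b * p₂ + p) + (a * q₁ + b * q₂ + q) * μ)
      ≡ a * (a₁ * w + b₁ * z + (p₁ + q₁ * μ)) + b * (a₂ * w + b₂ * z + (p₂ + q₂ * μ)) + (p + q * μ)
    lemma = solve-∀

  Cell : Set
  Cell = Fin 8 × Form

  -- For each pair of residues there are two cells: the new residue of the vertex or face, and the
  -- new quotient as a form in the old quotients w (vertex) and z (face).
  Map : Set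
  Map = Fin 8 → Fin 8 → Cell × Cell

  at : Cell → A → A → Point
  at (r , φ) w z = r , cls (⟦ φ ⟧ (+ val w) (+ val z))

  apply : Map → Point × Point → Point × Point
  apply T ((r , w) , (s , z)) = at (proj₁ (T r s)) w z , at (proj₂ (T r s)) w z

  substitute : Cell × Cell → Form → Form → Cell × Cell
  substitute ((r , φ) , (s , φ′)) ψ χ = (r , φ [ ψ , χ ]) , (s , φ′ [ ψ , χ ])

  infixl 9 _⟨$⟩_
  _⟨$⟩_ : Map → Cell × Cell → Cell × Cell
  T ⟨$⟩ ((r , ψ) , (s , χ)) = substitute (T r s) ψ χ

  infixr 9 _⊙_
  _⊙_ : Map → Map → Map
  (T ⊙ U) r s = T ⟨$⟩ U r s

  -- Symbolic substitution skips the reduction by `cls` between the two maps; this is harmless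
  -- because integral affine forms respect congruences.
  ⊙-apply : ∀ T U x → apply (T ⊙ U) x ≡ apply T (apply U x)
  ⊙-apply T U ((r , w) , (s , z)) = cong₂ _,_ (part (proj₁ (T r′ s′))) (part (proj₂ (T r′ s′)))
    where
    r′ = proj₁ (proj₁ (U r s))
    s′ = proj₁ (proj₂ (U r s))
    ψ = proj₂ (proj₁ (U r s))
    χ = proj₂ (proj₂ (U r s))
    part : (c : Cell) → at (proj₁ c , proj₂ c [ ψ , χ ]) w z ≡ at c (cls (⟦ ψ ⟧ (+ val w) (+ val z))) (cls (⟦ χ ⟧ (+ val w) (+ val z)))
    part (t , φ) = cong (t ,_) (cls-cong (mod-trans (≡⇒mod (substitution φ ψ χ _ _))
      (⟦⟧-cong φ (mod-sym (val-cls _)) (mod-sym (val-cls _)))))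

  _≈ᶜ_ : Cell → Cell → Set
  (r , φ) ≈ᶜ (s , ψ) = r ≡ s × φ ≅ ψ

  _≈ᶜ?_ : ∀ c d → Dec (c ≈ᶜ d)
  (r , φ) ≈ᶜ? (s , ψ) = r Fin.≟ s ×-dec φ ≅? ψ

  ≈ᶜ-sound : ∀ c d → c ≈ᶜ d → ∀ w z → at c w z ≡ at d w z
  ≈ᶜ-sound (r , φ) (_ , ψ) (refl , eq) w z = cong (r ,_) (cls-cong (≅-sound φ ψ eq _ _))

  infix 4 _≈₁_ _≈₂_
  _≈₁_ _≈₂_ : Map → Map → Set
  T ≈₁ U = ∀ r s → proj₁ (T r s) ≈ᶜ proj₁ (U r s)
  T ≈₂ U = ∀ r s → proj₂ (T r s) ≈ᶜ proj₂ (U r s)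

  _≈₁?_ : ∀ T U → Dec (T ≈₁ U)
  T ≈₁? U = Fin.all? λ r → Fin.all? λ s → proj₁ (T r s) ≈ᶜ? proj₁ (U r s)

  _≈₂?_ : ∀ T U → Dec (T ≈₂ U)
  T ≈₂? U = Fin.all? λ r → Fin.all? λ s → proj₂ (T r s) ≈ᶜ? proj₂ (U r s)

  -- The implicit argument is filled by evaluating 64 comparisons. The coefficients are closed
  -- integers, since m appears only through its own coefficient.
  check₁ : ∀ T U {_ : True (T ≈₁? U)} → ∀ x → proj₁ (apply T x) ≡ proj₁ (apply U x)
  check₁ T U {t} ((r , w) , (s , z)) = ≈ᶜ-sound (proj₁ (T r s)) (proj₁ (U r s)) (toWitness {a? = T ≈₁? U} t r s) w z

  check₂ : ∀ T U {_ : True (T ≈₂? U)} → ∀ x → proj₂ (apply T x) ≡ proj₂ (apply U x)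
  check₂ T U {t} ((r , w) , (s , z)) = ≈ᶜ-sound (proj₂ (T r s)) (proj₂ (U r s)) (toWitness {a? = T ≈₂? U} t r s) w z

  check : ∀ T U {_ : True (T ≈₁? U)} {_ : True (T ≈₂? U)} → ∀ x → apply T x ≡ apply U x
  check T U {t} {t′} x = cong₂ _,_ (check₁ T U {t} x) (check₂ T U {t′} x)

  odd : Fin 8 → Bool
  odd r = does (toℕ r ℕ.% 2 ℕ.≟ 1)

  ι : Fin 8 → ℤ
  ι r = + toℕ r

  half : ℤ → ℤ
  half x = x /ℕ 2

  -- The point 8 (a w + b z + q m) + e, for e an arbitrary integer.
  cell : (a b e q : ℤ) → Cell
  cell a b e q = fromℕ< (n%ℕd<d e 8) , form a b (e /ℕ 8) q

  twist : Fin 8 → ℤ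
  twist r = if odd r then half (+ 1 - ι r) else half (ι r)

  -- A triple (a , e , q) at residue r encodes the map from 8w + r to 8(a w + q m) + e, that is, to
  -- 8 a w + e + q M.
  Map₁ : Set
  Map₁ = Fin 8 → ℤ × ℤ × ℤ

  rotate rotate⁻ flip flip⁻ slide slide⁻ negate collapse : Map₁
  rotate  r = + 1 , ι r + + 1 , + 0
  rotate⁻ r = + 1 , ι r - + 1 , + 0
  flip    r = - + 1 , - ι r , twist r
  -- The preimage of r is -r modulo 8, so the required multiplier is c(-r), which equals r + c(r)
  -- modulo 4.
  flip⁻   r = - + 1 , - ι r , ι r + twist r
  slide   s = + 1 , (if odd s then ι s - + 2 else ι s) , - twist s
  slide⁻  s = + 1 , (if odd s then ι s + + 2 else ι s) , (if odd s then - half (ι s + + 1) else half (ι s))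
  negate  s = - + 1 , - ι s , + 0
  collapse _ = + 0 , + 0 , + 0

  keep : Map₁
  keep r = + 1 , ι r , + 0

  _⊗_ : Map₁ → Map₁ → Map
  (K ⊗ H) r s =
    let (a , e , q) = K r
        (b , e′ , q′) = H s
    in cell a (+ 0) e q , cell (+ 0) b e′ q′

  apply₁ : Map₁ → Point → Point
  -- The class of 0 fills the slot of the absent coordinate; its coefficient is 0.
  apply₁ K (r , w) = let (a , e , q) = K r in at (cell a (+ 0) e q) w (cls (+ 0))

  ⊗-apply : ∀ K H v f → apply (K ⊗ H) (v , f) ≡ (apply₁ K v , apply₁ H f)
  ⊗-apply K H (r , w) (s , z) = cong₂ _,_
    (let (a , e , q) = K r in
     cong (_ ,_) (cong cls (lemma (a * + val w) (+ val z) (+ val (cls (+ 0))) (e /ℕ 8 + q * μ))))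
    (let (b , e , q) = H s in
     cong (_ ,_) (cong cls (lemma′ (+ val w) (+ val z) (+ val (cls (+ 0))) b (e /ℕ 8 + q * μ))))
    where
    lemma : ∀ x z z′ y → x + + 0 * z + y ≡ x + + 0 * z′ + y
    lemma = solve-∀
    lemma′ : ∀ w z z′ b y → + 0 * w + b * z + y ≡ b * z + + 0 * z′ + y
    lemma′ = solve-∀

  -- On odd faces each application of σ₁ lowers f by 2 and raises c(f) by 1, so v applications
  -- accumulate this triangular number as a multiple of M.
  tri : ℤ → ℤ
  tri v = half (v * (v - + 1))

  -- (v , f) = σ₁^v (0 , f₀) is sent by R₂ to σ₁^v (0 , f₀ + 1): right multiplication by σ₂.
  -- Its face component is that of τ, since σ₁ fixes the base face; the vertex component of τ is
  -- similarly that of right multiplication by σ₁⁻¹.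
  τ : Map
  τ r s = first , second
    where
    v = ι r
    f = ι s
    first = if odd s
      then (if odd r then cell (+ 1) (+ 0) (v + + 1) (half (f - + 1) - v - + 1)
                     else cell (+ 1) (+ 0) (v + + 1) (half (f - + 1) + v + + 1))
      else cell (+ 1) (+ 0) (v - + 1) (- half f)
    second = if odd s
      then cell (+ 2) (+ 1) (f + + 1 + + 2 * v) (tri v - v * (f + + 2 * v))
      else cell (- + 2) (+ 1) (f + + 1 - + 2 * v) (v * f - tri v)

  R₂ R₂⁻ : Map
  R₂ r s = proj₁ ((keep ⊗ keep) r s) , proj₂ (τ r s)
  R₂⁻ r s = proj₁ ((keep ⊗ keep) r s) , (if odd s
      then cell (+ 2) (+ 1) (f - + 1 + + 2 * v) (v * (+ 1 - f - + 2 * v) + tri v)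
      else cell (- + 2) (+ 1) (f - + 1 - + 2 * v) (v * f - v - tri v))
    where
    v = ι r
    f = ι s

  idM : Map
  idM = keep ⊗ keep

-- The vertex and face actions

module Model (m : ℕ) .{{_ : NonZero m}} (C : Cyclic (4 ℕ.* m)) where
  open Affine m C

  n : ℕ
  n = 4 ℕ.* m

  keep-cell : ∀ r → cell (+ 1) (+ 0) (ι r) (+ 0) ≈ᶜ (r , form (+ 1) (+ 0) (+ 0) (+ 0))
  keep-cell = toWitness {a? = Fin.all? λ r → cell (+ 1) (+ 0) (ι r) (+ 0) ≈ᶜ? (r , form (+ 1) (+ 0) (+ 0) (+ 0))} _

  apply₁-keep : ∀ v → apply₁ keep v ≡ v
  apply₁-keep (r , w) = trans (≈ᶜ-sound (cell (+ 1) (+ 0) (ι r) (+ 0)) (r , form (+ 1) (+ 0) (+ 0) (+ 0)) (keep-cell r) w (cls (+ 0)))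
    (cong (r ,_) (trans (cong cls (lemma (+ val w) (+ val (cls (+ 0))) μ)) (cls-val w)))
    where
    lemma : ∀ w z μ → + 1 * w + + 0 * z + (+ 0 + + 0 * μ) ≡ w
    lemma = solve-∀

  apply-id : ∀ x → apply idM x ≡ x
  apply-id (v , f) = trans (⊗-apply keep keep v f) (cong₂ _,_ (apply₁-keep v) (apply₁-keep f))

  o : Point
  o = # 0 , cls (+ 0)

  -- Precomposing with `collapse` turns a statement about the base point into an identity of maps,
  -- which `check` can decide.
  apply₁-collapse : ∀ v → apply₁ collapse v ≡ o
  apply₁-collapse (r , w) = cong (_ ,_) (cong cls (lemma (+ val w) (+ val (cls (+ 0))) μ))
    where
    lemma : ∀ w z μ → + 0 * w + + 0 * z + (+ 0 + + 0 * μ) ≡ + 0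
    lemma = solve-∀

  ⊙-⊗ : ∀ T K H v f → apply (T ⊙ (K ⊗ H)) (v , f) ≡ apply T (apply₁ K v , apply₁ H f)
  ⊙-⊗ T K H v f = trans (⊙-apply T (K ⊗ H) (v , f)) (cong (apply T) (⊗-apply K H v f))

  τ-τ : ∀ x → apply τ (apply τ x) ≡ x
  τ-τ x = trans (sym (⊙-apply τ τ x)) (trans (check (τ ⊙ τ) idM x) (apply-id x))

  R₂⁻-id : ∀ x → proj₁ (apply R₂⁻ x) ≡ proj₁ x
  R₂⁻-id x = trans (check₁ R₂⁻ idM x) (cong proj₁ (apply-id x))

  R₂-id : ∀ x → proj₁ (apply R₂ x) ≡ proj₁ x
  R₂-id x = trans (check₁ R₂ idM x) (cong proj₁ (apply-id x))

  odd-cell : ∀ r s → odd (proj₁ (proj₁ (τ r s))) ≡ not (odd r) × odd (proj₁ (proj₂ (τ r s))) ≡ not (odd s)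
  odd-cell = toWitness {a? = Fin.all? λ r → Fin.all? λ s →
    (odd (proj₁ (proj₁ (τ r s))) Bool.≟ not (odd r)) ×-dec (odd (proj₁ (proj₂ (τ r s))) Bool.≟ not (odd s))} _

  tightData : TightData
  tightData = record
    { V = Point ; F = Point
    ; _≟V_ = ≡-dec Fin._≟_ _≟_ ; _≟F_ = ≡-dec Fin._≟_ _≟_
    ; parV = λ v → odd (proj₁ v) ; parF = λ f → odd (proj₁ f)
    ; τ₁ = λ v f → proj₁ (apply τ (v , f))
    ; τ₂ = λ v f → proj₂ (apply τ (v , f))
    ; ρ₂ = λ v f → proj₂ (apply R₂⁻ (v , f))
    ; τ₁-inv = λ v f → cong proj₁ (τ-τ (v , f))
    ; τ₂-inv = λ v f → cong proj₂ (τ-τ (v , f))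
    ; τ₂-ρ₂ = λ v f → begin
        proj₂ (apply τ (v , proj₂ (apply R₂⁻ (v , f))))  ≡⟨ cong (λ u → proj₂ (apply τ (u , proj₂ (apply R₂⁻ (v , f))))) (R₂⁻-id (v , f)) ⟨
        proj₂ (apply τ (apply R₂⁻ (v , f)))              ≡⟨ cong proj₂ (⊙-apply τ R₂⁻ (v , f)) ⟨
        proj₂ (apply (τ ⊙ R₂⁻) (v , f))                  ≡⟨ check₂ (τ ⊙ R₂⁻) idM (v , f) ⟩
        proj₂ (apply idM (v , f))                        ≡⟨ cong proj₂ (apply-id (v , f)) ⟩
        f                                                ∎
    ; ρ₂-τ₂ = λ v f → begin
        proj₂ (apply R₂⁻ (v , proj₂ (apply R₂ (v , f)))) ≡⟨ cong (λ u → proj₂ (apply R₂⁻ (u , proj₂ (apply R₂ (v , f))))) (R₂-id (v , f)) ⟨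
        proj₂ (apply R₂⁻ (apply R₂ (v , f)))             ≡⟨ cong proj₂ (⊙-apply R₂⁻ R₂ (v , f)) ⟨
        proj₂ (apply (R₂⁻ ⊙ R₂) (v , f))                 ≡⟨ check₂ (R₂⁻ ⊙ R₂) idM (v , f) ⟩
        proj₂ (apply idM (v , f))                        ≡⟨ cong proj₂ (apply-id (v , f)) ⟩
        f                                                ∎
    ; parV-τ₁ = λ v f → proj₁ (odd-cell (proj₁ v) (proj₁ f))
    ; parF-τ₂ = λ v f → proj₂ (odd-cell (proj₁ v) (proj₁ f)) }
    where open ≡-Reasoning

  open TightData tightData using (V; F; τ₁; τ₂; ρ₂)
  open Polyhedron tightData using (ρ₁)
  open Symmetries tightData
  open Symmetry

  symmetry : (K K⁻ H H⁻ : Map₁) →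
    (∀ x → apply ((K⁻ ⊗ H⁻) ⊙ (K ⊗ H)) x ≡ apply idM x) →
    (∀ x → apply ((K ⊗ H) ⊙ (K⁻ ⊗ H⁻)) x ≡ apply idM x) →
    (∀ x → apply ((K ⊗ H) ⊙ τ) x ≡ apply (τ ⊙ (K ⊗ H)) x) → Symmetry
  symmetry K K⁻ H H⁻ leftInverse rightInverse commutes = record
    { mV = apply₁ K ; iV = apply₁ K⁻ ; mF = apply₁ H ; iF = apply₁ H⁻
    ; iV-mV = λ v → cong proj₁ (left v o) ; mV-iV = λ v → cong proj₁ (right v o)
    ; iF-mF = λ v → cong proj₂ (left o v) ; mF-iF = λ v → cong proj₂ (right o v)
    ; mV-τ₁ = λ v f → cong proj₁ (commute v f) ; mF-τ₂ = λ v f → cong proj₂ (commute v f) }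
    where
    open ≡-Reasoning
    left : ∀ v f → (apply₁ K⁻ (apply₁ K v) , apply₁ H⁻ (apply₁ H f)) ≡ (v , f)
    left v f = begin
      apply₁ K⁻ (apply₁ K v) , apply₁ H⁻ (apply₁ H f)  ≡⟨ ⊗-apply K⁻ H⁻ (apply₁ K v) (apply₁ H f) ⟨
      apply (K⁻ ⊗ H⁻) (apply₁ K v , apply₁ H f)        ≡⟨ ⊙-⊗ (K⁻ ⊗ H⁻) K H v f ⟨
      apply ((K⁻ ⊗ H⁻) ⊙ (K ⊗ H)) (v , f)              ≡⟨ leftInverse (v , f) ⟩
      apply idM (v , f)                                ≡⟨ apply-id (v , f) ⟩
      v , f                                            ∎
    right : ∀ v f → (apply₁ K (apply₁ K⁻ v) , apply₁ H (apply₁ H⁻ f)) ≡ (v , f)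
    right v f = begin
      apply₁ K (apply₁ K⁻ v) , apply₁ H (apply₁ H⁻ f)  ≡⟨ ⊗-apply K H (apply₁ K⁻ v) (apply₁ H⁻ f) ⟨
      apply (K ⊗ H) (apply₁ K⁻ v , apply₁ H⁻ f)        ≡⟨ ⊙-⊗ (K ⊗ H) K⁻ H⁻ v f ⟨
      apply ((K ⊗ H) ⊙ (K⁻ ⊗ H⁻)) (v , f)              ≡⟨ rightInverse (v , f) ⟩
      apply idM (v , f)                                ≡⟨ apply-id (v , f) ⟩
      v , f                                            ∎
    commute : ∀ v f → (apply₁ K (τ₁ v f) , apply₁ H (τ₂ v f)) ≡ apply τ (apply₁ K v , apply₁ H f)
    commute v g = begin
      apply₁ K (τ₁ v g) , apply₁ H (τ₂ v g)            ≡⟨ ⊗-apply K H (τ₁ v g) (τ₂ v g) ⟨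
      apply (K ⊗ H) (apply τ (v , g))                  ≡⟨ ⊙-apply (K ⊗ H) τ (v , g) ⟨
      apply ((K ⊗ H) ⊙ τ) (v , g)                      ≡⟨ commutes (v , g) ⟩
      apply (τ ⊙ (K ⊗ H)) (v , g)                      ≡⟨ ⊙-⊗ τ K H v g ⟩
      apply τ (apply₁ K v , apply₁ H g)                ∎

  x-left : ∀ x → apply ((rotate⁻ ⊗ slide⁻) ⊙ (rotate ⊗ slide)) x ≡ apply idM x
  x-left = check ((rotate⁻ ⊗ slide⁻) ⊙ (rotate ⊗ slide)) idM

  x-right : ∀ x → apply ((rotate ⊗ slide) ⊙ (rotate⁻ ⊗ slide⁻)) x ≡ apply idM x
  x-right = check ((rotate ⊗ slide) ⊙ (rotate⁻ ⊗ slide⁻)) idM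

  x-τ : ∀ x → apply ((rotate ⊗ slide) ⊙ τ) x ≡ apply (τ ⊙ (rotate ⊗ slide)) x
  x-τ = check ((rotate ⊗ slide) ⊙ τ) (τ ⊙ (rotate ⊗ slide))

  y-left : ∀ x → apply ((flip⁻ ⊗ rotate⁻) ⊙ (flip ⊗ rotate)) x ≡ apply idM x
  y-left = check ((flip⁻ ⊗ rotate⁻) ⊙ (flip ⊗ rotate)) idM

  y-right : ∀ x → apply ((flip ⊗ rotate) ⊙ (flip⁻ ⊗ rotate⁻)) x ≡ apply idM x
  y-right = check ((flip ⊗ rotate) ⊙ (flip⁻ ⊗ rotate⁻)) idM

  y-τ : ∀ x → apply ((flip ⊗ rotate) ⊙ τ) x ≡ apply (τ ⊙ (flip ⊗ rotate)) x
  y-τ = check ((flip ⊗ rotate) ⊙ τ) (τ ⊙ (flip ⊗ rotate))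

  g₁ g₂ : Symmetry
  g₁ = symmetry rotate rotate⁻ slide slide⁻ x-left x-right x-τ
  g₂ = symmetry flip flip⁻ rotate rotate⁻ y-left y-right y-τ

  open Words g₁ g₂

  actV : Word → V → V
  actV w = mV (wordSym w)

  actF : Word → F → F
  actF w = mF (wordSym w)

  actV-++ : ∀ u w v → actV (u ++ w) v ≡ actV u (actV w v)
  actV-++ []      w v = refl
  actV-++ (x ∷ u) w v = cong (mV (letterSym x)) (actV-++ u w v)

  actF-++ : ∀ u w f → actF (u ++ w) f ≡ actF u (actF w f)
  actF-++ []      w f = refl
  actF-++ (x ∷ u) w f = cong (mF (letterSym x)) (actF-++ u w f)

  act : Word → V × F → V × F
  act w (v , f) = actV w v , actF w f

  letterMap : Letter → Map
  letterMap (s₁ , false) = rotate ⊗ slide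
  letterMap (s₁ , true)  = rotate⁻ ⊗ slide⁻
  letterMap (s₂ , false) = flip ⊗ rotate
  letterMap (s₂ , true)  = flip⁻ ⊗ rotate⁻

  letter-act : ∀ x v f → (mV (letterSym x) v , mF (letterSym x) f) ≡ apply (letterMap x) (v , f)
  letter-act (s₁ , false) v f = sym (⊗-apply rotate slide v f)
  letter-act (s₁ , true)  v f = sym (⊗-apply rotate⁻ slide⁻ v f)
  letter-act (s₂ , false) v f = sym (⊗-apply flip rotate v f)
  letter-act (s₂ , true)  v f = sym (⊗-apply flip⁻ rotate⁻ v f)

  wordMap : Word → Map
  wordMap []      = idM
  wordMap (x ∷ w) = letterMap x ⊙ wordMap w

  act-wordMap : ∀ w x → act w x ≡ apply (wordMap w) x
  act-wordMap []      x = sym (apply-id x)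
  act-wordMap (ℓ ∷ w) x = trans (letter-act ℓ _ _)
    (trans (cong (apply (letterMap ℓ)) (act-wordMap w x)) (sym (⊙-apply (letterMap ℓ) (wordMap w) x)))

  act-map : ∀ u T → (∀ x → apply (wordMap u) x ≡ apply T x) → ∀ x → act u x ≡ apply T x
  act-map u T eq x = trans (act-wordMap u x) (eq x)

  -- Powers of the generators

  jump : (P Q : Fin 8 → ℤ) → Map
  jump P Q r s = (r , form (+ 1) (+ 0) (P r) (+ 0)) , (s , form (+ 0) (+ 1) (Q s) (+ 0))

  jump-apply : ∀ P Q r w s z → apply (jump P Q) ((r , w) , (s , z)) ≡ ((r , cls (+ val w + P r)) , (s , cls (+ val z + Q s)))
  jump-apply P Q r w s z = cong₂ _,_
    (cong (r ,_) (cong cls (lemma (+ val w) (+ val z) (P r) μ)))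
    (cong (s ,_) (cong cls (lemma′ (+ val w) (+ val z) (Q s) μ)))
    where
    lemma : ∀ w z p μ → + 1 * w + + 0 * z + (p + + 0 * μ) ≡ w + p
    lemma = solve-∀
    lemma′ : ∀ w z p μ → + 0 * w + + 1 * z + (p + + 0 * μ) ≡ z + p
    lemma′ = solve-∀

  -- Eight applications of a generator restore the residues and translate each quotient by an amount
  -- depending only on its residue; further iteration just multiplies that amount.
  Jumps : Letter → (P Q : Fin 8 → ℤ) → Set
  Jumps ℓ P Q = ∀ y → act (replicate 8 ℓ) y ≡ apply (jump P Q) y

  many : ∀ ℓ P Q → Jumps ℓ P Q → ∀ k r w s z → act (replicate (k ℕ.* 8) ℓ) ((r , w) , (s , z))
                     ≡ ((r , cls (+ val w + + k * P r)) , (s , cls (+ val z + + k * Q s)))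
  many ℓ P Q eight ℕ.zero r w s z = cong₂ _,_ (cong (r ,_) (base w (P r))) (cong (s ,_) (base z (Q s)))
    where
    lemma : ∀ w p → w + + 0 * p ≡ w
    lemma = solve-∀
    base : ∀ w p → w ≡ cls (+ val w + + 0 * p)
    base w p = sym (trans (cong cls (lemma (+ val w) p)) (cls-val w))
  many ℓ P Q eight (ℕ.suc k) r w s z = begin
    act (replicate 8 ℓ) (act (replicate (k ℕ.* 8) ℓ) ((r , w) , (s , z)))
      ≡⟨ cong (act (replicate 8 ℓ)) (many ℓ P Q eight k r w s z) ⟩
    act (replicate 8 ℓ) ((r , w′) , (s , z′))           ≡⟨ eight ((r , w′) , (s , z′)) ⟩
    apply (jump P Q) ((r , w′) , (s , z′))              ≡⟨ jump-apply P Q r w′ s z′ ⟩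
    (r , cls (+ val w′ + P r)) , (s , cls (+ val z′ + Q s))
      ≡⟨ cong₂ _,_ (cong (r ,_) (next w (P r))) (cong (s ,_) (next z (Q s))) ⟩
    (r , cls (+ val w + + ℕ.suc k * P r)) , (s , cls (+ val z + + ℕ.suc k * Q s)) ∎
    where
    open ≡-Reasoning
    w′ = cls (+ val w + + k * P r)
    z′ = cls (+ val z + + k * Q s)
    lemma : ∀ w k p → w + k * p + p ≡ w + (+ 1 + k) * p
    lemma = solve-∀
    next : ∀ w p → cls (+ val (cls (+ val w + + k * p)) + p) ≡ cls (+ val w + + ℕ.suc k * p)
    next w p = cls-cong (mod-trans (mod-+ (val-cls _) (≡⇒mod {x = p} refl)) (≡⇒mod (lemma (+ val w) (+ k) p)))

  -- The m-fold iterate of a jump. It is expressible as a form because its translation is a multiple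
  -- of m, and so powers with exponent M can enter the checks.
  slow : (P Q : Fin 8 → ℤ) → Map
  slow P Q r s = (r , form (+ 1) (+ 0) (+ 0) (P r)) , (s , form (+ 0) (+ 1) (+ 0) (Q s))

  many-m : ∀ ℓ P Q → Jumps ℓ P Q → ∀ y → act (replicate (m ℕ.* 8) ℓ) y ≡ apply (slow P Q) y
  many-m ℓ P Q eight ((r , w) , (s , z)) = trans (many ℓ P Q eight m r w s z) (cong₂ _,_
    (cong (r ,_) (cong cls (lemma (+ val w) (+ val z) (P r) μ)))
    (cong (s ,_) (cong cls (lemma′ (+ val w) (+ val z) (Q s) μ))))
    where
    lemma : ∀ w z p μ → w + μ * p ≡ + 1 * w + + 0 * z + (+ 0 + p * μ)
    lemma = solve-∀
    lemma′ : ∀ w z p μ → z + μ * p ≡ + 0 * w + + 1 * z + (+ 0 + p * μ)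
    lemma′ = solve-∀

  constant : ℤ → Fin 8 → ℤ
  constant c _ = c

  oddly : ℤ → Fin 8 → ℤ
  oddly c s = if odd s then c else + 0

  x x⁻ y y⁻ : Letter
  x  = s₁ , false
  x⁻ = s₁ , true
  y  = s₂ , false
  y⁻ = s₂ , true

  x-jumps : Jumps x (constant (+ 1)) (oddly (- + 2))
  x-jumps = act-map (replicate 8 x) (jump (constant (+ 1)) (oddly (- + 2)))
    (check (wordMap (replicate 8 x)) (jump (constant (+ 1)) (oddly (- + 2))))

  x⁻-jumps : Jumps x⁻ (constant (- + 1)) (oddly (+ 2))
  x⁻-jumps = act-map (replicate 8 x⁻) (jump (constant (- + 1)) (oddly (+ 2)))
    (check (wordMap (replicate 8 x⁻)) (jump (constant (- + 1)) (oddly (+ 2))))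

  y-jumps : Jumps y (constant (+ 0)) (constant (+ 1))
  y-jumps = act-map (replicate 8 y) (jump (constant (+ 0)) (constant (+ 1)))
    (check (wordMap (replicate 8 y)) (jump (constant (+ 0)) (constant (+ 1))))

  ⟨_⟩ : Point → ℕ
  ⟨ r , w ⟩ = toℕ r ℕ.+ val w ℕ.* 8

  replicate-+ : ∀ j k (ℓ : Letter) → replicate (j ℕ.+ k) ℓ ≡ replicate j ℓ ++ replicate k ℓ
  replicate-+ ℕ.zero    k ℓ = refl
  replicate-+ (ℕ.suc j) k ℓ = cong (ℓ ∷_) (replicate-+ j k ℓ)

  actV-power : ∀ j k ℓ v → actV (replicate (j ℕ.+ k) ℓ) v ≡ actV (replicate j ℓ) (actV (replicate k ℓ) v)
  actV-power j k ℓ v = trans (cong (λ w → actV w v) (replicate-+ j k ℓ)) (actV-++ (replicate j ℓ) (replicate k ℓ) v)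

  actF-power : ∀ j k ℓ f → actF (replicate (j ℕ.+ k) ℓ) f ≡ actF (replicate j ℓ) (actF (replicate k ℓ) f)
  actF-power j k ℓ f = trans (cong (λ w → actF w f) (replicate-+ j k ℓ)) (actF-++ (replicate j ℓ) (replicate k ℓ) f)

  cell-act₁ : ∀ u r s c → proj₁ (wordMap u r s) ≈ᶜ c → ∀ w → actV u (r , w) ≡ at c w (cls (+ 0))
  cell-act₁ u r s c eq w = trans (cong proj₁ (act-wordMap u ((r , w) , (s , cls (+ 0)))))
    (≈ᶜ-sound (proj₁ (wordMap u r s)) c eq w (cls (+ 0)))

  cell-act₂ : ∀ u r s c → proj₂ (wordMap u r s) ≈ᶜ c → ∀ z → actF u (s , z) ≡ at c (cls (+ 0)) z
  cell-act₂ u r s c eq z = trans (cong proj₂ (act-wordMap u ((r , cls (+ 0)) , (s , z))))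
    (≈ᶜ-sound (proj₂ (wordMap u r s)) c eq (cls (+ 0)) z)

  form₁-value : ∀ p w → cls (⟦ form (+ 1) (+ 0) p (+ 0) ⟧ (+ val w) (+ val (cls (+ 0)))) ≡ cls (+ val w + p)
  form₁-value p w = cong cls (lemma (+ val w) (+ val (cls (+ 0))) p μ)
    where
    lemma : ∀ w z p μ → + 1 * w + + 0 * z + (p + + 0 * μ) ≡ w + p
    lemma = solve-∀

  form₂-value : ∀ p z → cls (⟦ form (+ 0) (+ 1) p (+ 0) ⟧ (+ val (cls (+ 0))) (+ val z)) ≡ cls (+ val z + p)
  form₂-value p z = cong cls (lemma (+ val (cls (+ 0))) (+ val z) p μ)
    where
    lemma : ∀ w z p μ → + 0 * w + + 1 * z + (p + + 0 * μ) ≡ z + p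
    lemma = solve-∀

  cls-val-0 : ∀ w → cls (+ val w + + 0) ≡ w
  cls-val-0 w = trans (cong cls (ℤ.+-identityʳ (+ val w))) (cls-val w)

  x-from-0 : ∀ r w → actV (replicate (toℕ r) x) (# 0 , w) ≡ (r , w)
  x-from-0 r w = trans (cell-act₁ (replicate (toℕ r) x) (# 0) (# 0) (r , form (+ 1) (+ 0) (+ 0) (+ 0)) (cells r) w)
      (cong (r ,_) (trans (form₁-value (+ 0) w) (cls-val-0 w)))
    where
    cells : ∀ r → proj₁ (wordMap (replicate (toℕ r) x) (# 0) (# 0)) ≈ᶜ (r , form (+ 1) (+ 0) (+ 0) (+ 0))
    cells = toWitness {a? = Fin.all? λ r → proj₁ (wordMap (replicate (toℕ r) x) (# 0) (# 0)) ≈ᶜ? (r , form (+ 1) (+ 0) (+ 0) (+ 0))} _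

  y-from-0 : ∀ s z → actF (replicate (toℕ s) y) (# 0 , z) ≡ (s , z)
  y-from-0 s z = trans (cell-act₂ (replicate (toℕ s) y) (# 0) (# 0) (s , form (+ 0) (+ 1) (+ 0) (+ 0)) (cells s) z)
      (cong (s ,_) (trans (form₂-value (+ 0) z) (cls-val-0 z)))
    where
    cells : ∀ s → proj₂ (wordMap (replicate (toℕ s) y) (# 0) (# 0)) ≈ᶜ (s , form (+ 0) (+ 1) (+ 0) (+ 0))
    cells = toWitness {a? = Fin.all? λ s → proj₂ (wordMap (replicate (toℕ s) y) (# 0) (# 0)) ≈ᶜ? (s , form (+ 0) (+ 1) (+ 0) (+ 0))} _

  y-to-0 : ∀ s z → actF (replicate (8 ℕ.∸ toℕ s) y) (s , z) ≡ (# 0 , cls (+ val z + + 1))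
  y-to-0 s z = trans (cell-act₂ (replicate (8 ℕ.∸ toℕ s) y) (# 0) s (# 0 , form (+ 0) (+ 1) (+ 1) (+ 0)) (cells s) z)
      (cong (# 0 ,_) (form₂-value (+ 1) z))
    where
    cells : ∀ s → proj₂ (wordMap (replicate (8 ℕ.∸ toℕ s) y) (# 0) s) ≈ᶜ (# 0 , form (+ 0) (+ 1) (+ 1) (+ 0))
    cells = toWitness {a? = Fin.all? λ s → proj₂ (wordMap (replicate (8 ℕ.∸ toℕ s) y) (# 0) s) ≈ᶜ? (# 0 , form (+ 0) (+ 1) (+ 1) (+ 0))} _

  x⁻-to-0 : ∀ r w → actV (replicate (toℕ r) x⁻) (r , w) ≡ (# 0 , w)
  x⁻-to-0 r w = trans (cell-act₁ (replicate (toℕ r) x⁻) r (# 0) (# 0 , form (+ 1) (+ 0) (+ 0) (+ 0)) (cells r) w)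
      (cong (# 0 ,_) (trans (form₁-value (+ 0) w) (cls-val-0 w)))
    where
    cells : ∀ r → proj₁ (wordMap (replicate (toℕ r) x⁻) r (# 0)) ≈ᶜ (# 0 , form (+ 1) (+ 0) (+ 0) (+ 0))
    cells = toWitness {a? = Fin.all? λ r → proj₁ (wordMap (replicate (toℕ r) x⁻) r (# 0)) ≈ᶜ? (# 0 , form (+ 1) (+ 0) (+ 0) (+ 0))} _

  x⁻-from-0 : ∀ r w → actV (replicate (8 ℕ.∸ toℕ r) x⁻) (# 0 , w) ≡ (r , cls (+ val w + (- + 1)))
  x⁻-from-0 r w = trans (cell-act₁ (replicate (8 ℕ.∸ toℕ r) x⁻) (# 0) (# 0) (r , form (+ 1) (+ 0) (- + 1) (+ 0)) (cells r) w)
      (cong (r ,_) (form₁-value (- + 1) w))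
    where
    cells : ∀ r → proj₁ (wordMap (replicate (8 ℕ.∸ toℕ r) x⁻) (# 0) (# 0)) ≈ᶜ (r , form (+ 1) (+ 0) (- + 1) (+ 0))
    cells = toWitness {a? = Fin.all? λ r → proj₁ (wordMap (replicate (8 ℕ.∸ toℕ r) x⁻) (# 0) (# 0)) ≈ᶜ? (r , form (+ 1) (+ 0) (- + 1) (+ 0))} _

  x-reaches : ∀ v → actV (replicate ⟨ v ⟩ x) o ≡ v
  x-reaches (r , w) = begin
    actV (replicate (toℕ r ℕ.+ val w ℕ.* 8) x) o  ≡⟨ actV-power (toℕ r) (val w ℕ.* 8) x o ⟩
    actV (replicate (toℕ r) x) (actV (replicate (val w ℕ.* 8) x) o)
      ≡⟨ cong (λ p → actV (replicate (toℕ r) x) (proj₁ p)) (many x (constant (+ 1)) (oddly (- + 2)) x-jumps (val w) (# 0) (cls (+ 0)) (# 0) (cls (+ 0))) ⟩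
    actV (replicate (toℕ r) x) (# 0 , cls (+ val (cls (+ 0)) + + val w * + 1))
      ≡⟨ cong (λ w → actV (replicate (toℕ r) x) (# 0 , w)) (trans (cls-cong (mod-+ (val-cls (+ 0)) (≡⇒mod (ℤ.*-identityʳ (+ val w))))) (cls-val w)) ⟩
    actV (replicate (toℕ r) x) (# 0 , w)          ≡⟨ x-from-0 r w ⟩
    r , w                                         ∎
    where open ≡-Reasoning

  y-reaches : ∀ f → actF (replicate ⟨ f ⟩ y) o ≡ f
  y-reaches (s , z) = begin
    actF (replicate (toℕ s ℕ.+ val z ℕ.* 8) y) o  ≡⟨ actF-power (toℕ s) (val z ℕ.* 8) y o ⟩
    actF (replicate (toℕ s) y) (actF (replicate (val z ℕ.* 8) y) o)
      ≡⟨ cong (λ p → actF (replicate (toℕ s) y) (proj₂ p)) (many y (constant (+ 0)) (constant (+ 1)) y-jumps (val z) (# 0) (cls (+ 0)) (# 0) (cls (+ 0))) ⟩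
    actF (replicate (toℕ s) y) (# 0 , cls (+ val (cls (+ 0)) + + val z * + 1))
      ≡⟨ cong (λ z → actF (replicate (toℕ s) y) (# 0 , z)) (trans (cls-cong (mod-+ (val-cls (+ 0)) (≡⇒mod (ℤ.*-identityʳ (+ val z))))) (cls-val z)) ⟩
    actF (replicate (toℕ s) y) (# 0 , z)          ≡⟨ y-from-0 s z ⟩
    s , z                                         ∎
    where open ≡-Reasoning

  y-fixes-oV : mV g₂ o ≡ o
  y-fixes-oV = begin
    apply₁ flip o                                  ≡⟨ cong (apply₁ flip) (apply₁-collapse o) ⟨
    apply₁ flip (apply₁ collapse o)                    ≡⟨ cong proj₁ (⊗-apply flip keep (apply₁ collapse o) (apply₁ keep o)) ⟨
    proj₁ (apply (flip ⊗ keep) (apply₁ collapse o , apply₁ keep o))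
                                                   ≡⟨ cong proj₁ (⊙-⊗ (flip ⊗ keep) collapse keep o o) ⟨
    proj₁ (apply ((flip ⊗ keep) ⊙ (collapse ⊗ keep)) (o , o))
                                                   ≡⟨ check₁ ((flip ⊗ keep) ⊙ (collapse ⊗ keep)) (collapse ⊗ keep) (o , o) ⟩
    proj₁ (apply (collapse ⊗ keep) (o , o))            ≡⟨ cong proj₁ (⊗-apply collapse keep o o) ⟩
    apply₁ collapse o                                  ≡⟨ apply₁-collapse o ⟩
    o                                              ∎
    where open ≡-Reasoning

  x-fixes-oF : mF g₁ o ≡ o
  x-fixes-oF = begin
    apply₁ slide o                                  ≡⟨ cong (apply₁ slide) (apply₁-collapse o) ⟨
    apply₁ slide (apply₁ collapse o)                    ≡⟨ cong proj₂ (⊗-apply keep slide (apply₁ keep o) (apply₁ collapse o)) ⟨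
    proj₂ (apply (keep ⊗ slide) (apply₁ keep o , apply₁ collapse o))
                                                    ≡⟨ cong proj₂ (⊙-⊗ (keep ⊗ slide) keep collapse o o) ⟨
    proj₂ (apply ((keep ⊗ slide) ⊙ (keep ⊗ collapse)) (o , o))
                                                    ≡⟨ check₂ ((keep ⊗ slide) ⊙ (keep ⊗ collapse)) (keep ⊗ collapse) (o , o) ⟩
    proj₂ (apply (keep ⊗ collapse) (o , o))             ≡⟨ cong proj₂ (⊗-apply keep collapse o o) ⟩
    apply₁ collapse o                                   ≡⟨ apply₁-collapse o ⟩
    o                                               ∎
    where open ≡-Reasoning

  y-power-fixes-oV : ∀ k → actV (replicate k y) o ≡ o
  y-power-fixes-oV ℕ.zero    = refl
  y-power-fixes-oV (ℕ.suc k) = trans (cong (mV g₂) (y-power-fixes-oV k)) y-fixes-oV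

  x-power-fixes-oF : ∀ k → actF (replicate k x) o ≡ o
  x-power-fixes-oF ℕ.zero    = refl
  x-power-fixes-oF (ℕ.suc k) = trans (cong (mF g₁) (x-power-fixes-oF k)) x-fixes-oF

  -- Powers of σ₂ fix the base vertex, so the power of σ₁ alone selects v, and the power of σ₂ is
  -- aimed at the preimage of f under it.
  transitive : ∀ v f → Σ Word λ w → actV w o ≡ v × actF w o ≡ f
  transitive v f = X ++ replicate ⟨ f′ ⟩ y
    , trans (actV-++ X (replicate ⟨ f′ ⟩ y) o) (trans (cong (actV X) (y-power-fixes-oV ⟨ f′ ⟩)) (x-reaches v))
    , trans (actF-++ X (replicate ⟨ f′ ⟩ y) o) (trans (cong (actF X) (y-reaches f′)) (mF-iF (wordSym X) f))
    where
    X = replicate ⟨ v ⟩ x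
    f′ = iF (wordSym X) f

  τ₁-oF : ∀ v → τ₁ v o ≡ iV g₁ v
  τ₁-oF v = begin
    proj₁ (apply τ (v , o))                    ≡⟨ cong₂ (λ v f → proj₁ (apply τ (v , f))) (apply₁-keep v) (apply₁-collapse o) ⟨
    proj₁ (apply τ (apply₁ keep v , apply₁ collapse o)) ≡⟨ cong proj₁ (⊙-⊗ τ keep collapse v o) ⟨
    proj₁ (apply (τ ⊙ (keep ⊗ collapse)) (v , o))  ≡⟨ check₁ (τ ⊙ (keep ⊗ collapse)) (rotate⁻ ⊗ keep) (v , o) ⟩
    proj₁ (apply (rotate⁻ ⊗ keep) (v , o))     ≡⟨ cong proj₁ (⊗-apply rotate⁻ keep v o) ⟩
    apply₁ rotate⁻ v                           ∎
    where open ≡-Reasoning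

  τ₂-oV : ∀ f → τ₂ o f ≡ mF g₂ f
  τ₂-oV f = begin
    proj₂ (apply τ (o , f))                    ≡⟨ cong₂ (λ v f → proj₂ (apply τ (v , f))) (apply₁-collapse o) (apply₁-keep f) ⟨
    proj₂ (apply τ (apply₁ collapse o , apply₁ keep f)) ≡⟨ cong proj₂ (⊙-⊗ τ collapse keep o f) ⟨
    proj₂ (apply (τ ⊙ (collapse ⊗ keep)) (o , f))  ≡⟨ check₂ (τ ⊙ (collapse ⊗ keep)) (keep ⊗ rotate) (o , f) ⟩
    proj₂ (apply (keep ⊗ rotate) (o , f))      ≡⟨ cong proj₂ (⊗-apply keep rotate o f) ⟩
    apply₁ rotate f                            ∎
    where open ≡-Reasoning

  cycleF : (Q : F → Set) → ∀ {f₀} → Q f₀ → (∀ f → Q f → Q (mF g₂ f)) → ∀ f → Q f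
  cycleF Q {s₀ , z₀} q₀ next (s , z) =
    subst Q (y-from-0 s z) (steps (toℕ s) _
      (subst Q (trans (cong proj₂ (many y (constant (+ 0)) (constant (+ 1)) y-jumps k (# 0) (cls (+ 0)) (# 0) z₁)) (cong (# 0 ,_) arrive))
        (steps (k ℕ.* 8) _ (subst Q (y-to-0 s₀ z₀) (steps (8 ℕ.∸ toℕ s₀) _ q₀)))))
    where
    steps : ∀ k f → Q f → Q (actF (replicate k y) f)
    steps ℕ.zero    f q = q
    steps (ℕ.suc k) f q = next _ (steps k f q)
    -- Completing the residue to 8 raises the quotient by one, including the case of residue 0,
    -- where all eight steps are taken.
    z₁ = cls (+ val z₀ + + 1)
    k = val (cls (+ val z - + val z₁))
    lemma : ∀ a b → a + (b - a) * + 1 ≡ b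
    lemma = solve-∀
    mod-*1 : ∀ {a b} → a ≡ b mod n → a * + 1 ≡ b * + 1 mod n
    mod-*1 {a} {b} = subst₂ (λ a b → a ≡ b mod n) (sym (ℤ.*-identityʳ a)) (sym (ℤ.*-identityʳ b))
    arrive : cls (+ val z₁ + + k * + 1) ≡ z
    arrive = trans (cls-cong (mod-trans (mod-+ (≡⇒mod {x = + val z₁} refl) (mod-*1 (val-cls _)))
      (≡⇒mod (lemma (+ val z₁) (+ val z))))) (cls-val z)

  cycleV : (Q : V → Set) → ∀ {v₀} → Q v₀ → (∀ v → Q v → Q (iV g₁ v)) → ∀ v → Q v
  cycleV Q {r₀ , w₀} q₀ next (r , w) =
    subst Q (trans (x⁻-from-0 r w₁) (cong (r ,_) last)) (steps (8 ℕ.∸ toℕ r) _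
      (subst Q (trans (cong proj₁ (many x⁻ (constant (- + 1)) (oddly (+ 2)) x⁻-jumps k (# 0) w₀ (# 0) (cls (+ 0)))) (cong (# 0 ,_) arrive))
        (steps (k ℕ.* 8) _ (subst Q (x⁻-to-0 r₀ w₀) (steps (toℕ r₀) _ q₀)))))
    where
    steps : ∀ k v → Q v → Q (actV (replicate k x⁻) v)
    steps ℕ.zero    v q = q
    steps (ℕ.suc k) v q = next _ (steps k v q)
    -- The last 8 - r backward steps lower the quotient by one, so the translation has to stop one
    -- above w.
    w₁ = cls (+ val w + + 1)
    k = val (cls (+ val w₀ - + val w₁))
    lemma : ∀ a b → a + (- + 1) * (a - b) ≡ b
    lemma = solve-∀
    lemma′ : ∀ a → a + + 1 + - + 1 ≡ a
    lemma′ = solve-∀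
    arrive : cls (+ val w₀ + + k * (- + 1)) ≡ w₁
    arrive = trans (cls-cong (mod-trans (mod-+ (≡⇒mod {x = + val w₀} refl)
        (mod-trans (≡⇒mod (ℤ.*-comm (+ k) (- + 1))) (mod-* (- + 1) (val-cls _))))
      (≡⇒mod (lemma (+ val w₀) (+ val w₁))))) (cls-val w₁)
    last : cls (+ val w₁ + (- + 1)) ≡ w
    last = trans (cls-cong (mod-trans (mod-+ (val-cls (+ val w + + 1)) (≡⇒mod {x = - + 1} refl)) (≡⇒mod (lemma′ (+ val w))))) (cls-val w)

  -- Excluding reflections at the base pair

  ρ₁-oF : ∀ v → ρ₁ v o ≡ mV g₁ v
  ρ₁-oF v = begin
    ρ₁ v o                        ≡⟨ mV-iV g₁ (ρ₁ v o) ⟨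
    mV g₁ (iV g₁ (ρ₁ v o))        ≡⟨ cong (mV g₁) (τ₁-oF (ρ₁ v o)) ⟨
    mV g₁ (τ₁ (ρ₁ v o) o)         ≡⟨ cong (mV g₁) (Polyhedron.τ₁-ρ₁ tightData v o) ⟩
    mV g₁ v                       ∎
    where open ≡-Reasoning

  negate-o : apply₁ negate o ≡ o
  negate-o = begin
    apply₁ negate o                                  ≡⟨ cong (apply₁ negate) (apply₁-collapse o) ⟨
    apply₁ negate (apply₁ collapse o)                    ≡⟨ cong proj₂ (⊗-apply keep negate (apply₁ collapse o) (apply₁ collapse o)) ⟨
    proj₂ (apply (keep ⊗ negate) (apply₁ collapse o , apply₁ collapse o))
                                                     ≡⟨ cong proj₂ (⊙-⊗ (keep ⊗ negate) collapse collapse o o) ⟨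
    proj₂ (apply ((keep ⊗ negate) ⊙ (collapse ⊗ collapse)) (o , o))
                                                     ≡⟨ check₂ ((keep ⊗ negate) ⊙ (collapse ⊗ collapse)) (keep ⊗ collapse) (o , o) ⟩
    proj₂ (apply (keep ⊗ collapse) (o , o))              ≡⟨ cong proj₂ (⊗-apply keep collapse o o) ⟩
    apply₁ collapse o                                    ≡⟨ apply₁-collapse o ⟩
    o                                                ∎
    where open ≡-Reasoning

  negate-rotate : ∀ f → ρ₂ o (apply₁ negate f) ≡ apply₁ negate (mF g₂ f)
  negate-rotate f = begin
    proj₂ (apply R₂⁻ (o , apply₁ negate f))                ≡⟨ cong (λ v → proj₂ (apply R₂⁻ (v , apply₁ negate f))) (apply₁-collapse o) ⟨
    proj₂ (apply R₂⁻ (apply₁ collapse o , apply₁ negate f))    ≡⟨ cong proj₂ (⊙-⊗ R₂⁻ collapse negate o f) ⟨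
    proj₂ (apply (R₂⁻ ⊙ (collapse ⊗ negate)) (o , f))
      ≡⟨ check₂ (R₂⁻ ⊙ (collapse ⊗ negate)) ((keep ⊗ negate) ⊙ (keep ⊗ rotate)) (o , f) ⟩
    proj₂ (apply ((keep ⊗ negate) ⊙ (keep ⊗ rotate)) (o , f)) ≡⟨ cong proj₂ (⊙-⊗ (keep ⊗ negate) keep rotate o f) ⟩
    proj₂ (apply (keep ⊗ negate) (apply₁ keep o , apply₁ rotate f)) ≡⟨ cong proj₂ (⊗-apply keep negate (apply₁ keep o) (apply₁ rotate f)) ⟩
    apply₁ negate (apply₁ rotate f)                        ∎
    where open ≡-Reasoning

  -- The factor m cancels, so a congruence modulo 4m between its multiples is one modulo 4 between
  -- coefficients. As the converse of `4μ-mod`, this lets a formal difference refute an equality of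
  -- points.
  μ-independent : ∀ p q q′ → p + q * μ ≡ p + q′ * μ mod n → Σ ℤ λ k → q - q′ ≡ k * + 4
  μ-independent p q q′ (k , eq) = k , ℤ.*-cancelʳ-≡ (q - q′) (k * + 4) μ (begin
    (q - q′) * μ                             ≡⟨ lemma p q q′ μ ⟩
    (p + q * μ) - (p + q′ * μ)               ≡⟨ cong (_- (p + q′ * μ)) eq ⟩
    (p + q′ * μ) + k * + n - (p + q′ * μ)    ≡⟨ cong (λ x → (p + q′ * μ) + k * x - (p + q′ * μ)) (ℤ.pos-* 4 m) ⟩
    (p + q′ * μ) + k * (+ 4 * μ) - (p + q′ * μ) ≡⟨ lemma′ (p + q′ * μ) k μ ⟩
    k * + 4 * μ                              ∎)
    where
    open ≡-Reasoning
    lemma : ∀ p q q′ μ → (q - q′) * μ ≡ (p + q * μ) - (p + q′ * μ)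
    lemma = solve-∀
    lemma′ : ∀ c k μ → c + k * (+ 4 * μ) - c ≡ k * + 4 * μ
    lemma′ = solve-∀

  form₀-value : ∀ p q w z → ⟦ form (+ 0) (+ 0) p q ⟧ w z ≡ p + q * μ
  form₀-value p q w z = lemma w z (p + q * μ)
    where
    lemma : ∀ w z x → + 0 * w + + 0 * z + x ≡ x
    lemma = solve-∀

  ⊗-keep : ∀ K v f → apply (K ⊗ keep) (v , f) ≡ (apply₁ K v , f)
  ⊗-keep K v f = trans (⊗-apply K keep v f) (cong (apply₁ K v ,_) (apply₁-keep f))

  zero-⊗-collapse : apply (collapse ⊗ collapse) (o , o) ≡ (o , o)
  zero-⊗-collapse = trans (⊗-apply collapse collapse o o) (cong₂ _,_ (apply₁-collapse o) (apply₁-collapse o))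

  twice : ∀ K T → apply (T ⊙ (K ⊗ keep) ⊙ (K ⊗ keep) ⊙ (collapse ⊗ collapse)) (o , o) ≡ apply T (apply₁ K (apply₁ K o) , o)
  twice K T = begin
    apply (T ⊙ K′ ⊙ K′ ⊙ (collapse ⊗ collapse)) (o , o)       ≡⟨ ⊙-apply T (K′ ⊙ K′ ⊙ (collapse ⊗ collapse)) (o , o) ⟩
    apply T (apply (K′ ⊙ K′ ⊙ (collapse ⊗ collapse)) (o , o)) ≡⟨ cong (apply T) (⊙-apply K′ (K′ ⊙ (collapse ⊗ collapse)) (o , o)) ⟩
    apply T (apply K′ (apply (K′ ⊙ (collapse ⊗ collapse)) (o , o)))
      ≡⟨ cong (λ p → apply T (apply K′ p)) (⊙-apply K′ (collapse ⊗ collapse) (o , o)) ⟩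
    apply T (apply K′ (apply K′ (apply (collapse ⊗ collapse) (o , o))))
      ≡⟨ cong (λ p → apply T (apply K′ (apply K′ p))) zero-⊗-collapse ⟩
    apply T (apply K′ (apply K′ (o , o)))             ≡⟨ cong (λ p → apply T (apply K′ p)) (⊗-keep K o o) ⟩
    apply T (apply K′ (apply₁ K o , o))               ≡⟨ cong (apply T) (⊗-keep K (apply₁ K o) o) ⟩
    apply T (apply₁ K (apply₁ K o) , o)               ∎
    where
    open ≡-Reasoning
    K′ = K ⊗ keep

  -- A reflection fixing the base vertex and face acts on faces by negation, and then would
  -- send the face τ₂ (-2) 0 both to 3 + 8 (15 m - 1) and to 3 + 8 (-3 m - 1); these differ by
  -- half of the modulus.
  reflected-face : apply₁ negate (τ₂ (apply₁ rotate⁻ (apply₁ rotate⁻ o)) o) ≢ ρ₂ (apply₁ rotate (apply₁ rotate o)) o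
  reflected-face eq = contradiction
    (remainder-unique {4} {2} {0} (ℕ.s≤s (ℕ.s≤s (ℕ.s≤s ℕ.z≤n))) (ℕ.s≤s ℕ.z≤n) (proj₁ k - + 4 , two≡))
    λ ()
    where
    open ≡-Reasoning
    left : apply₁ negate (τ₂ (apply₁ rotate⁻ (apply₁ rotate⁻ o)) o) ≡ (# 3 , cls (- + 1 + + 15 * μ))
    left = begin
      apply₁ negate (τ₂ v o)                        ≡⟨ cong proj₂ (⊗-apply keep negate (τ₁ v o) (τ₂ v o)) ⟨
      proj₂ (apply (keep ⊗ negate) (apply τ (v , o))) ≡⟨ cong proj₂ (⊙-apply (keep ⊗ negate) τ (v , o)) ⟨
      proj₂ (apply ((keep ⊗ negate) ⊙ τ) (v , o))   ≡⟨ cong proj₂ (twice rotate⁻ ((keep ⊗ negate) ⊙ τ)) ⟨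
      proj₂ (apply (((keep ⊗ negate) ⊙ τ) ⊙ (rotate⁻ ⊗ keep) ⊙ (rotate⁻ ⊗ keep) ⊙ (collapse ⊗ collapse)) (o , o))
        ≡⟨ cong (# 3 ,_) (cong cls (form₀-value (- + 1) (+ 15) (+ val (cls (+ 0))) (+ val (cls (+ 0))))) ⟩
      # 3 , cls (- + 1 + + 15 * μ)                  ∎
      where v = apply₁ rotate⁻ (apply₁ rotate⁻ o)
    right : ρ₂ (apply₁ rotate (apply₁ rotate o)) o ≡ (# 3 , cls (- + 1 + - + 3 * μ))
    right = begin
      proj₂ (apply R₂⁻ (apply₁ rotate (apply₁ rotate o) , o)) ≡⟨ cong proj₂ (twice rotate R₂⁻) ⟨
      proj₂ (apply (R₂⁻ ⊙ (rotate ⊗ keep) ⊙ (rotate ⊗ keep) ⊙ (collapse ⊗ collapse)) (o , o))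
        ≡⟨ cong (# 3 ,_) (cong cls (form₀-value (- + 1) (- + 3) (+ val (cls (+ 0))) (+ val (cls (+ 0))))) ⟩
      # 3 , cls (- + 1 + - + 3 * μ)                 ∎
    k : Σ ℤ λ k → + 18 ≡ k * + 4
    k = μ-independent (- + 1) (+ 15) (- + 3) (cls-injective (cong proj₂ (trans (sym left) (trans eq right))))
    lemma : ∀ k → k * + 4 - + 16 ≡ + 0 + (k - + 4) * + 4
    lemma = solve-∀
    two≡ : + 2 ≡ + 0 + (proj₁ k - + 4) * + 4
    two≡ = trans (cong (_- + 16) (proj₂ k)) (lemma (proj₁ k))

  no-reflection : (α : V → V) (β : F → F) → α o ≡ o → β o ≡ o →
    (∀ v f → α (τ₁ v f) ≡ ρ₁ (α v) (β f)) → (∀ v f → β (τ₂ v f) ≡ ρ₂ (α v) (β f)) → ⊥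
  no-reflection α β αo βo α-τ₁ β-τ₂ = reflected-face (begin
    apply₁ negate (τ₂ v₂ o)                   ≡⟨ β-negates (τ₂ v₂ o) ⟨
    β (τ₂ v₂ o)                               ≡⟨ β-τ₂ v₂ o ⟩
    ρ₂ (α v₂) (β o)                           ≡⟨ cong₂ ρ₂ (trans (α-rotates v₁) (cong (mV g₁) (trans (α-rotates o) (cong (mV g₁) αo)))) βo ⟩
    ρ₂ (apply₁ rotate (apply₁ rotate o)) o    ∎)
    where
    open ≡-Reasoning
    v₁ = apply₁ rotate⁻ o
    v₂ = apply₁ rotate⁻ v₁
    α-rotates : ∀ v → α (iV g₁ v) ≡ mV g₁ (α v)
    α-rotates v = begin
      α (iV g₁ v)       ≡⟨ cong α (τ₁-oF v) ⟨
      α (τ₁ v o)        ≡⟨ α-τ₁ v o ⟩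
      ρ₁ (α v) (β o)    ≡⟨ cong (ρ₁ (α v)) βo ⟩
      ρ₁ (α v) o        ≡⟨ ρ₁-oF (α v) ⟩
      mV g₁ (α v)       ∎
    β-negates : ∀ f → β f ≡ apply₁ negate f
    β-negates = cycleF (λ f → β f ≡ apply₁ negate f) (trans βo (sym negate-o)) λ f eq → begin
      β (mF g₂ f)             ≡⟨ cong β (τ₂-oV f) ⟨
      β (τ₂ o f)              ≡⟨ β-τ₂ o f ⟩
      ρ₂ (α o) (β f)          ≡⟨ cong₂ ρ₂ αo eq ⟩
      ρ₂ o (apply₁ negate f)  ≡⟨ negate-rotate f ⟩
      apply₁ negate (mF g₂ f) ∎

  chiralData : ChiralData
  chiralData = record
    { tightData = tightData ; g₁ = g₁ ; g₂ = g₂ ; oV = o ; oF = o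
    ; g₂-oV = y-fixes-oV ; g₁-oF = x-fixes-oF ; τ₁-oF = τ₁-oF ; τ₂-oV = τ₂-oV
    ; transitive = transitive ; cycleV = cycleV ; cycleF = cycleF
    ; no-reflection = no-reflection }

  -- The defining relations in the two actions

  xyxy-identity : ∀ p → act (x ∷ y ∷ x ∷ y ∷ []) p ≡ p
  xyxy-identity p = trans (act-wordMap (x ∷ y ∷ x ∷ y ∷ []) p)
    (trans (check (wordMap (x ∷ y ∷ x ∷ y ∷ [])) idM p) (apply-id p))

  actV-y⁸ : ∀ v → actV (replicate 8 y) v ≡ v
  actV-y⁸ v = trans (cong proj₁ (act-wordMap (replicate 8 y) (v , o)))
    (trans (check₁ (wordMap (replicate 8 y)) idM (v , o)) (cong proj₁ (apply-id (v , o))))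

  actV-xᴺ : ∀ v → actV (replicate (n ℕ.* 8) x) v ≡ v
  actV-xᴺ (r , w) = trans (cong proj₁ (many x (constant (+ 1)) (oddly (- + 2)) x-jumps n r w (# 0) (cls (+ 0))))
    (cong (r ,_) (trans (cls-cong (+ 1 , lemma (+ val w) (+ n))) (cls-val w)))
    where
    lemma : ∀ w n → w + n * + 1 ≡ w + + 1 * n
    lemma = solve-∀

  actF-yᴺ : ∀ f → actF (replicate (n ℕ.* 8) y) f ≡ f
  actF-yᴺ (s , z) = trans (cong proj₂ (many y (constant (+ 0)) (constant (+ 1)) y-jumps n (# 0) (cls (+ 0)) s z))
    (cong (s ,_) (trans (cls-cong (+ 1 , lemma (+ val z) (+ n))) (cls-val z)))
    where
    lemma : ∀ w n → w + n * + 1 ≡ w + + 1 * n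
    lemma = solve-∀

  -- On odd faces eight steps lower the quotient by 2, so 2m such rounds lower it by 4m, the
  -- modulus; even faces return after every round.
  actF-x²ᴹ : ∀ f → actF (replicate (2 ℕ.* m ℕ.* 8) x) f ≡ f
  actF-x²ᴹ (s , z) = trans (cong proj₂ (many x (constant (+ 1)) (oddly (- + 2)) x-jumps (2 ℕ.* m) (# 0) (cls (+ 0)) s z))
    (cong (s ,_) (trans (cls-cong shift) (cls-val z)))
    where
    lemma₀ : ∀ w n → w + n * + 0 ≡ w
    lemma₀ = solve-∀
    lemma : ∀ w μ → w + + 2 * μ * (- + 2) ≡ w + (- + 1) * (+ 4 * μ)
    lemma = solve-∀
    shift : + val z + + (2 ℕ.* m) * oddly (- + 2) s ≡ + val z mod n
    shift with odd s
    ... | false = ≡⇒mod (lemma₀ (+ val z) (+ (2 ℕ.* m)))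
    ... | true  = - + 1 , (begin
      + val z + + (2 ℕ.* m) * (- + 2)      ≡⟨ cong (λ k → + val z + k * (- + 2)) (ℤ.pos-* 2 m) ⟩
      + val z + + 2 * μ * (- + 2)          ≡⟨ lemma (+ val z) μ ⟩
      + val z + (- + 1) * (+ 4 * μ)        ≡⟨ cong (λ k → + val z + (- + 1) * k) (ℤ.pos-* 4 m) ⟨
      + val z + (- + 1) * + n              ∎)
      where open ≡-Reasoning

  xᴹ yᴹ : Map
  xᴹ = slow (constant (+ 1)) (oddly (- + 2))
  yᴹ = slow (constant (+ 0)) (constant (+ 1))

  Xᴹ Yᴹ : Word
  Xᴹ = replicate (m ℕ.* 8) x
  Yᴹ = replicate (m ℕ.* 8) y

  Xᴹ-act : ∀ p → act Xᴹ p ≡ apply xᴹ p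
  Xᴹ-act = many-m x (constant (+ 1)) (oddly (- + 2)) x-jumps

  Yᴹ-act : ∀ p → act Yᴹ p ≡ apply yᴹ p
  Yᴹ-act = many-m y (constant (+ 0)) (constant (+ 1)) y-jumps

  act-XᴹYᴹ : ∀ u w p → act u (act Xᴹ (act w (act Yᴹ p))) ≡ apply (wordMap u ⊙ xᴹ ⊙ wordMap w ⊙ yᴹ) p
  act-XᴹYᴹ u w p = begin
    act u (act Xᴹ (act w (act Yᴹ p)))                          ≡⟨ act-wordMap u _ ⟩
    apply (wordMap u) (act Xᴹ (act w (act Yᴹ p)))              ≡⟨ cong (apply (wordMap u)) (Xᴹ-act _) ⟩
    apply (wordMap u) (apply xᴹ (act w (act Yᴹ p)))             ≡⟨ cong (λ p → apply (wordMap u) (apply xᴹ p)) (act-wordMap w _) ⟩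
    apply (wordMap u) (apply xᴹ (apply (wordMap w) (act Yᴹ p))) ≡⟨ cong (λ p → apply (wordMap u) (apply xᴹ (apply (wordMap w) p))) (Yᴹ-act p) ⟩
    apply (wordMap u) (apply xᴹ (apply (wordMap w) (apply yᴹ p))) ≡⟨ cong (λ p → apply (wordMap u) (apply xᴹ p)) (⊙-apply (wordMap w) yᴹ p) ⟨
    apply (wordMap u) (apply xᴹ (apply (wordMap w ⊙ yᴹ) p))      ≡⟨ cong (apply (wordMap u)) (⊙-apply xᴹ (wordMap w ⊙ yᴹ) p) ⟨
    apply (wordMap u) (apply (xᴹ ⊙ wordMap w ⊙ yᴹ) p)            ≡⟨ ⊙-apply (wordMap u) (xᴹ ⊙ wordMap w ⊙ yᴹ) p ⟨
    apply (wordMap u ⊙ xᴹ ⊙ wordMap w ⊙ yᴹ) p                    ∎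
    where open ≡-Reasoning

  -- yᴹ acts trivially on vertices, so these relations contain those of Γ₂ on vertices.
  relation-1 : ∀ p → act (y⁻ ∷ x ∷ []) p ≡ act (x⁻ ∷ []) (act Xᴹ (act (y⁻ ∷ y⁻ ∷ y⁻ ∷ []) (act Yᴹ p)))
  relation-1 p = trans (act-wordMap (y⁻ ∷ x ∷ []) p) (trans
    (check (wordMap (y⁻ ∷ x ∷ [])) (wordMap (x⁻ ∷ []) ⊙ xᴹ ⊙ wordMap (y⁻ ∷ y⁻ ∷ y⁻ ∷ []) ⊙ yᴹ) p)
    (sym (act-XᴹYᴹ (x⁻ ∷ []) (y⁻ ∷ y⁻ ∷ y⁻ ∷ []) p)))

  relation-2 : ∀ p → act (y ∷ x⁻ ∷ []) p ≡ act (x ∷ []) (act Xᴹ (act (y ∷ y ∷ y ∷ []) (act Yᴹ p)))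
  relation-2 p = trans (act-wordMap (y ∷ x⁻ ∷ []) p) (trans
    (check (wordMap (y ∷ x⁻ ∷ [])) (wordMap (x ∷ []) ⊙ xᴹ ⊙ wordMap (y ∷ y ∷ y ∷ []) ⊙ yᴹ) p)
    (sym (act-XᴹYᴹ (x ∷ []) (y ∷ y ∷ y ∷ []) p)))

  actV-Yᴹ : ∀ v → actV Yᴹ v ≡ v
  actV-Yᴹ v = trans (cong proj₁ (Yᴹ-act (v , o))) (trans (check₁ yᴹ idM (v , o)) (cong proj₁ (apply-id (v , o))))

-- Normal forms in the presented groups

record Congruence (E : Word → Word → Set) : Set where
  field
    E-refl   : ∀ {u} → E u u
    E-sym    : ∀ {u v} → E u v → E v u
    E-trans  : ∀ {u v w} → E u v → E v w → E u w
    E-cong   : ∀ {u u′ v v′} → E u u′ → E v v′ → E (u ++ v) (u′ ++ v′)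
    E-cancel : ∀ x → E (x ∷ inv x ∷ []) []

PresEq-congruence : ∀ R → Congruence (PresEq R)
PresEq-congruence R = record
  { E-refl = ≈-refl ; E-sym = ≈-sym ; E-trans = ≈-trans ; E-cong = ≈-cong ; E-cancel = ≈-cancel }

Mix-congruence : ∀ {E E′} → Congruence E → Congruence E′ → Congruence (Mix E E′)
Mix-congruence C C′ = record
  { E-refl   = C.E-refl , C′.E-refl
  ; E-sym    = λ (p , q) → C.E-sym p , C′.E-sym q
  ; E-trans  = λ (p , q) (p′ , q′) → C.E-trans p p′ , C′.E-trans q q′
  ; E-cong   = λ (p , q) (p′ , q′) → C.E-cong p p′ , C′.E-cong q q′
  ; E-cancel = λ x → C.E-cancel x , C′.E-cancel x }
  where
  module C = Congruence C
  module C′ = Congruence C′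

-- Words are handled as lists of powers, so that associativity is definitional.
Syllable : Set
Syllable = Gen × ℤ

Syllables : Set
Syllables = List Syllable

ev : Syllables → Word
ev []            = []
ev ((g , i) ∷ s) = pow g i ++ ev s

ev-++ : ∀ s t → ev (s ++ t) ≡ ev s ++ ev t
ev-++ []            t = refl
ev-++ ((g , i) ∷ s) t = trans (cong (pow g i ++_) (ev-++ s t)) (sym (++-assoc (pow g i) (ev s) (ev t)))

X Y : ℤ → Syllable
X i = s₁ , i
Y j = s₂ , j

-- P is closed like a subgroup of ℤ × ℤ. It is used for the pairs of exponents (a , b) such that a
-- power of x conjugates y^a to y^b, and for periods and commuting powers, where only one coordinate
-- matters.
multiples : (P : ℤ → ℤ → Set) → P (+ 0) (+ 0) →
  (∀ {i j k l} → P i j → P k l → P (i + k) (j + l)) → (∀ {i j} → P i j → P (- i) (- j)) →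
  ∀ {a b} → P a b → ∀ k → P (k * a) (k * b)
multiples P p0 p+ p- {a} {b} pab = go
  where
  lemma : ∀ k a → a + k * a ≡ (+ 1 + k) * a
  lemma = solve-∀
  lemma′ : ∀ k a → - (k * a) ≡ - k * a
  lemma′ = solve-∀
  positive : ∀ k → P (+ k * a) (+ k * b)
  positive ℕ.zero    = p0
  positive (ℕ.suc k) = subst₂ P (lemma (+ k) a) (lemma (+ k) b) (p+ pab (positive k))
  go : ∀ k → P (k * a) (k * b)
  go (+ k)    = positive k
  go -[1+ k ] = subst₂ P (lemma′ (+ ℕ.suc k) a) (lemma′ (+ ℕ.suc k) b) (p- (positive (ℕ.suc k)))

module Syllabic {E : Word → Word → Set} (C : Congruence E) where
  open Congruence C public

  E-cancelˡ : ∀ x {w} → E (x ∷ inv x ∷ w) w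
  E-cancelˡ x = E-cong (E-cancel x) E-refl

  pow-suc : ∀ g i → E ((g , false) ∷ pow g i) (pow g (+ 1 + i))
  pow-suc g (+ n)            = E-refl
  pow-suc g -[1+ ℕ.zero ]    = E-cancel (g , false)
  pow-suc g -[1+ ℕ.suc n ]   = E-cancelˡ (g , false)

  pow-pred : ∀ g i → E ((g , true) ∷ pow g i) (pow g (-[1+ 0 ] + i))
  pow-pred g (+ ℕ.zero)    = E-refl
  pow-pred g (+ ℕ.suc n)   = E-cancelˡ (g , true)
  pow-pred g -[1+ n ]      = E-refl

  pow-+ : ∀ g i j → E (pow g i ++ pow g j) (pow g (i + j))
  pow-+ g (+ n) j = positive n
    where
    positive : ∀ n → E (pow g (+ n) ++ pow g j) (pow g (+ n + j))
    positive ℕ.zero    = subst (λ k → E (pow g j) (pow g k)) (sym (ℤ.+-identityˡ j)) E-refl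
    positive (ℕ.suc n) = E-trans (E-cong {u = (g , false) ∷ []} E-refl (positive n))
      (subst (λ k → E ((g , false) ∷ pow g (+ n + j)) (pow g k)) (sym (ℤ.+-assoc (+ 1) (+ n) j)) (pow-suc g (+ n + j)))
  pow-+ g -[1+ n ] j = negative n
    where
    negative : ∀ n → E (pow g -[1+ n ] ++ pow g j) (pow g (-[1+ n ] + j))
    negative ℕ.zero    = pow-pred g j
    negative (ℕ.suc n) = E-trans (E-cong {u = (g , true) ∷ []} E-refl (negative n))
      (subst (λ k → E ((g , true) ∷ pow g (-[1+ n ] + j)) (pow g k)) (sym (ℤ.+-assoc -[1+ 0 ] -[1+ n ] j)) (pow-pred g (-[1+ n ] + j)))

  infix 4 _≈_
  record _≈_ (s t : Syllables) : Set where
    constructor mk≈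
    field
      words : E (ev s) (ev t)
  open _≈_ public

  ~-sym : ∀ {s t} → s ≈ t → t ≈ s
  ~-sym (mk≈ p) = mk≈ (E-sym p)

  ~-trans : ∀ {s t u} → s ≈ t → t ≈ u → s ≈ u
  ~-trans (mk≈ p) (mk≈ q) = mk≈ (E-trans p q)

  setoid : Setoid _ _
  setoid = record { Carrier = Syllables ; _≈_ = _≈_
    ; isEquivalence = record { refl = mk≈ E-refl ; sym = ~-sym ; trans = ~-trans } }

  module ≈-Reasoning = SetoidReasoning setoid

  ≈-++ : ∀ {s s′ t t′} → s ≈ s′ → t ≈ t′ → s ++ t ≈ s′ ++ t′
  ≈-++ {s} {s′} {t} {t′} (mk≈ p) (mk≈ q) = mk≈ (subst₂ E (sym (ev-++ s t)) (sym (ev-++ s′ t′)) (E-cong p q))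

  rw : ∀ p {s t} → s ≈ t → ∀ q → p ++ s ++ q ≈ p ++ t ++ q
  rw p eq q = ≈-++ {p} {p} (mk≈ E-refl) (≈-++ eq (mk≈ {q} {q} E-refl))

  merge : ∀ g i j → (g , i) ∷ (g , j) ∷ [] ≈ (g , i + j) ∷ []
  merge g i j = mk≈ (subst₂ E (cong (pow g i ++_) (sym (++-identityʳ (pow g j)))) (sym (++-identityʳ (pow g (i + j)))) (pow-+ g i j))

  mergeTo : ∀ g i j {k} → i + j ≡ k → (g , i) ∷ (g , j) ∷ [] ≈ (g , k) ∷ []
  mergeTo g i j refl = merge g i j

  cancelʳ : ∀ g i → (g , - i) ∷ (g , i) ∷ [] ≈ []
  cancelʳ g i = ~-trans (mergeTo g (- i) i (ℤ.+-inverseˡ i)) (mk≈ E-refl)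

  cancelˡ : ∀ g i → (g , i) ∷ (g , - i) ∷ [] ≈ []
  cancelˡ g i = ~-trans (mergeTo g i (- i) (ℤ.+-inverseʳ i)) (mk≈ E-refl)

  moveˡ : ∀ g i {s t} → (g , i) ∷ s ≈ t → s ≈ (g , - i) ∷ t
  moveˡ g i {s} {t} eq = ~-trans (~-sym (≈-++ (cancelʳ g i) (mk≈ {s} E-refl))) (≈-++ {(g , - i) ∷ []} (mk≈ E-refl) eq)

  moveʳ : ∀ g i {s t} → s ++ (g , i) ∷ [] ≈ t → s ≈ t ++ (g , - i) ∷ []
  moveʳ g i {s} {t} eq = begin
    s                                        ≡⟨ ++-identityʳ s ⟨
    s ++ []                                  ≈⟨ ≈-++ (mk≈ {s} E-refl) (cancelˡ g i) ⟨
    s ++ (g , i) ∷ (g , - i) ∷ []            ≡⟨ ++-assoc s ((g , i) ∷ []) ((g , - i) ∷ []) ⟨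
    (s ++ (g , i) ∷ []) ++ (g , - i) ∷ []    ≈⟨ ≈-++ eq (mk≈ E-refl) ⟩
    t ++ (g , - i) ∷ []                      ∎
    where open ≈-Reasoning

  period : ∀ g {i} → (g , i) ∷ [] ≈ [] → ∀ k → (g , k * i) ∷ [] ≈ []
  period g {i} eq = multiples (λ i _ → (g , i) ∷ [] ≈ []) (mk≈ E-refl)
    (λ {i} {_} {k} p q → ~-trans (~-sym (merge g i k)) (≈-++ p q))
    (λ {i} p → ~-sym (moveˡ g i p)) {i} {i} eq

  periodic : ∀ g {n i j} → (g , n) ∷ [] ≈ [] → ∀ k → i ≡ j + k * n → (g , i) ∷ [] ≈ (g , j) ∷ []
  periodic g {n} {i} {j} eq k refl =
    ~-trans (~-sym (merge g j (k * n))) (≈-++ {(g , j) ∷ []} (mk≈ E-refl) (period g eq k))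

  conjugates : ∀ {i a b} → X i ∷ Y a ∷ [] ≈ Y b ∷ X i ∷ [] → ∀ k → X i ∷ Y (k * a) ∷ [] ≈ Y (k * b) ∷ X i ∷ []
  conjugates {i} = multiples (λ a b → X i ∷ Y a ∷ [] ≈ Y b ∷ X i ∷ []) (mk≈ E-refl)
    (λ {a} {b} {c} {d} p q → begin
      X i ∷ Y (a + c) ∷ []    ≈⟨ rw (X i ∷ []) (merge s₂ a c) [] ⟨
      X i ∷ Y a ∷ Y c ∷ []    ≈⟨ rw [] p (Y c ∷ []) ⟩
      Y b ∷ X i ∷ Y c ∷ []    ≈⟨ rw (Y b ∷ []) q [] ⟩
      Y b ∷ Y d ∷ X i ∷ []    ≈⟨ rw [] (merge s₂ b d) (X i ∷ []) ⟩
      Y (b + d) ∷ X i ∷ []    ∎)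
    (λ {a} {b} p → ~-sym (moveʳ s₂ a (~-sym (moveˡ s₂ b (~-sym p)))))
    where open ≈-Reasoning

  commutes : ∀ {j a} → X a ∷ Y j ∷ [] ≈ Y j ∷ X a ∷ [] → ∀ k → X (k * a) ∷ Y j ∷ [] ≈ Y j ∷ X (k * a) ∷ []
  commutes {j} {a} = λ eq → multiples (λ a _ → X a ∷ Y j ∷ [] ≈ Y j ∷ X a ∷ []) (mk≈ E-refl)
    (λ {a} {_} {c} p q → begin
      X (a + c) ∷ Y j ∷ []    ≈⟨ rw [] (merge s₁ a c) (Y j ∷ []) ⟨
      X a ∷ X c ∷ Y j ∷ []    ≈⟨ rw (X a ∷ []) q [] ⟩
      X a ∷ Y j ∷ X c ∷ []    ≈⟨ rw [] p (X c ∷ []) ⟩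
      Y j ∷ X a ∷ X c ∷ []    ≈⟨ rw (Y j ∷ []) (merge s₁ a c) [] ⟩
      Y j ∷ X (a + c) ∷ []    ∎)
    (λ {a} p → ~-sym (moveˡ s₁ a (~-sym (moveʳ s₁ a (~-sym p))))) {a} {a} eq
    where open ≈-Reasoning

  expo : ∀ g {i j} → i ≡ j → (g , i) ∷ [] ≈ (g , j) ∷ []
  expo g refl = mk≈ E-refl

  -- The exponents are chosen so that the same identities hold in both groups: in Γ₂, multiples of M
  -- can be added to exponents of y because y^8 = 1 and 8 divides M; in Γ₁, multiples of 2M can be
  -- added to exponents of x.
  record Relations (M : ℤ) : Set where
    field
      x⁻y⁻  : X (- + 1) ∷ Y (- + 1) ∷ [] ≈ Y (+ 1) ∷ X (+ 1) ∷ []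
      x⁻y   : X (- + 1) ∷ Y (+ 1) ∷ [] ≈ Y (+ 3 - M) ∷ X (+ 1 - M) ∷ []
      x⁻y⁻² : X (- + 1) ∷ Y (- + 2) ∷ [] ≈ Y (- + 2 - M) ∷ X (- + 1 - M) ∷ []
      x⁻y⁴  : X (- + 1) ∷ Y (+ 4) ∷ [] ≈ Y (+ 4 - + 2 * M) ∷ X (+ 2 * M - + 1) ∷ []
      x²ᴹy  : X (+ 2 * M) ∷ Y (+ 1) ∷ [] ≈ Y (+ 1) ∷ X (+ 2 * M) ∷ []
      x⁴ᴹ   : X (+ 4 * M) ∷ [] ≈ []
      y⁴ᴹ   : Y (+ 4 * M) ∷ [] ≈ []

  -- Consequences of the two presentations

  module Presentation (i₁ j₁ i₂ j₂ : ℤ)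
    (xyxy : X (+ 1) ∷ Y (+ 1) ∷ X (+ 1) ∷ Y (+ 1) ∷ [] ≈ [])
    (y⁻x  : Y (- + 1) ∷ X (+ 1) ∷ [] ≈ X i₁ ∷ Y j₁ ∷ [])
    (yx⁻  : Y (+ 1) ∷ X (- + 1) ∷ [] ≈ X i₂ ∷ Y j₂ ∷ []) where
    open ≈-Reasoning

    yxy : Y (+ 1) ∷ X (+ 1) ∷ Y (+ 1) ∷ [] ≈ X (- + 1) ∷ []
    yxy = moveˡ s₁ (+ 1) xyxy

    P-x⁻y⁻ : X (- + 1) ∷ Y (- + 1) ∷ [] ≈ Y (+ 1) ∷ X (+ 1) ∷ []
    P-x⁻y⁻ = ~-sym (moveʳ s₂ (+ 1) yxy)

    P-y⁻x⁻ : Y (- + 1) ∷ X (- + 1) ∷ [] ≈ X (+ 1) ∷ Y (+ 1) ∷ []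
    P-y⁻x⁻ = ~-sym (moveʳ s₁ (+ 1) (moveʳ s₂ (+ 1) xyxy))

    P-x⁻y : X (- + 1) ∷ Y (+ 1) ∷ [] ≈ Y (- j₁) ∷ X (- i₁) ∷ []
    P-x⁻y = moveʳ s₁ i₁ (moveʳ s₂ j₁ (~-sym (moveˡ s₁ (+ 1) (moveˡ s₂ (- + 1) y⁻x))))

    -- Since yxy = x⁻¹, the product y²xy equals yx⁻¹, to which the second extra relation applies;
    -- cancelling one y on the right and inverting gives the claim.
    P-x⁻y⁻² : X (- + 1) ∷ Y (- + 2) ∷ [] ≈ Y (+ 1 - j₂) ∷ X (- i₂) ∷ []
    P-x⁻y⁻² = ~-trans (moveʳ s₁ i₂ (moveʳ s₂ j₂ (~-sym (moveˡ s₁ (+ 1) (moveˡ s₂ (+ 2) (begin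
        Y (+ 2) ∷ X (+ 1) ∷ Y (+ 1) ∷ []              ≈⟨ rw [] (merge s₂ (+ 1) (+ 1)) (X (+ 1) ∷ Y (+ 1) ∷ []) ⟨
        Y (+ 1) ∷ Y (+ 1) ∷ X (+ 1) ∷ Y (+ 1) ∷ []    ≈⟨ rw (Y (+ 1) ∷ []) yxy [] ⟩
        Y (+ 1) ∷ X (- + 1) ∷ []                      ≈⟨ yx⁻ ⟩
        X i₂ ∷ Y j₂ ∷ []                              ∎))))))
      (rw [] (merge s₂ (+ 1) (- j₂)) (X (- i₂) ∷ []))

  module Presentation₂ (M k : ℤ) (M≡ : M ≡ k * + 8)
    (xᴺ   : X (+ 4 * M) ∷ [] ≈ [])
    (y⁸   : Y (+ 8) ∷ [] ≈ [])
    (xyxy : X (+ 1) ∷ Y (+ 1) ∷ X (+ 1) ∷ Y (+ 1) ∷ [] ≈ [])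
    (y⁻x  : Y (- + 1) ∷ X (+ 1) ∷ [] ≈ X (- + 1 + M) ∷ Y (- + 3) ∷ [])
    (yx⁻  : Y (+ 1) ∷ X (- + 1) ∷ [] ≈ X (+ 1 + M) ∷ Y (+ 3) ∷ []) where
    open ≈-Reasoning
    open Presentation (- + 1 + M) (- + 3) (+ 1 + M) (+ 3) xyxy y⁻x yx⁻

    yᴹ : ∀ i l → Y i ∷ [] ≈ Y (i + l * M) ∷ []
    yᴹ i l = ~-sym (periodic s₂ y⁸ (l * k) (trans (cong (λ M → i + l * M) M≡) (lemma i l k)))
      where
      lemma : ∀ i l k → i + l * (k * + 8) ≡ i + l * k * + 8
      lemma = solve-∀

    y³ : Y (+ 3) ∷ [] ≈ X (- + 1) ∷ Y (+ 1) ∷ X (- + 1 + M) ∷ []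
    y³ = begin
      Y (+ 3) ∷ []                                      ≈⟨ moveʳ s₁ (- (- + 1 + M)) (~-sym P-x⁻y) ⟩
      X (- + 1) ∷ Y (+ 1) ∷ X (- - (- + 1 + M)) ∷ []    ≈⟨ rw (X (- + 1) ∷ Y (+ 1) ∷ []) (expo s₁ (ℤ.neg-involutive (- + 1 + M))) [] ⟩
      X (- + 1) ∷ Y (+ 1) ∷ X (- + 1 + M) ∷ []          ∎

    -- Each extra relation expresses y³ through y and powers of x; eliminating y³ shows that
    -- conjugation by y inverts x^M.
    y≈xᴹyxᴹ : X M ∷ Y (+ 1) ∷ X M ∷ [] ≈ Y (+ 1) ∷ []
    y≈xᴹyxᴹ = ~-sym (begin
      Y (+ 1) ∷ []                                              ≈⟨ moveʳ s₁ (- + 1) yx⁻ ⟩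
      X (+ 1 + M) ∷ Y (+ 3) ∷ X (+ 1) ∷ []                      ≈⟨ rw (X (+ 1 + M) ∷ []) y³ (X (+ 1) ∷ []) ⟩
      X (+ 1 + M) ∷ X (- + 1) ∷ Y (+ 1) ∷ X (- + 1 + M) ∷ X (+ 1) ∷ []
        ≈⟨ rw [] (mergeTo s₁ (+ 1 + M) (- + 1) (lemma M)) (Y (+ 1) ∷ X (- + 1 + M) ∷ X (+ 1) ∷ []) ⟩
      X M ∷ Y (+ 1) ∷ X (- + 1 + M) ∷ X (+ 1) ∷ []
        ≈⟨ rw (X M ∷ Y (+ 1) ∷ []) (mergeTo s₁ (- + 1 + M) (+ 1) (lemma′ M)) [] ⟩
      X M ∷ Y (+ 1) ∷ X M ∷ []                                  ∎)
      where
      lemma : ∀ M → + 1 + M + - + 1 ≡ M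
      lemma = solve-∀
      lemma′ : ∀ M → - + 1 + M + + 1 ≡ M
      lemma′ = solve-∀

    xᴹy : X M ∷ Y (+ 1) ∷ [] ≈ Y (+ 1) ∷ X (- M) ∷ []
    xᴹy = moveʳ s₁ M y≈xᴹyxᴹ

    x⁻ᴹy : X (- M) ∷ Y (+ 1) ∷ [] ≈ Y (+ 1) ∷ X M ∷ []
    x⁻ᴹy = ~-sym (moveˡ s₁ M y≈xᴹyxᴹ)

    xᴹy² : X M ∷ Y (+ 2) ∷ [] ≈ Y (+ 2) ∷ X M ∷ []
    xᴹy² = begin
      X M ∷ Y (+ 2) ∷ []               ≈⟨ rw (X M ∷ []) (merge s₂ (+ 1) (+ 1)) [] ⟨
      X M ∷ Y (+ 1) ∷ Y (+ 1) ∷ []     ≈⟨ rw [] xᴹy (Y (+ 1) ∷ []) ⟩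
      Y (+ 1) ∷ X (- M) ∷ Y (+ 1) ∷ [] ≈⟨ rw (Y (+ 1) ∷ []) x⁻ᴹy [] ⟩
      Y (+ 1) ∷ Y (+ 1) ∷ X M ∷ []     ≈⟨ rw [] (merge s₂ (+ 1) (+ 1)) (X M ∷ []) ⟩
      Y (+ 2) ∷ X M ∷ []               ∎

    -- Conjugation by y inverts x^(2M), whose square is trivial, so the two commute.
    P-x²ᴹy : X (+ 2 * M) ∷ Y (+ 1) ∷ [] ≈ Y (+ 1) ∷ X (+ 2 * M) ∷ []
    P-x²ᴹy = begin
      X (+ 2 * M) ∷ Y (+ 1) ∷ []          ≈⟨ rw [] (mergeTo s₁ M M (lemma M)) (Y (+ 1) ∷ []) ⟨
      X M ∷ X M ∷ Y (+ 1) ∷ []            ≈⟨ rw (X M ∷ []) xᴹy [] ⟩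
      X M ∷ Y (+ 1) ∷ X (- M) ∷ []        ≈⟨ rw [] xᴹy (X (- M) ∷ []) ⟩
      Y (+ 1) ∷ X (- M) ∷ X (- M) ∷ []    ≈⟨ rw (Y (+ 1) ∷ []) (merge s₁ (- M) (- M)) [] ⟩
      Y (+ 1) ∷ X (- M + - M) ∷ []        ≈⟨ rw (Y (+ 1) ∷ []) (periodic s₁ xᴺ (- + 1) (lemma′ M)) [] ⟩
      Y (+ 1) ∷ X (+ 2 * M) ∷ []          ∎
      where
      lemma : ∀ M → M + M ≡ + 2 * M
      lemma = solve-∀
      lemma′ : ∀ M → - M + - M ≡ + 2 * M + (- + 1) * (+ 4 * M)
      lemma′ = solve-∀

    -- Writing y² as y⁻¹y³ and substituting for y³ produces y⁻¹x⁻¹ = xy, which leaves y² = x y²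
    -- x^(M-1).
    x⁻y² : X (- + 1) ∷ Y (+ 2) ∷ [] ≈ Y (+ 2) ∷ X (- + 1 + M) ∷ []
    x⁻y² = ~-sym (moveˡ s₁ (+ 1) (~-sym (begin
      Y (+ 2) ∷ []                                       ≈⟨ merge s₂ (- + 1) (+ 3) ⟨
      Y (- + 1) ∷ Y (+ 3) ∷ []                           ≈⟨ rw (Y (- + 1) ∷ []) y³ [] ⟩
      Y (- + 1) ∷ X (- + 1) ∷ Y (+ 1) ∷ X (- + 1 + M) ∷ [] ≈⟨ rw [] P-y⁻x⁻ (Y (+ 1) ∷ X (- + 1 + M) ∷ []) ⟩
      X (+ 1) ∷ Y (+ 1) ∷ Y (+ 1) ∷ X (- + 1 + M) ∷ []   ≈⟨ rw (X (+ 1) ∷ []) (merge s₂ (+ 1) (+ 1)) (X (- + 1 + M) ∷ []) ⟩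
      X (+ 1) ∷ Y (+ 2) ∷ X (- + 1 + M) ∷ []             ∎)))

    P-x⁻y⁴ : X (- + 1) ∷ Y (+ 4) ∷ [] ≈ Y (+ 4 - + 2 * M) ∷ X (+ 2 * M - + 1) ∷ []
    P-x⁻y⁴ = begin
      X (- + 1) ∷ Y (+ 4) ∷ []                        ≈⟨ rw (X (- + 1) ∷ []) (merge s₂ (+ 2) (+ 2)) [] ⟨
      X (- + 1) ∷ Y (+ 2) ∷ Y (+ 2) ∷ []              ≈⟨ rw [] x⁻y² (Y (+ 2) ∷ []) ⟩
      Y (+ 2) ∷ X (- + 1 + M) ∷ Y (+ 2) ∷ []          ≈⟨ rw (Y (+ 2) ∷ []) (merge s₁ (- + 1) M) (Y (+ 2) ∷ []) ⟨
      Y (+ 2) ∷ X (- + 1) ∷ X M ∷ Y (+ 2) ∷ []        ≈⟨ rw (Y (+ 2) ∷ X (- + 1) ∷ []) xᴹy² [] ⟩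
      Y (+ 2) ∷ X (- + 1) ∷ Y (+ 2) ∷ X M ∷ []        ≈⟨ rw (Y (+ 2) ∷ []) x⁻y² (X M ∷ []) ⟩
      Y (+ 2) ∷ Y (+ 2) ∷ X (- + 1 + M) ∷ X M ∷ []    ≈⟨ rw [] (merge s₂ (+ 2) (+ 2)) (X (- + 1 + M) ∷ X M ∷ []) ⟩
      Y (+ 4) ∷ X (- + 1 + M) ∷ X M ∷ []              ≈⟨ rw (Y (+ 4) ∷ []) (mergeTo s₁ (- + 1 + M) M (lemma M)) [] ⟩
      -- Here y^(-2M) is trivial; it is inserted to agree with the exponent forced by the other
      -- presentation.
      Y (+ 4) ∷ X (+ 2 * M - + 1) ∷ []                ≈⟨ rw [] (~-trans (yᴹ (+ 4) (- + 2)) (expo s₂ (lemma′ M))) (X (+ 2 * M - + 1) ∷ []) ⟩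
      Y (+ 4 - + 2 * M) ∷ X (+ 2 * M - + 1) ∷ []      ∎
      where
      lemma : ∀ M → - + 1 + M + M ≡ + 2 * M - + 1
      lemma = solve-∀
      lemma′ : ∀ M → + 4 + (- + 2) * M ≡ + 4 - + 2 * M
      lemma′ = solve-∀

    relations : Relations M
    relations = record
      { x⁻y⁻ = P-x⁻y⁻
      ; x⁻y = ~-trans P-x⁻y (≈-++ (~-trans (yᴹ (+ 3) (- + 1)) (expo s₂ (lemma₃ M))) (expo s₁ (lemma₁ M)))
      ; x⁻y⁻² = ~-trans P-x⁻y⁻² (≈-++ (~-trans (yᴹ (+ 1 - + 3) (- + 1)) (expo s₂ (lemma₂ M))) (expo s₁ (lemma₀ M)))
      ; x⁻y⁴ = P-x⁻y⁴
      ; x²ᴹy = P-x²ᴹy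
      ; x⁴ᴹ = xᴺ
      ; y⁴ᴹ = ~-trans (~-trans (expo s₂ (lemma₄ M)) (~-sym (yᴹ (+ 0) (+ 4)))) (mk≈ E-refl) }
      where
      lemma₀ : ∀ M → - (+ 1 + M) ≡ - + 1 - M
      lemma₀ = solve-∀
      lemma₁ : ∀ M → - (- + 1 + M) ≡ + 1 - M
      lemma₁ = solve-∀
      lemma₂ : ∀ M → + 1 - + 3 + (- + 1) * M ≡ - + 2 - M
      lemma₂ = solve-∀
      lemma₃ : ∀ M → + 3 + (- + 1) * M ≡ + 3 - M
      lemma₃ = solve-∀
      lemma₄ : ∀ M → + 4 * M ≡ + 0 + + 4 * M
      lemma₄ = solve-∀

  module Presentation₁ (M k : ℤ) (M≡ : M ≡ k * + 8)
    (x²ᴹ  : X (+ 2 * M) ∷ [] ≈ [])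
    (yᴺ   : Y (+ 4 * M) ∷ [] ≈ [])
    (xyxy : X (+ 1) ∷ Y (+ 1) ∷ X (+ 1) ∷ Y (+ 1) ∷ [] ≈ [])
    (y⁻x  : Y (- + 1) ∷ X (+ 1) ∷ [] ≈ X (- + 1 + M) ∷ Y (- + 3 + M) ∷ [])
    (yx⁻  : Y (+ 1) ∷ X (- + 1) ∷ [] ≈ X (+ 1 + M) ∷ Y (+ 3 + M) ∷ []) where
    open ≈-Reasoning
    open Presentation (- + 1 + M) (- + 3 + M) (+ 1 + M) (+ 3 + M) xyxy y⁻x yx⁻

    -- The power of y between yx⁻¹ and y⁻¹x is chosen to cancel the y-power of the second extra
    -- relation. The x-powers of both relations then meet and form x^(2M) = 1.
    x⁻y⁻⁴⁻ᴹ : X (- + 1) ∷ Y (- + 4 - M) ∷ [] ≈ Y (M - + 4) ∷ X (- + 1) ∷ []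
    x⁻y⁻⁴⁻ᴹ = ~-trans (moveʳ s₁ (+ 1) (moveʳ s₂ (+ 3 - M) (moveˡ s₂ (+ 1) (begin
        Y (+ 1) ∷ X (- + 1) ∷ Y (- + 4 - M) ∷ X (+ 1) ∷ Y (+ 3 - M) ∷ []
          ≈⟨ rw (Y (+ 1) ∷ X (- + 1) ∷ []) (mergeTo s₂ (- (+ 3 + M)) (- + 1) (lemma₁ M)) (X (+ 1) ∷ Y (+ 3 - M) ∷ []) ⟨
        Y (+ 1) ∷ X (- + 1) ∷ Y (- (+ 3 + M)) ∷ Y (- + 1) ∷ X (+ 1) ∷ Y (+ 3 - M) ∷ []
          ≈⟨ rw [] yx⁻ (Y (- (+ 3 + M)) ∷ Y (- + 1) ∷ X (+ 1) ∷ Y (+ 3 - M) ∷ []) ⟩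
        X (+ 1 + M) ∷ Y (+ 3 + M) ∷ Y (- (+ 3 + M)) ∷ Y (- + 1) ∷ X (+ 1) ∷ Y (+ 3 - M) ∷ []
          ≈⟨ rw (X (+ 1 + M) ∷ []) (cancelˡ s₂ (+ 3 + M)) (Y (- + 1) ∷ X (+ 1) ∷ Y (+ 3 - M) ∷ []) ⟩
        X (+ 1 + M) ∷ Y (- + 1) ∷ X (+ 1) ∷ Y (+ 3 - M) ∷ []
          ≈⟨ rw (X (+ 1 + M) ∷ []) y⁻x (Y (+ 3 - M) ∷ []) ⟩
        X (+ 1 + M) ∷ X (- + 1 + M) ∷ Y (- + 3 + M) ∷ Y (+ 3 - M) ∷ []
          ≈⟨ rw [] (mergeTo s₁ (+ 1 + M) (- + 1 + M) (lemma₂ M)) (Y (- + 3 + M) ∷ Y (+ 3 - M) ∷ []) ⟩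
        X (+ 2 * M) ∷ Y (- + 3 + M) ∷ Y (+ 3 - M) ∷ []
          ≈⟨ rw [] x²ᴹ (Y (- + 3 + M) ∷ Y (+ 3 - M) ∷ []) ⟩
        Y (- + 3 + M) ∷ Y (+ 3 - M) ∷ []
          ≈⟨ mergeTo s₂ (- + 3 + M) (+ 3 - M) (lemma₃ M) ⟩
        Y (+ 0) ∷ []  ≈⟨ mk≈ E-refl ⟩
        []  ∎))))
      (rw [] (mergeTo s₂ (- + 1) (- (+ 3 - M)) (lemma₄ M)) (X (- + 1) ∷ []))
      where
      lemma₁ : ∀ M → - (+ 3 + M) + - + 1 ≡ - + 4 - M
      lemma₁ = solve-∀
      lemma₂ : ∀ M → + 1 + M + (- + 1 + M) ≡ + 2 * M
      lemma₂ = solve-∀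
      lemma₃ : ∀ M → - + 3 + M + (+ 3 - M) ≡ + 0
      lemma₃ = solve-∀
      lemma₄ : ∀ M → - + 1 + - (+ 3 - M) ≡ M - + 4
      lemma₄ = solve-∀

    -- 1 - 2k + 4k² inverts 1 + 2k modulo 8k, because their product is 1 + 8k³.
    x⁻y⁴-x⁻ : X (- + 1) ∷ Y (+ 4) ∷ [] ≈ Y (+ 4 - + 2 * M) ∷ X (- + 1) ∷ []
    x⁻y⁴-x⁻ = begin
      X (- + 1) ∷ Y (+ 4) ∷ []                   ≈⟨ rw (X (- + 1) ∷ []) (periodic s₂ yᴺ (k * k) (exponent₁ M M≡)) [] ⟨
      X (- + 1) ∷ Y (j * (- + 4 - M)) ∷ []       ≈⟨ conjugates x⁻y⁻⁴⁻ᴹ j ⟩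
      Y (j * (M - + 4)) ∷ X (- + 1) ∷ []         ≈⟨ rw [] (periodic s₂ yᴺ (k - k * k) (exponent₂ M M≡)) (X (- + 1) ∷ []) ⟩
      Y (+ 4 - + 2 * M) ∷ X (- + 1) ∷ []         ∎
      where
      j = - (+ 1 - + 2 * k + + 4 * k * k)
      lemma₁ : ∀ k → - (+ 1 - + 2 * k + + 4 * k * k) * (- + 4 - k * + 8) ≡ + 4 + k * k * (+ 4 * (k * + 8))
      lemma₁ = solve-∀
      lemma₂ : ∀ k → - (+ 1 - + 2 * k + + 4 * k * k) * (k * + 8 - + 4) ≡ + 4 - + 2 * (k * + 8) + (k - k * k) * (+ 4 * (k * + 8))
      lemma₂ = solve-∀
      exponent₁ : ∀ M → M ≡ k * + 8 → j * (- + 4 - M) ≡ + 4 + k * k * (+ 4 * M)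
      exponent₁ _ refl = lemma₁ k
      exponent₂ : ∀ M → M ≡ k * + 8 → j * (M - + 4) ≡ + 4 - + 2 * M + (k - k * k) * (+ 4 * M)
      exponent₂ _ refl = lemma₂ k

    relations : Relations M
    relations = record
      { x⁻y⁻ = P-x⁻y⁻
      ; x⁻y = ~-trans P-x⁻y (≈-++ (expo s₂ (lemma₃ M)) (expo s₁ (lemma₁ M)))
      ; x⁻y⁻² = ~-trans P-x⁻y⁻² (≈-++ (expo s₂ (lemma₂ M)) (expo s₁ (lemma₀ M)))
      -- Here x^(2M) is trivial and is inserted to agree with the exponent from the other
      -- presentation.
      ; x⁻y⁴ = ~-trans x⁻y⁴-x⁻ (rw (Y (+ 4 - + 2 * M) ∷ []) (periodic s₁ x²ᴹ (- + 1) (lemma₅ M)) [])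
      ; x²ᴹy = ~-trans (rw [] x²ᴹ (Y (+ 1) ∷ [])) (~-sym (rw (Y (+ 1) ∷ []) x²ᴹ []))
      ; x⁴ᴹ = ~-trans (periodic s₁ {j = + 0} x²ᴹ (+ 2) (lemma₄ M)) (mk≈ E-refl)
      ; y⁴ᴹ = yᴺ }
      where
      lemma₀ : ∀ M → - (+ 1 + M) ≡ - + 1 - M
      lemma₀ = solve-∀
      lemma₁ : ∀ M → - (- + 1 + M) ≡ + 1 - M
      lemma₁ = solve-∀
      lemma₂ : ∀ M → + 1 - (+ 3 + M) ≡ - + 2 - M
      lemma₂ = solve-∀
      lemma₃ : ∀ M → - (- + 3 + M) ≡ + 3 - M
      lemma₃ = solve-∀
      lemma₄ : ∀ M → + 4 * M ≡ + 0 + + 2 * (+ 2 * M)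
      lemma₄ = solve-∀
      lemma₅ : ∀ M → - + 1 ≡ + 2 * M - + 1 + (- + 1) * (+ 2 * M)
      lemma₅ = solve-∀

-- Moving x⁻¹ past powers of y

module NormalForm {E : Word → Word → Set} (C : Congruence E) (M : ℤ) (R : Syllabic.Relations C M) where
  open Syllabic C
  open Relations R
  open ≈-Reasoning

  x²ᴹ-central : ∀ e j → X (e * (+ 2 * M)) ∷ Y j ∷ [] ≈ Y j ∷ X (e * (+ 2 * M)) ∷ []
  x²ᴹ-central e j = subst (λ j → X (e * (+ 2 * M)) ∷ Y j ∷ [] ≈ Y j ∷ X (e * (+ 2 * M)) ∷ [])
    (ℤ.*-identityʳ j) (conjugates (commutes x²ᴹy e) j)

  -- Each factor y⁴ passes at the cost of x^(2M), which commutes with y and can be collected at the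
  -- right end.
  x⁻y⁴ᵏ : ∀ k → Σ ℤ λ b → Σ ℤ λ e →
    X (- + 1) ∷ Y (+ (k ℕ.* 4)) ∷ [] ≈ Y b ∷ X (- + 1) ∷ X (e * (+ 2 * M)) ∷ []
  x⁻y⁴ᵏ ℕ.zero = + 0 , + 0 , mk≈ E-refl
  x⁻y⁴ᵏ (ℕ.suc k) with x⁻y⁴ᵏ k
  ... | b , e , eq = + 4 - + 2 * M + b , + 1 + e , (begin
    X (- + 1) ∷ Y (+ (4 ℕ.+ k ℕ.* 4)) ∷ []                 ≈⟨ rw (X (- + 1) ∷ []) (merge s₂ (+ 4) (+ (k ℕ.* 4))) [] ⟨
    X (- + 1) ∷ Y (+ 4) ∷ Y (+ (k ℕ.* 4)) ∷ []             ≈⟨ rw [] x⁻y⁴ (Y (+ (k ℕ.* 4)) ∷ []) ⟩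
    Y c ∷ X (+ 2 * M - + 1) ∷ Y (+ (k ℕ.* 4)) ∷ []         ≈⟨ rw (Y c ∷ []) (mergeTo s₁ (+ 1 * (+ 2 * M)) (- + 1) (lemma₁ M)) (Y (+ (k ℕ.* 4)) ∷ []) ⟨
    Y c ∷ X (+ 1 * (+ 2 * M)) ∷ X (- + 1) ∷ Y (+ (k ℕ.* 4)) ∷ [] ≈⟨ rw (Y c ∷ X (+ 1 * (+ 2 * M)) ∷ []) eq [] ⟩
    Y c ∷ X (+ 1 * (+ 2 * M)) ∷ Y b ∷ X (- + 1) ∷ X (e * (+ 2 * M)) ∷ []
      ≈⟨ rw (Y c ∷ []) (x²ᴹ-central (+ 1) b) (X (- + 1) ∷ X (e * (+ 2 * M)) ∷ []) ⟩
    Y c ∷ Y b ∷ X (+ 1 * (+ 2 * M)) ∷ X (- + 1) ∷ X (e * (+ 2 * M)) ∷ []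
      ≈⟨ rw [] (merge s₂ c b) (X (+ 1 * (+ 2 * M)) ∷ X (- + 1) ∷ X (e * (+ 2 * M)) ∷ []) ⟩
    Y (c + b) ∷ X (+ 1 * (+ 2 * M)) ∷ X (- + 1) ∷ X (e * (+ 2 * M)) ∷ []
      ≈⟨ rw (Y (c + b) ∷ []) (mergeTo s₁ (+ 1 * (+ 2 * M)) (- + 1) (lemma₂ M)) (X (e * (+ 2 * M)) ∷ []) ⟩
    Y (c + b) ∷ X (- + 1 + + 2 * M) ∷ X (e * (+ 2 * M)) ∷ []
      ≈⟨ rw (Y (c + b) ∷ []) (merge s₁ (- + 1) (+ 2 * M)) (X (e * (+ 2 * M)) ∷ []) ⟨
    Y (c + b) ∷ X (- + 1) ∷ X (+ 2 * M) ∷ X (e * (+ 2 * M)) ∷ []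
      ≈⟨ rw (Y (c + b) ∷ X (- + 1) ∷ []) (mergeTo s₁ (+ 2 * M) (e * (+ 2 * M)) (lemma₃ e (+ 2 * M))) [] ⟩
    Y (c + b) ∷ X (- + 1) ∷ X ((+ 1 + e) * (+ 2 * M)) ∷ [] ∎)
    where
    c = + 4 - + 2 * M
    lemma₁ : ∀ M → + 1 * (+ 2 * M) + - + 1 ≡ + 2 * M - + 1
    lemma₁ = solve-∀
    lemma₂ : ∀ M → + 1 * (+ 2 * M) + - + 1 ≡ - + 1 + + 2 * M
    lemma₂ = solve-∀
    lemma₃ : ∀ e a → a + e * a ≡ (+ 1 + e) * a
    lemma₃ = solve-∀

  -- Remainders modulo 4 are taken from -2 to 1, since these are the products for which relations
  -- are at hand.
  x⁻y-small : (r : Fin 4) → Σ ℤ λ b → Σ ℤ λ a → X (- + 1) ∷ Y (+ toℕ r - + 2) ∷ [] ≈ Y b ∷ X a ∷ []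
  x⁻y-small Fin.zero                              = - + 2 - M , - + 1 - M , x⁻y⁻²
  x⁻y-small (Fin.suc Fin.zero)                    = + 1 , + 1 , x⁻y⁻
  x⁻y-small (Fin.suc (Fin.suc Fin.zero))          = + 0 , - + 1 , mk≈ E-refl
  x⁻y-small (Fin.suc (Fin.suc (Fin.suc Fin.zero))) = + 3 - M , + 1 - M , x⁻y

  x⁻yᵇ : ∀ b → Σ ℤ λ j → Σ ℤ λ i → X (- + 1) ∷ Y (+ b) ∷ [] ≈ Y j ∷ X i ∷ []
  x⁻yᵇ b = j , i , (begin
      X (- + 1) ∷ Y (+ b) ∷ []                             ≈⟨ rw (X (- + 1) ∷ []) (mergeTo s₂ (+ (k ℕ.* 4)) (+ toℕ r - + 2) split) [] ⟨
      X (- + 1) ∷ Y (+ (k ℕ.* 4)) ∷ Y (+ toℕ r - + 2) ∷ [] ≈⟨ rw [] eq₁ (Y (+ toℕ r - + 2) ∷ []) ⟩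
      Y b₁ ∷ X (- + 1) ∷ X (e * (+ 2 * M)) ∷ Y (+ toℕ r - + 2) ∷ []
        ≈⟨ rw (Y b₁ ∷ X (- + 1) ∷ []) (x²ᴹ-central e (+ toℕ r - + 2)) [] ⟩
      Y b₁ ∷ X (- + 1) ∷ Y (+ toℕ r - + 2) ∷ X (e * (+ 2 * M)) ∷ [] ≈⟨ rw (Y b₁ ∷ []) eq₂ (X (e * (+ 2 * M)) ∷ []) ⟩
      Y b₁ ∷ Y b₂ ∷ X a ∷ X (e * (+ 2 * M)) ∷ []           ≈⟨ rw [] (merge s₂ b₁ b₂) (X a ∷ X (e * (+ 2 * M)) ∷ []) ⟩
      Y j ∷ X a ∷ X (e * (+ 2 * M)) ∷ []                   ≈⟨ rw (Y j ∷ []) (merge s₁ a (e * (+ 2 * M))) [] ⟩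
      Y j ∷ X i ∷ []                                       ∎)
    where
    k = (b ℕ.+ 2) ℕ./ 4
    r = fromℕ< (ℕ.m%n<n (b ℕ.+ 2) 4)
    b₁ = proj₁ (x⁻y⁴ᵏ k)
    e = proj₁ (proj₂ (x⁻y⁴ᵏ k))
    eq₁ = proj₂ (proj₂ (x⁻y⁴ᵏ k))
    b₂ = proj₁ (x⁻y-small r)
    a = proj₁ (proj₂ (x⁻y-small r))
    eq₂ = proj₂ (proj₂ (x⁻y-small r))
    j = b₁ + b₂
    i = a + e * (+ 2 * M)
    lemma : ∀ k r → k + (r - + 2) ≡ r + k - + 2
    lemma = solve-∀
    lemma′ : ∀ b → b + + 2 - + 2 ≡ b
    lemma′ = solve-∀
    division : + toℕ r + + (k ℕ.* 4) ≡ + b + + 2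
    division = cong +_ (trans (cong (ℕ._+ k ℕ.* 4) (Fin.toℕ-fromℕ< (ℕ.m%n<n (b ℕ.+ 2) 4))) (sym (ℕ.m≡m%n+[m/n]*n (b ℕ.+ 2) 4)))
    split : + (k ℕ.* 4) + (+ toℕ r - + 2) ≡ + b
    split = trans (lemma (+ (k ℕ.* 4)) (+ toℕ r)) (trans (cong (_- + 2) division) (lemma′ (+ b)))

-- Having the same action on vertices, or on faces, is a congruence of words, so soundness of an
-- action reduces to checking the defining relations.
PresEq-least : ∀ {R E} → Congruence E → (∀ {u w} → R u w → E u w) → ∀ {u w} → PresEq R u w → E u w
PresEq-least {R} {E} C rel = go
  where
  open Congruence C
  go : ∀ {u w} → PresEq R u w → E u w
  go ≈-refl        = E-refl
  go (≈-sym p)     = E-sym (go p)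
  go (≈-trans p q) = E-trans (go p) (go q)
  go (≈-cong p q)  = E-cong (go p) (go q)
  go (≈-cancel x)  = E-cancel x
  go (≈-rel r)     = rel r

-- Faithfulness of the action of the mix

G₁ : (p q M : ℕ) → Word → Word → Set
G₁ p q M = Γ p q (-[1+ 0 ] + + M) (-[1+ 2 ] + + M) (+ 1 + + M) (+ 3 + + M)

G₂ : (p M : ℕ) → Word → Word → Set
G₂ p M = Γ p 8 (-[1+ 0 ] + + M) -[1+ 2 ] (+ 1 + + M) (+ 3)

module MixOfGroups (m : ℕ) .{{_ : NonZero m}} (C : Cyclic (4 ℕ.* m)) where
  open Affine m C hiding (R₂)
  open Model m C
  open Symmetries tightData
  open Symmetry
  open Words g₁ g₂

  M : ℕ
  M = m ℕ.* 8

  E₁ E₂ E : Word → Word → Set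
  E₁ = G₁ (2 ℕ.* m ℕ.* 8) (4 ℕ.* m ℕ.* 8) M
  E₂ = G₂ (4 ℕ.* m ℕ.* 8) M
  E = Mix E₁ E₂

  C₁ : Congruence E₁
  C₁ = PresEq-congruence _

  C₂ : Congruence E₂
  C₂ = PresEq-congruence _

  CE : Congruence E
  CE = Mix-congruence C₁ C₂

  4M : + (4 ℕ.* m ℕ.* 8) ≡ + 4 * + M
  4M = trans (cong +_ (ℕ.*-assoc 4 m 8)) (ℤ.pos-* 4 M)

  2M : + (2 ℕ.* m ℕ.* 8) ≡ + 2 * + M
  2M = trans (cong +_ (ℕ.*-assoc 2 m 8)) (ℤ.pos-* 2 M)

  one-syllable : ∀ {E} (C : Congruence E) g {i j} → i ≡ j → E (pow g i) [] → Syllabic._≈_ C ((g , j) ∷ []) []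
  one-syllable {E} C g {i} refl eq = Syllabic.mk≈ (subst (λ w → E w []) (sym (++-identityʳ (pow g i))) eq)

  two-syllables : ∀ {E} (C : Congruence E) u i j → E (ev u) (pow s₁ i ++ pow s₂ j) → Syllabic._≈_ C u (X i ∷ Y j ∷ [])
  two-syllables {E} C u i j eq = Syllabic.mk≈ (subst (λ w → E (ev u) (pow s₁ i ++ w)) (sym (++-identityʳ (pow s₂ j))) eq)

  relations₁ : Syllabic.Relations C₁ (+ M)
  relations₁ = Syllabic.Presentation₁.relations C₁ (+ M) (+ m) (ℤ.pos-* m 8)
    (one-syllable C₁ s₁ 2M (≈-rel rel-p)) (one-syllable C₁ s₂ 4M (≈-rel rel-q))
    (Syllabic.mk≈ (≈-rel rel-12))
    (two-syllables C₁ _ _ _ (≈-rel rel-1)) (two-syllables C₁ _ _ _ (≈-rel rel-2))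

  relations₂ : Syllabic.Relations C₂ (+ M)
  relations₂ = Syllabic.Presentation₂.relations C₂ (+ M) (+ m) (ℤ.pos-* m 8)
    (one-syllable C₂ s₁ 4M (≈-rel rel-p)) (one-syllable C₂ s₂ refl (≈-rel rel-q))
    (Syllabic.mk≈ (≈-rel rel-12))
    (two-syllables C₂ _ _ _ (≈-rel rel-1)) (two-syllables C₂ _ _ _ (≈-rel rel-2))

  relations : Syllabic.Relations CE (+ M)
  relations = record
    { x⁻y⁻  = both R₁.x⁻y⁻ R₂.x⁻y⁻
    ; x⁻y   = both R₁.x⁻y R₂.x⁻y
    ; x⁻y⁻² = both R₁.x⁻y⁻² R₂.x⁻y⁻²
    ; x⁻y⁴  = both R₁.x⁻y⁴ R₂.x⁻y⁴
    ; x²ᴹy  = both R₁.x²ᴹy R₂.x²ᴹy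
    ; x⁴ᴹ   = both R₁.x⁴ᴹ R₂.x⁴ᴹ
    ; y⁴ᴹ   = both R₁.y⁴ᴹ R₂.y⁴ᴹ }
    where
    module R₁ = Syllabic.Relations relations₁
    module R₂ = Syllabic.Relations relations₂
    both : ∀ {s t} → Syllabic._≈_ C₁ s t → Syllabic._≈_ C₂ s t → Syllabic._≈_ CE s t
    both p q = Syllabic.mk≈ (Syllabic.words p , Syllabic.words q)

  open Syllabic CE hiding (Relations; module Presentation; module Presentation₁; module Presentation₂)
  open Syllabic.Relations relations using (x⁴ᴹ; y⁴ᴹ)

  point : ℤ → Point
  point i = fromℕ< (n%ℕd<d i 8) , cls (i /ℕ 8)

  point-mod : ∀ i → Σ ℤ λ k → i ≡ + ⟨ point i ⟩ + k * (+ 4 * + M)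
  point-mod i with val-cls (i /ℕ 8)
  ... | k , eq = - k , (begin
    i                                                       ≡⟨ a≡a%ℕn+[a/ℕn]*n i 8 ⟩
    r + q * + 8                                             ≡⟨ lemma r q k (+ n) ⟩
    r + (q + k * + n) * + 8 + (- k) * (+ n * + 8)           ≡⟨ cong₂ (λ a b → r + a * + 8 + (- k) * b) (sym eq) (trans (sym (ℤ.pos-* n 8)) 4M) ⟩
    r + + val (cls q) * + 8 + (- k) * (+ 4 * + M)           ≡⟨ cong₂ (λ a b → a + b + (- k) * (+ 4 * + M)) (cong +_ (sym (Fin.toℕ-fromℕ< (n%ℕd<d i 8)))) (sym (ℤ.pos-* (val (cls q)) 8)) ⟩
    + ⟨ point i ⟩ + (- k) * (+ 4 * + M)                     ∎)
    where
    open ≡-Reasoning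
    r = + (i %ℕ 8)
    q = i /ℕ 8
    lemma : ∀ r q k n → r + q * + 8 ≡ r + (q + k * n) * + 8 + (- k) * (n * + 8)
    lemma = solve-∀

  normal : Point → Point → Syllables
  normal f v = Y (+ ⟨ f ⟩) ∷ X (+ ⟨ v ⟩) ∷ []

  -- Exponents are kept as points, hence modulo N, so that the points read off from the action
  -- determine the word itself.
  NF : Word → Set
  NF u = Σ Point λ f → Σ Point λ v → E u (ev (normal f v))

  reduce : ∀ {u} j i → E u (ev (Y j ∷ X i ∷ [])) → NF u
  reduce j i eq = point j , point i , E-trans eq (words (≈-++
    (periodic s₂ {j = + ⟨ point j ⟩} y⁴ᴹ (proj₁ (point-mod j)) (proj₂ (point-mod j)))
    (periodic s₁ {j = + ⟨ point i ⟩} x⁴ᴹ (proj₁ (point-mod i)) (proj₂ (point-mod i)))))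

  NF-resp : ∀ {u w} → E u w → NF w → NF u
  NF-resp eq (f , v , eq′) = f , v , E-trans eq eq′

  NF-x⁻ : ∀ {u} → NF u → NF (x⁻ ∷ u)
  NF-x⁻ {u} (f , v , eq) = extend (NormalForm.x⁻yᵇ CE (+ M) relations ⟨ f ⟩)
    where
    extend : (Σ ℤ λ j → Σ ℤ λ i → X (- + 1) ∷ Y (+ ⟨ f ⟩) ∷ [] ≈ Y j ∷ X i ∷ []) → NF (x⁻ ∷ u)
    extend (j , i , eq′) = reduce j (i + + ⟨ v ⟩) (E-trans (E-cong {u = x⁻ ∷ []} E-refl eq)
      (words (~-trans (rw [] eq′ (X (+ ⟨ v ⟩) ∷ [])) (rw (Y j ∷ []) (merge s₁ i (+ ⟨ v ⟩)) []))))

  NF-x⁻-power : ∀ k {u} → NF u → NF (replicate k x⁻ ++ u)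
  NF-x⁻-power ℕ.zero    p = p
  NF-x⁻-power (ℕ.suc k) p = NF-x⁻ (NF-x⁻-power k p)

  NF-y : ∀ k {u} → NF u → NF (pow s₂ k ++ u)
  NF-y k (f , v , eq) = reduce (k + + ⟨ f ⟩) (+ ⟨ v ⟩) (E-trans (E-cong E-refl eq)
    (words (rw [] (merge s₂ k (+ ⟨ f ⟩)) (X (+ ⟨ v ⟩) ∷ []))))

  negative-power : ∀ k → pow s₁ (- + k) ≡ replicate k x⁻
  negative-power ℕ.zero    = refl
  negative-power (ℕ.suc k) = refl

  -- Only x⁻¹ has rules for passing powers of y; finite order reduces x to that case.
  x-as-x⁻-power : Σ ℕ λ k → E (x ∷ []) (replicate k x⁻)
  x-as-x⁻-power with point-mod (- + 1)
  -- The exponent is a natural representative of -1 modulo N, and x equals the power of x⁻¹ with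
  -- that exponent.
  ... | l , eq = ⟨ p ⟩ , subst (E (x ∷ [])) (trans (++-identityʳ (pow s₁ (- + ⟨ p ⟩))) (negative-power ⟨ p ⟩))
    (words (periodic s₁ {i = + 1} {j = - + ⟨ p ⟩} x⁴ᴹ (- l) (trans (cong -_ eq) (lemma (+ ⟨ p ⟩) l (+ 4 * + M)))))
    where
    p = point (- + 1)
    lemma : ∀ a l b → - (a + l * b) ≡ - a + (- l) * b
    lemma = solve-∀

  normalise : ∀ u → NF u
  normalise []                 = reduce (+ 0) (+ 0) E-refl
  normalise ((s₁ , true) ∷ u)  = NF-x⁻ (normalise u)
  normalise ((s₁ , false) ∷ u) =
    NF-resp (E-cong (proj₂ x-as-x⁻-power) E-refl) (NF-x⁻-power (proj₁ x-as-x⁻-power) (normalise u))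
  normalise ((s₂ , false) ∷ u) = NF-y (+ 1) (normalise u)
  normalise ((s₂ , true) ∷ u)  = NF-y (- + 1) (normalise u)

  _~V_ _~F_ : Word → Word → Set
  u ~V w = ∀ v → actV u v ≡ actV w v
  u ~F w = ∀ f → actF u f ≡ actF w f

  cancelV : ∀ ℓ v → actV (ℓ ∷ inv ℓ ∷ []) v ≡ v
  cancelV (s₁ , false) = mV-iV g₁
  cancelV (s₁ , true)  = iV-mV g₁
  cancelV (s₂ , false) = mV-iV g₂
  cancelV (s₂ , true)  = iV-mV g₂

  cancelF : ∀ ℓ f → actF (ℓ ∷ inv ℓ ∷ []) f ≡ f
  cancelF (s₁ , false) = mF-iF g₁
  cancelF (s₁ , true)  = iF-mF g₁
  cancelF (s₂ , false) = mF-iF g₂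
  cancelF (s₂ , true)  = iF-mF g₂

  V-congruence : Congruence _~V_
  V-congruence = record
    { E-refl = λ _ → refl ; E-sym = λ p v → sym (p v) ; E-trans = λ p q v → trans (p v) (q v)
    ; E-cong = λ {u} {u′} {w} {w′} p q v → trans (actV-++ u w v)
        (trans (p (actV w v)) (trans (cong (actV u′) (q v)) (sym (actV-++ u′ w′ v))))
    ; E-cancel = cancelV }

  F-congruence : Congruence _~F_
  F-congruence = record
    { E-refl = λ _ → refl ; E-sym = λ p f → sym (p f) ; E-trans = λ p q f → trans (p f) (q f)
    ; E-cong = λ {u} {u′} {w} {w′} p q f → trans (actF-++ u w f)
        (trans (p (actF w f)) (trans (cong (actF u′) (q f)) (sym (actF-++ u′ w′ f))))
    ; E-cancel = cancelF }

  E₂-sound : ∀ {u w} → E₂ u w → u ~V w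
  E₂-sound = PresEq-least V-congruence relation
    where
    -- Equality of vertex actions is itself a congruence, so the generic law `pow-+` merges x^i with
    -- x^M here.
    powers : ∀ i j v → actV (pow s₁ i) (actV Xᴹ (actV (pow s₂ j) v)) ≡ actV (pow s₁ (i + + M) ++ pow s₂ j) v
    powers i j v = trans (sym (actV-++ (pow s₁ i) Xᴹ _)) (trans
      (Syllabic.pow-+ V-congruence s₁ i (+ M) (actV (pow s₂ j) v))
      (sym (actV-++ (pow s₁ (i + + M)) (pow s₂ j) v)))
    relation : ∀ {u w} → GammaRel (4 ℕ.* m ℕ.* 8) 8 (-[1+ 0 ] + + M) -[1+ 2 ] (+ 1 + + M) (+ 3) u w → u ~V w
    relation rel-p  v = actV-xᴺ v
    relation rel-q  v = actV-y⁸ v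
    relation rel-12 v = cong proj₁ (xyxy-identity (v , o))
    relation rel-1  v = trans (cong proj₁ (relation-1 (v , o)))
      (trans (cong (λ v → actV (x⁻ ∷ []) (actV Xᴹ (actV (y⁻ ∷ y⁻ ∷ y⁻ ∷ []) v))) (actV-Yᴹ v)) (powers -[1+ 0 ] -[1+ 2 ] v))
    relation rel-2  v = trans (cong proj₁ (relation-2 (v , o)))
      (trans (cong (λ v → actV (x ∷ []) (actV Xᴹ (actV (y ∷ y ∷ y ∷ []) v))) (actV-Yᴹ v)) (powers (+ 1) (+ 3) v))

  E₁-sound : ∀ {u w} → E₁ u w → u ~F w
  E₁-sound = PresEq-least F-congruence relation
    where
    powers : ∀ i j f → actF (pow s₁ i) (actF Xᴹ (actF (pow s₂ j) (actF Yᴹ f))) ≡ actF (pow s₁ (i + + M) ++ pow s₂ (j + + M)) f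
    powers i j f = begin
      actF (pow s₁ i) (actF Xᴹ (actF (pow s₂ j) (actF Yᴹ f)))  ≡⟨ actF-++ (pow s₁ i) Xᴹ _ ⟨
      actF (pow s₁ i ++ Xᴹ) (actF (pow s₂ j) (actF Yᴹ f))      ≡⟨ Syllabic.pow-+ F-congruence s₁ i (+ M) _ ⟩
      actF (pow s₁ (i + + M)) (actF (pow s₂ j) (actF Yᴹ f))    ≡⟨ cong (actF (pow s₁ (i + + M))) (actF-++ (pow s₂ j) Yᴹ f) ⟨
      actF (pow s₁ (i + + M)) (actF (pow s₂ j ++ Yᴹ) f)        ≡⟨ cong (actF (pow s₁ (i + + M))) (Syllabic.pow-+ F-congruence s₂ j (+ M) f) ⟩
      actF (pow s₁ (i + + M)) (actF (pow s₂ (j + + M)) f)      ≡⟨ actF-++ (pow s₁ (i + + M)) (pow s₂ (j + + M)) f ⟨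
      actF (pow s₁ (i + + M) ++ pow s₂ (j + + M)) f            ∎
      where open ≡-Reasoning
    relation : ∀ {u w} → GammaRel (2 ℕ.* m ℕ.* 8) (4 ℕ.* m ℕ.* 8) (-[1+ 0 ] + + M) (-[1+ 2 ] + + M) (+ 1 + + M) (+ 3 + + M) u w → u ~F w
    relation rel-p  f = actF-x²ᴹ f
    relation rel-q  f = actF-yᴺ f
    relation rel-12 f = cong proj₂ (xyxy-identity (o , f))
    relation rel-1  f = trans (cong proj₂ (relation-1 (o , f))) (powers -[1+ 0 ] -[1+ 2 ] f)
    relation rel-2  f = trans (cong proj₂ (relation-2 (o , f))) (powers (+ 1) (+ 3) f)

  normal-word : ∀ f v → ev (normal f v) ≡ replicate ⟨ f ⟩ y ++ replicate ⟨ v ⟩ x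
  normal-word f v = cong (replicate ⟨ f ⟩ y ++_) (++-identityʳ (replicate ⟨ v ⟩ x))

  normal-F : ∀ f v → actF (ev (normal f v)) o ≡ f
  normal-F f v = trans (cong (λ u → actF u o) (normal-word f v))
    (trans (actF-++ (replicate ⟨ f ⟩ y) (replicate ⟨ v ⟩ x) o)
      (trans (cong (actF (replicate ⟨ f ⟩ y)) (x-power-fixes-oF ⟨ v ⟩)) (y-reaches f)))

  normal-V : ∀ f v → actV (ev (normal f v)) o ≡ actV (replicate ⟨ f ⟩ y) v
  normal-V f v = trans (cong (λ u → actV u o) (normal-word f v))
    (trans (actV-++ (replicate ⟨ f ⟩ y) (replicate ⟨ v ⟩ x) o) (cong (actV (replicate ⟨ f ⟩ y)) (x-reaches v)))

  -- Since σ₁ fixes the base face, the image of that face is the point encoding the exponent of σ₂.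
  -- The image of the base vertex then yields the other exponent, after undoing the common power of
  -- σ₂.
  faithful : ∀ u w → E u w ⇔ (u ~V w × u ~F w)
  faithful u w = mk⇔ (λ (p , q) → E₂-sound q , E₁-sound p) λ (eqV , eqF) → complete eqV eqF (normalise u) (normalise w)
    where
    complete : u ~V w → u ~F w → NF u → NF w → E u w
    complete eqV eqF (f , v , p@(p₁ , p₂)) (f′ , v′ , q@(q₁ , q₂)) =
      E-trans p (E-trans (subst₂ (λ f v → E (ev (normal f v)) (ev (normal f′ v′))) (sym f≡) (sym v≡) E-refl) (E-sym q))
      where
      open ≡-Reasoning
      f≡ : f ≡ f′
      f≡ = begin
        f                           ≡⟨ normal-F f v ⟨
        actF (ev (normal f v)) o    ≡⟨ E₁-sound p₁ o ⟨
        actF u o                    ≡⟨ eqF o ⟩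
        actF w o                    ≡⟨ E₁-sound q₁ o ⟩
        actF (ev (normal f′ v′)) o  ≡⟨ normal-F f′ v′ ⟩
        f′                          ∎
      images : actV (replicate ⟨ f ⟩ y) v ≡ actV (replicate ⟨ f ⟩ y) v′
      images = begin
        actV (replicate ⟨ f ⟩ y) v   ≡⟨ normal-V f v ⟨
        actV (ev (normal f v)) o     ≡⟨ E₂-sound p₂ o ⟨
        actV u o                     ≡⟨ eqV o ⟩
        actV w o                     ≡⟨ E₂-sound q₂ o ⟩
        actV (ev (normal f′ v′)) o   ≡⟨ normal-V f′ v′ ⟩
        actV (replicate ⟨ f′ ⟩ y) v′ ≡⟨ cong (λ f → actV (replicate ⟨ f ⟩ y) v′) f≡ ⟨
        actV (replicate ⟨ f ⟩ y) v′  ∎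
      v≡ : v ≡ v′
      v≡ = trans (sym (iV-mV g v)) (trans (cong (iV g) images) (iV-mV g v′))
        where g = wordSym (replicate ⟨ f ⟩ y)

  points : Point ↔ Fin (8 ℕ.* (4 ℕ.* m))
  points = ↔-trans (↔-refl ×-↔ A↔Fin) (↔-sym Fin.*↔×)

  tight-chiral : ∀ {p} → 8 ℕ.* (4 ℕ.* m) ≡ p →
    Σ Poset3 λ P → IsPolyhedron P × HasType P p p × Tight P p p × Chiral P × IsAutGroupOf P E
  tight-chiral refl = Polyhedron.𝒫 tightData , isPolyhedron , hasType points points , tight points points , chiral , isAutGroup E faithful
    where
    open ChiralPolyhedron chiralData
    open Polyhedron tightData using (hasType; tight)

-- Specialisation to m = 2^(α-5)

Γ₁≡G₁ : ∀ β → Γ₁ (5 ℕ.+ β) ≡ G₁ (2 ℕ.* 2 ^ β ℕ.* 8) (4 ℕ.* 2 ^ β ℕ.* 8) (2 ^ β ℕ.* 8)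
Γ₁≡G₁ β = begin
  G₁ (2 ^ (4 ℕ.+ β)) (2 ^ (5 ℕ.+ β)) (2 ^ (3 ℕ.+ β)) ≡⟨ cong₂ (λ p q → G₁ p q (2 ^ (3 ℕ.+ β))) (lemma₄ (2 ^ β)) (lemma₅ (2 ^ β)) ⟩
  G₁ (2 ℕ.* 2 ^ β ℕ.* 8) (4 ℕ.* 2 ^ β ℕ.* 8) (2 ^ (3 ℕ.+ β)) ≡⟨ cong (G₁ (2 ℕ.* 2 ^ β ℕ.* 8) (4 ℕ.* 2 ^ β ℕ.* 8)) (lemma₃ (2 ^ β)) ⟩
  G₁ (2 ℕ.* 2 ^ β ℕ.* 8) (4 ℕ.* 2 ^ β ℕ.* 8) (2 ^ β ℕ.* 8) ∎
  where
  open ≡-Reasoning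
  lemma₃ : ∀ m → 2 ℕ.* (2 ℕ.* (2 ℕ.* m)) ≡ m ℕ.* 8
  lemma₃ = ℕSolver.solve-∀
  lemma₄ : ∀ m → 2 ℕ.* (2 ℕ.* (2 ℕ.* (2 ℕ.* m))) ≡ 2 ℕ.* m ℕ.* 8
  lemma₄ = ℕSolver.solve-∀
  lemma₅ : ∀ m → 2 ℕ.* (2 ℕ.* (2 ℕ.* (2 ℕ.* (2 ℕ.* m)))) ≡ 4 ℕ.* m ℕ.* 8
  lemma₅ = ℕSolver.solve-∀

Γ₂≡G₂ : ∀ β → Γ₂ (5 ℕ.+ β) ≡ G₂ (4 ℕ.* 2 ^ β ℕ.* 8) (2 ^ β ℕ.* 8)
Γ₂≡G₂ β = cong₂ G₂ (lemma₅ (2 ^ β)) (lemma₃ (2 ^ β))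
  where
  lemma₃ : ∀ m → 2 ℕ.* (2 ℕ.* (2 ℕ.* m)) ≡ m ℕ.* 8
  lemma₃ = ℕSolver.solve-∀
  lemma₅ : ∀ m → 2 ℕ.* (2 ℕ.* (2 ℕ.* (2 ℕ.* (2 ℕ.* m)))) ≡ 4 ℕ.* m ℕ.* 8
  lemma₅ = ℕSolver.solve-∀

theorem3p12 : (α : ℕ) → 5 ≤ α →
    Σ Poset3 λ P →
    IsPolyhedron P
    × HasType P (2 ^ α) (2 ^ α)
    × Tight P (2 ^ α) (2 ^ α)
    × Chiral P
    × IsAutGroupOf P (Mix (Γ₁ α) (Γ₂ α))
theorem3p12 _ (s≤s (s≤s (s≤s (s≤s (s≤s (z≤n {β})))))) = subst₂
  (λ E₁ E₂ → Σ Poset3 λ P → IsPolyhedron P × HasType P N N × Tight P N N × Chiral P × IsAutGroupOf P (Mix E₁ E₂))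
  (sym (Γ₁≡G₁ β)) (sym (Γ₂≡G₂ β)) (MixOfGroups.tight-chiral m (cyclic (4 ℕ.* m)) (lemma m))
  where
  m = 2 ^ β
  N = 2 ^ (5 ℕ.+ β)
  instance
    m≢0 : NonZero m
    m≢0 = ℕ.m^n≢0 2 β
    4m≢0 : NonZero (4 ℕ.* m)
    4m≢0 = ℕ.m*n≢0 4 m
  lemma : ∀ m → 8 ℕ.* (4 ℕ.* m) ≡ 2 ℕ.* (2 ℕ.* (2 ℕ.* (2 ℕ.* (2 ℕ.* m))))
  lemma = ℕSolver.solve-∀
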